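{- Let $H$ be a real symmetric matrix indexed by a finite set $V$, let $a,b\in V$ be distinct, and suppose that \[ \operatorname{supp}_H(e_a)\cup\operatorname{supp}_H(e_b)\subseteq c\mathbb Z\qquad\text{for some real } c>0. \] Then for every $k\in\mathbb N^+$: if $k$ is odd, $H^k$ has PST from $a$ to $b$ if and only if $H$ has PST from $a$ to $b$; if $k$ is even, $H^k$ has PST from $a$ to $b$ if and only if $H^2$ has PST from $a$ to $b$. Consequently, \[ \mathcal K(H;a,b)\in\{\varnothing,\ 2\mathbb N+1,\ 2\mathbb N^+,\ \mathbb N^+\}. \]
   Context: $\mathbb N=\{0,1,2,\ldots\}$ and $\mathbb N^+=\{1,2,3,\ldots\}$. For a finite set $V$, $e_v$ denotes the standard basis vector indexed by $v\in V$. For a real symmetric matrix $H$ indexed by $V$ with spectral decomposition $H=\sum_{\lambda\in\operatorname{Spec}(H)}\lambda E_\lambda$ ($E_\lambda$ the orthogonal projection onto the $\lambda$-eigenspace), and a vector $x$, put $\operatorname{supp}_H(x)=\{\lambda\in\operatorname{Spec}(H):E_\lambda x\neq 0\}$. A real symmetric matrix $K$ has perfect state transfer (PST) from $a$ to $b$ at time $\tau>0$ if $\exp(-\mathrm i\tau K)e_a=\gamma e_b$ for some $\gamma\in\mathbb C$ with $|\gamma|=1$; $K$ has PST from $a$ to $b$ if this holds for some $\tau>0$. $\mathcal K(H;a,b)=\{k\in\mathbb N^+: H^k\text{ has PST from }a\text{ to }b\}$. -}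

module Defs where

open import Level using (0ℓ; suc)
open import Algebra.Bundles using (CommutativeRing)
open import Algebra.Bundles.Raw using (RawRing)
import Algebra.Definitions.RawSemiring as RawSemiringDefinitions
open import Data.Bool.Base using (if_then_else_)
open import Data.Fin.Base using (Fin)
open import Data.Fin.Properties using (_≟_)
open import Data.Integer.Base using (ℤ; +_; -[1+_])
open import Data.Nat.Base as ℕ using (ℕ; zero; _!)
open import Data.Product.Base using (_×_; ∃; Σ-syntax; ∃-syntax)
open import Data.Vec.Functional using (Vector)
open import Relation.Binary.Core using (Rel)
open import Relation.Binary.PropositionalEquality.Core using (_≡_)
open import Relation.Binary.Structures using (IsTotalOrder)
open import Relation.Nullary.Decidable.Core using (does)
open import Relation.Nullary.Negation.Core using (¬_)
open import Relation.Unary using (Pred; _∈_)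

-- The standard library has no real numbers.  ℝ is taken to be an arbitrary
-- Dedekind-complete ordered field; classically there is exactly one up to
-- isomorphism.
record Reals : Set (suc 0ℓ) where
  field
    commutativeRing : CommutativeRing 0ℓ 0ℓ

  open CommutativeRing commutativeRing public

  infix 4 _≤_ _<_
  infix 9 _⁻¹

  field
    1≉0          : ¬ (1# ≈ 0#)
    -- The value of 0# ⁻¹ is irrelevant: only nonzero elements are inverted below.
    _⁻¹          : Carrier → Carrier
    ⁻¹-inverseʳ  : ∀ x → ¬ (x ≈ 0#) → x * x ⁻¹ ≈ 1#
    _≤_          : Rel Carrier 0ℓ
    isTotalOrder : IsTotalOrder _≈_ _≤_
    +-monoʳ-≤    : ∀ x {y z} → y ≤ z → x + y ≤ x + z
    *-nonneg     : ∀ {x y} → 0# ≤ x → 0# ≤ y → 0# ≤ x * y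

  UpperBound : Pred Carrier 0ℓ → Pred Carrier 0ℓ
  UpperBound P u = ∀ x → x ∈ P → x ≤ u

  field
    supremum : (P : Pred Carrier 0ℓ) → ∃ P → ∃ (UpperBound P) →
               ∃[ s ] (s ∈ UpperBound P × (∀ u → u ∈ UpperBound P → s ≤ u))

  _<_ : Rel Carrier 0ℓ
  x < y = x ≤ y × ¬ (x ≈ y)

module Matrices {c ℓ} (R : RawRing c ℓ) where
  open RawRing R
  open RawSemiringDefinitions rawSemiring using (sum)

  Vec : ℕ → Set c
  Vec n = Vector Carrier n

  Matrix : ℕ → Set c
  Matrix n = Fin n → Fin n → Carrier

  infix  4 _≋_
  infixl 6 _+ᴹ_
  infixl 7 _*ᴹ_ _*ᵛ_ _·ᴹ_ _·ᵛ_
  infixr 8 _^ᴹ_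

  _≋_ : ∀ {n} → Rel (Vec n) ℓ
  x ≋ y = ∀ i → x i ≈ y i

  0ᵛ : ∀ {n} → Vec n
  0ᵛ _ = 0#

  e : ∀ {n} → Fin n → Vec n
  e v i = if does (v ≟ i) then 1# else 0#

  _·ᵛ_ : ∀ {n} → Carrier → Vec n → Vec n
  (r ·ᵛ x) i = r * x i

  _-ᵛ_ : ∀ {n} → Vec n → Vec n → Vec n
  (x -ᵛ y) i = x i + - (y i)

  -- Only used over ℝ, where it is the standard inner product.
  ⟨_,_⟩ : ∀ {n} → Vec n → Vec n → Carrier
  ⟨ x , y ⟩ = sum λ i → x i * y i

  Symmetric : ∀ {n} → Matrix n → Set ℓ
  Symmetric A = ∀ i j → A i j ≈ A j i

  0ᴹ : ∀ {n} → Matrix n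
  0ᴹ _ _ = 0#

  1ᴹ : ∀ {n} → Matrix n
  1ᴹ = e

  _+ᴹ_ : ∀ {n} → Matrix n → Matrix n → Matrix n
  (A +ᴹ B) i j = A i j + B i j

  _·ᴹ_ : ∀ {n} → Carrier → Matrix n → Matrix n
  (r ·ᴹ A) i j = r * A i j

  _*ᴹ_ : ∀ {n} → Matrix n → Matrix n → Matrix n
  (A *ᴹ B) i j = sum λ k → A i k * B k j

  _*ᵛ_ : ∀ {n} → Matrix n → Vec n → Vec n
  (A *ᵛ x) i = sum λ j → A i j * x j

  _^ᴹ_ : ∀ {n} → Matrix n → ℕ → Matrix n
  A ^ᴹ zero    = 1ᴹ
  A ^ᴹ ℕ.suc k = A *ᴹ (A ^ᴹ k)

ℕ⁺ : Pred ℕ 0ℓ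
ℕ⁺ k = 1 ℕ.≤ k

2ℕ+1 : Pred ℕ 0ℓ
2ℕ+1 k = ∃[ m ] k ≡ 2 ℕ.* m ℕ.+ 1

2ℕ⁺ : Pred ℕ 0ℓ
2ℕ⁺ k = ∃[ m ] (m ∈ ℕ⁺ × k ≡ 2 ℕ.* m)

module Theory (ℝ : Reals) where
  open Reals ℝ
  open RawSemiringDefinitions (RawRing.rawSemiring rawRing) using () renaming (_×_ to _×ᴺ_)

  fromℕ : ℕ → Carrier
  fromℕ n = n ×ᴺ 1#

  fromℤ : ℤ → Carrier
  fromℤ (+ n)    = fromℕ n
  fromℤ -[1+ n ] = - fromℕ (ℕ.suc n)

  _·ℤ : Carrier → Pred Carrier 0ℓ
  (c ·ℤ) x = Σ[ m ∈ ℤ ] x ≈ c * fromℤ m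

  record ℂ : Set where
    constructor _+i_
    field
      re im : Carrier

  open ℂ public

  infix 4 _≈ᶜ_

  _≈ᶜ_ : Rel ℂ 0ℓ
  z ≈ᶜ w = re z ≈ re w × im z ≈ im w

  ℂ-rawRing : RawRing 0ℓ 0ℓ
  ℂ-rawRing = record
    { Carrier = ℂ
    ; _≈_     = _≈ᶜ_
    ; _+_     = λ z w → (re z + re w) +i (im z + im w)
    ; _*_     = λ z w → (re z * re w - im z * im w) +i (re z * im w + im z * re w)
    ; -_      = λ z → (- re z) +i (- im z)
    ; 0#      = 0# +i 0#
    ; 1#      = 1# +i 0#
    }

  ofℝ : Carrier → ℂ
  ofℝ x = x +i 0#

  ∣_∣² : ℂ → Carrier
  ∣ z ∣² = re z * re z + im z * im z

  -- ∣z∣ is the nonnegative square root of ∣ z ∣²; these say ∣z∣ = r and ∣z∣ < r.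
  ∣_∣≈_ : ℂ → Carrier → Set
  ∣ z ∣≈ r = 0# ≤ r × ∣ z ∣² ≈ r * r

  ∣_∣<_ : ℂ → Carrier → Set
  ∣ z ∣< r = 0# < r × ∣ z ∣² < r * r

  module ℂᴿ = RawRing ℂ-rawRing
  module Mᴿ = Matrices rawRing
  module Mᶜ = Matrices ℂ-rawRing

  _⟶_ : (ℕ → ℂ) → ℂ → Set
  s ⟶ z = ∀ ε → 0# < ε → ∃[ N ] (∀ n → N ℕ.≤ n → ∣ s n ℂᴿ.+ (ℂᴿ.- z) ∣< ε)

  expPartialSum : ∀ {n} → Mᶜ.Matrix n → ℕ → Mᶜ.Matrix n
  expPartialSum A zero      = Mᶜ.0ᴹ
  expPartialSum A (ℕ.suc N) =
    expPartialSum A N Mᶜ.+ᴹ (ofℝ (fromℕ (N !) ⁻¹) Mᶜ.·ᴹ (A Mᶜ.^ᴹ N))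

  -- U is exp A = Σ_k A^k / k!.  Limits are unique, so a relation determines it.
  IsExp : ∀ {n} → Mᶜ.Matrix n → Mᶜ.Matrix n → Set
  IsExp A U = ∀ i j → (λ N → expPartialSum A N i j) ⟶ U i j

  -iτ : Carrier → ℂ
  -iτ τ = 0# +i (- τ)

  complexify : ∀ {n} → Mᴿ.Matrix n → Mᶜ.Matrix n
  complexify K i j = ofℝ (K i j)

  PSTAt : ∀ {n} → Mᴿ.Matrix n → Fin n → Fin n → Carrier → Set
  PSTAt K a b τ =
    ∃[ U ] (IsExp (-iτ τ Mᶜ.·ᴹ complexify K) U ×
            ∃[ γ ] (∣ γ ∣≈ 1# × (U Mᶜ.*ᵛ Mᶜ.e a) Mᶜ.≋ (γ Mᶜ.·ᵛ Mᶜ.e b)))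

  PST : ∀ {n} → Mᴿ.Matrix n → Fin n → Fin n → Set
  PST K a b = ∃[ τ ] (0# < τ × PSTAt K a b τ)

  open Mᴿ

  Eigenspace : ∀ {n} → Matrix n → Carrier → Pred (Vec n) 0ℓ
  Eigenspace H μ x = H *ᵛ x ≋ μ ·ᵛ x

  Spec : ∀ {n} → Matrix n → Pred Carrier 0ℓ
  Spec H μ = ∃[ x ] (¬ (x ≋ 0ᵛ) × x ∈ Eigenspace H μ)

  -- E is the orthogonal projection onto the μ-eigenspace; these two conditions
  -- determine it uniquely.
  record IsEigenprojection {n} (H : Matrix n) (μ : Carrier) (E : Matrix n) : Set where
    field
      range    : ∀ x → (E *ᵛ x) ∈ Eigenspace H μ
      residual : ∀ x y → y ∈ Eigenspace H μ → ⟨ x -ᵛ (E *ᵛ x) , y ⟩ ≈ 0#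

  supp : ∀ {n} → Matrix n → Vec n → Pred Carrier 0ℓ
  supp H x μ = μ ∈ Spec H × ∃[ E ] (IsEigenprojection H μ E × ¬ (E *ᵛ x ≋ 0ᵛ))

  𝒦 : ∀ {n} → Matrix n → Fin n → Fin n → Pred ℕ 0ℓ
  𝒦 H a b k = k ∈ ℕ⁺ × PST (H ^ᴹ k) a b

{-# OPTIONS --safe #-}

-- Write p_λ = E_λ e_a and q_λ = E_λ e_b.  Eigenvectors for distinct eigenvalues
-- are independent, so H^k has PST at time τ with phase γ iff
-- e^{-iτλ^k} p_λ = γ q_λ for all λ.  As p_λ and q_λ are real, this forces
-- q_λ = ± p_λ, with both signs occurring because e_b ≠ ± e_a.  Put λ = c m_λ with
-- integers m_λ, scaled so that some m₀ is odd, let d_λ = m_λ^k - m₀^k and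
-- z = e^{-iτc^k}.  Then PST says that z^{d_λ} is the prescribed sign for all λ.
-- Since some sign is -1, z is a root of unity; replacing τ by an odd multiple of
-- it, which changes no sign, makes the order of z a power of 2.  Now odd factors
-- in the exponents d_λ are irrelevant.  For odd k, d_λ is an odd multiple of
-- m_λ - m₀.  For k = 2j with all m_λ odd, d_λ is 2^t times an odd multiple of
-- m_λ² - m₀², where t is the 2-adic valuation of j, and 2^t is absorbed into τ;
-- if some m_λ is even, z = ±1 and only the parity of d_λ matters.
--
-- The spectral theorem is obtained by deflation: on the range of a projector
-- commuting with H, the supremum μ of the lower bounds of the quadratic form is an
-- eigenvalue, since otherwise H - μ would be coercive there.
-- The exponential exists by comparison with a bounded real series, and is
-- multiplicative because the error of the triangular Cauchy product is dominated
-- by the same error for the majorants.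
module Submission where

open import Defs
open import Algebra.Bundles using (CommutativeRing)
import Algebra.Properties.AbelianGroup as AbelianGroupProperties
import Algebra.Properties.Monoid.Mult.TCOptimised as MonoidMultTCOptimised
import Algebra.Properties.Ring as RingProperties
import Algebra.Properties.Semiring.Exp as SemiringExp
import Algebra.Properties.Semiring.Mult as SemiringMult
import Algebra.Properties.Semiring.Sum as SemiringSum
import Algebra.Solver.Ring as RingSolver
open import Algebra.Solver.Ring.AlmostCommutativeRing
  using (fromCommutativeRing; _-Raw-AlmostCommutative⟶_)
open import Axiom.ExcludedMiddle using (ExcludedMiddle)
open import Data.Fin.Base using (Fin; zero; suc)
import Data.Fin.Properties as Fin
open import Data.Integer.Base as ℤ using (ℤ; +_; -[1+_])
import Data.Integer.DivMod as ℤ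
import Data.Integer.Properties as ℤ
import Data.Integer.Solver as ℤSolver
open import Data.Maybe.Base using (Maybe; just; nothing)
open import Data.Nat.Base as ℕ using (ℕ; zero; suc; _⊔_; _!)
open import Data.Nat.Induction using (<-rec)
import Data.Nat.Properties as ℕ
import Data.Nat.Solver as ℕSolver
open import Data.Product.Base using (_×_; _,_; proj₁; proj₂; ∃; ∃-syntax; Σ-syntax)
open import Data.Sum.Base using (_⊎_; inj₁; inj₂; [_,_]′)
open import Function.Base using (_∘_)
open import Function.Bundles using (_⇔_; mk⇔; Equivalence)
open import Level using (0ℓ)
open import Relation.Binary.PropositionalEquality.Core as ≡ using (_≡_; _≢_)
import Relation.Binary.PropositionalEquality.Properties as ≡
import Relation.Binary.Reasoning.Setoid as SetoidReasoning
open import Relation.Binary.Structures using (IsTotalOrder)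
open import Relation.Nullary.Decidable.Core using (Dec; yes; no; decidable-stable)
open import Relation.Nullary.Negation.Core using (¬_; contradiction)
open import Relation.Unary using (Pred; _∈_; _⊆_; _∪_; _≐_; ∅)

-- Ring solver with integer coefficients

-- One single time has to meet the sign conditions of all eigenvalues, while the odd cofactor of
-- `d k i` over `d 1 i` or `d 2 i` varies with `i`. Such a cofactor cannot be absorbed into the
-- time. It can only be made harmless, which is what an order that is a power of 2 achieves. The
-- factor 2^t, by contrast, is common to all `i`, and a real time can be multiplied or divided by
-- it; division plays the role of extracting a root of z. For this reason the arithmetic is done
-- with the homomorphism x ↦ exp(-ix) on ℝ rather than with powers of z. A common 2^t is available
-- when all the integers are odd: their squares are 1 mod 4, so each doubling of the exponent adds
-- exactly one factor 2. An even integer beside the odd m₀ has an odd difference at every positive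
-- exponent, hence the separate parity argument. The odd m₀ also comes from the sign -1: two active
-- eigenvalues differ, so one of them is nonzero, and halving all the integers must stop.

module IntegerCoefficients {c ℓ} (R : CommutativeRing c ℓ) where
  open CommutativeRing R
  open SemiringMult semiring renaming (_×_ to _×ᵤ_)
  open MonoidMultTCOptimised +-monoid using (×ᵤ≈×) renaming (_×_ to _×′_)
  open AbelianGroupProperties +-abelianGroup using (ε⁻¹≈ε; ⁻¹-∙-comm; ⁻¹-involutive)
  open RingProperties ring using (-‿distribˡ-*; -‿distribʳ-*)
  open SetoidReasoning setoid

  ι : ℤ → Carrier
  ι (+ n)    = n ×ᵤ 1#
  ι -[1+ n ] = - (suc n ×ᵤ 1#)

  ι-cong : ∀ {m n} → m ≡ n → ι m ≈ ι n
  ι-cong ≡.refl = refl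

  ι-⊖ : ∀ m n → ι (m ℤ.⊖ n) ≈ m ×ᵤ 1# - n ×ᵤ 1#
  ι-⊖ m       zero    = begin
    m ×ᵤ 1#         ≈⟨ +-identityʳ _ ⟨
    m ×ᵤ 1# + 0#    ≈⟨ +-congˡ ε⁻¹≈ε ⟨
    m ×ᵤ 1# - 0#    ∎
  ι-⊖ zero    (suc n) = sym (+-identityˡ _)
  ι-⊖ (suc m) (suc n) = begin
    ι (suc m ℤ.⊖ suc n)                  ≈⟨ ι-cong (ℤ.[1+m]⊖[1+n]≡m⊖n m n) ⟩
    ι (m ℤ.⊖ n)                          ≈⟨ ι-⊖ m n ⟩
    m ×ᵤ 1# - n ×ᵤ 1#                      ≈⟨ +-identityˡ _ ⟨
    0# + (m ×ᵤ 1# - n ×ᵤ 1#)               ≈⟨ +-congʳ (-‿inverseʳ 1#) ⟨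
    (1# - 1#) + (m ×ᵤ 1# - n ×ᵤ 1#)        ≈⟨ +-assoc _ _ _ ⟩
    1# + (- 1# + (m ×ᵤ 1# - n ×ᵤ 1#))      ≈⟨ +-congˡ (trans (sym (+-assoc _ _ _)) (+-congʳ (+-comm _ _))) ⟩
    1# + ((m ×ᵤ 1# - 1#) - n ×ᵤ 1#)        ≈⟨ +-congˡ (+-assoc _ _ _) ⟩
    1# + (m ×ᵤ 1# + (- 1# - n ×ᵤ 1#))      ≈⟨ +-assoc _ _ _ ⟨
    (1# + m ×ᵤ 1#) + (- 1# - n ×ᵤ 1#)      ≈⟨ +-congˡ (⁻¹-∙-comm 1# (n ×ᵤ 1#)) ⟩
    suc m ×ᵤ 1# - suc n ×ᵤ 1#              ∎

  ι-neg : ∀ m → ι (ℤ.- m) ≈ - ι m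
  ι-neg (+ zero)  = sym ε⁻¹≈ε
  ι-neg (+ suc n) = refl
  ι-neg -[1+ n ]  = sym (⁻¹-involutive _)

  ι-+ : ∀ m n → ι (m ℤ.+ n) ≈ ι m + ι n
  ι-+ (+ m)    (+ n)    = ×-homo-+ 1# m n
  ι-+ (+ m)    -[1+ n ] = ι-⊖ m (suc n)
  ι-+ -[1+ m ] (+ n)    = trans (ι-⊖ n (suc m)) (+-comm _ _)
  ι-+ -[1+ m ] -[1+ n ] = begin
    - (suc (suc (m ℕ.+ n)) ×ᵤ 1#)          ≈⟨ -‿cong (+-congˡ (×-homo-+ 1# (suc m) n)) ⟩
    - (1# + (suc m ×ᵤ 1# + n ×ᵤ 1#))
      ≈⟨ -‿cong (trans (sym (+-assoc _ _ _)) (trans (+-congʳ (+-comm _ _)) (+-assoc _ _ _))) ⟩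
    - (suc m ×ᵤ 1# + suc n ×ᵤ 1#)           ≈⟨ ⁻¹-∙-comm _ _ ⟨
    - (suc m ×ᵤ 1#) - suc n ×ᵤ 1#           ∎

  ι-*⁺ : ∀ m n → ι (+ m ℤ.* + n) ≈ ι (+ m) * ι (+ n)
  ι-*⁺ m n = trans (ι-cong (≡.sym (ℤ.pos-* m n))) (×1-homo-* m n)

  ι-* : ∀ m n → ι (m ℤ.* n) ≈ ι m * ι n
  ι-*ʳ : ∀ m n → ι (+ m ℤ.* n) ≈ ι (+ m) * ι n
  ι-*ʳ m (+ n)    = ι-*⁺ m n
  ι-*ʳ m -[1+ n ] = begin
    ι (+ m ℤ.* -[1+ n ])            ≈⟨ ι-cong (≡.sym (ℤ.neg-distribʳ-* (+ m) (+ suc n))) ⟩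
    ι (ℤ.- (+ m ℤ.* + suc n))       ≈⟨ ι-neg (+ m ℤ.* + suc n) ⟩
    - ι (+ m ℤ.* + suc n)           ≈⟨ -‿cong (ι-*⁺ m (suc n)) ⟩
    - (ι (+ m) * ι (+ suc n))       ≈⟨ -‿distribʳ-* _ _ ⟩
    ι (+ m) * ι -[1+ n ]            ∎
  ι-* (+ m)    n = ι-*ʳ m n
  ι-* -[1+ m ] n = begin
    ι (-[1+ m ] ℤ.* n)              ≈⟨ ι-cong (≡.sym (ℤ.neg-distribˡ-* (+ suc m) n)) ⟩
    ι (ℤ.- (+ suc m ℤ.* n))         ≈⟨ ι-neg (+ suc m ℤ.* n) ⟩
    - ι (+ suc m ℤ.* n)             ≈⟨ -‿cong (ι-*ʳ (suc m) n) ⟩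
    - (ι (+ suc m) * ι n)           ≈⟨ -‿distribˡ-* _ _ ⟩
    ι -[1+ m ] * ι n                ∎

  private
    -- ι with 1# in place of 1# + 0#, so that solver constants are the ring's literals.
    κ : ℤ → Carrier
    κ (+ n)    = n ×′ 1#
    κ -[1+ n ] = - (suc n ×′ 1#)

    ι≈κ : ∀ m → ι m ≈ κ m
    ι≈κ (+ n)    = ×ᵤ≈× n 1#
    ι≈κ -[1+ n ] = -‿cong (×ᵤ≈× (suc n) 1#)

    homomorphism : ℤ.+-*-rawRing -Raw-AlmostCommutative⟶ fromCommutativeRing R
    homomorphism = record
      { ⟦_⟧    = κ
      ; +-homo = λ m n → trans (sym (ι≈κ (m ℤ.+ n))) (trans (ι-+ m n) (+-cong (ι≈κ m) (ι≈κ n)))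
      ; *-homo = λ m n → trans (sym (ι≈κ (m ℤ.* n))) (trans (ι-* m n) (*-cong (ι≈κ m) (ι≈κ n)))
      ; -‿homo = λ m → trans (sym (ι≈κ (ℤ.- m))) (trans (ι-neg m) (-‿cong (ι≈κ m)))
      ; 0-homo = refl
      ; 1-homo = refl
      }

    coefficient≟ : ∀ m n → Maybe (κ m ≈ κ n)
    coefficient≟ m n with m ℤ.≟ n
    ... | yes ≡.refl = just refl
    ... | no  _      = nothing

  module Solver = RingSolver ℤ.+-*-rawRing (fromCommutativeRing R) homomorphism coefficient≟

-- Ordered-field arithmetic

module RealProperties (em : ExcludedMiddle 0ℓ) (ℝ : Reals) where
  open Reals ℝ
  open Theory ℝ using (fromℕ)
  open IsTotalOrder isTotalOrder public
    using (antisym; total; ≤-respˡ-≈; ≤-respʳ-≈)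
    renaming (reflexive to ≤-reflexive; trans to ≤-trans; refl to ≤-refl)
  open IntegerCoefficients commutativeRing public
  open Solver public

  x-y≈0⇒x≈y : ∀ {x y} → x - y ≈ 0# → x ≈ y
  x-y≈0⇒x≈y {x} {y} = RingProperties.x∙y⁻¹≈ε⇒x≈y ring x y

  2# : Carrier
  2# = 1# + 1#

  ≤-resp : ∀ {x x′ y y′} → x ≈ x′ → y ≈ y′ → x ≤ y → x′ ≤ y′
  ≤-resp x≈x′ y≈y′ x≤y = ≤-respˡ-≈ x≈x′ (≤-respʳ-≈ y≈y′ x≤y)

  difference-nonneg : ∀ {x y} → x ≤ y → 0# ≤ y - x
  difference-nonneg {x} {y} x≤y =
    ≤-resp (-‿inverseˡ x) (+-comm (- x) y) (+-monoʳ-≤ (- x) x≤y)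

  ≤-from-difference : ∀ {x y z} → 0# ≤ z → z ≈ y - x → x ≤ y
  ≤-from-difference {x} {y} {z} 0≤z z≈y-x =
    ≤-resp (+-identityʳ x)
      (trans (+-congˡ z≈y-x) (solve 2 (λ x y → x :+ (y :- x) := y) refl x y))
      (+-monoʳ-≤ x 0≤z)

  +-nonneg : ∀ {x y} → 0# ≤ x → 0# ≤ y → 0# ≤ x + y
  +-nonneg {x} {y} 0≤x 0≤y =
    ≤-trans 0≤x (≤-respˡ-≈ (+-identityʳ x) (+-monoʳ-≤ x 0≤y))

  +-mono-≤ : ∀ {x y u v} → x ≤ y → u ≤ v → x + u ≤ y + v
  +-mono-≤ {x} {y} {u} {v} x≤y u≤v =
    ≤-from-difference (+-nonneg (difference-nonneg x≤y) (difference-nonneg u≤v))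
      (solve 4 (λ x y u v → (y :- x) :+ (v :- u) := (y :+ v) :- (x :+ u)) refl x y u v)

  neg-mono-≤ : ∀ {x y} → x ≤ y → - y ≤ - x
  neg-mono-≤ {x} {y} x≤y = ≤-from-difference (difference-nonneg x≤y)
    (solve 2 (λ x y → y :- x := (:- x) :- (:- y)) refl x y)

  *-monoˡ-≤ : ∀ {x y z} → 0# ≤ z → x ≤ y → z * x ≤ z * y
  *-monoˡ-≤ {x} {y} {z} 0≤z x≤y =
    ≤-from-difference (*-nonneg 0≤z (difference-nonneg x≤y))
      (solve 3 (λ x y z → z :* (y :- x) := z :* y :- z :* x) refl x y z)

  difference-pos : ∀ {x y} → x < y → 0# < y - x
  difference-pos (x≤y , x≉y) = difference-nonneg x≤y , λ 0≈y-x → x≉y (sym (x-y≈0⇒x≈y (sym 0≈y-x)))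

  *-mono-≤ : ∀ {x y u v} → 0# ≤ x → 0# ≤ u → x ≤ y → u ≤ v → x * u ≤ y * v
  *-mono-≤ {x} {y} {u} {v} 0≤x 0≤u x≤y u≤v =
    ≤-trans (*-monoˡ-≤ 0≤x u≤v)
      (≤-resp (*-comm v x) (*-comm v y) (*-monoˡ-≤ (≤-trans 0≤u u≤v) x≤y))

  square-nonneg : ∀ x → 0# ≤ x * x
  square-nonneg x with total 0# x
  ... | inj₁ 0≤x = *-nonneg 0≤x 0≤x
  ... | inj₂ x≤0 = ≤-respʳ-≈ (solve 1 (λ x → (con (+ 0) :- x) :* (con (+ 0) :- x) := x :* x) refl x)
                     (*-nonneg (difference-nonneg x≤0) (difference-nonneg x≤0))

  ≰⇒≥ : ∀ {x y} → ¬ (x ≤ y) → y ≤ x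
  ≰⇒≥ {x} {y} x≰y with total x y
  ... | inj₁ x≤y = contradiction x≤y x≰y
  ... | inj₂ y≤x = y≤x

  <⇒≱ : ∀ {x y} → x < y → ¬ (y ≤ x)
  <⇒≱ (x≤y , x≉y) y≤x = x≉y (antisym x≤y y≤x)

  ≰⇒> : ∀ {x y} → ¬ (x ≤ y) → y < x
  ≰⇒> x≰y = ≰⇒≥ x≰y , λ y≈x → x≰y (≤-reflexive (sym y≈x))

  ≮⇒≥ : ∀ {x y} → ¬ (x < y) → y ≤ x
  ≮⇒≥ {x} {y} x≮y with em {y ≤ x}
  ... | yes y≤x = y≤x
  ... | no  y≰x = contradiction (≰⇒> y≰x) x≮y

  <-≤-trans : ∀ {x y z} → x < y → y ≤ z → x < z
  <-≤-trans (x≤y , x≉y) y≤z =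
    ≤-trans x≤y y≤z , λ x≈z → x≉y (antisym x≤y (≤-respʳ-≈ (sym x≈z) y≤z))

  <-respʳ-≈ : ∀ {x y z} → y ≈ z → x < y → x < z
  <-respʳ-≈ y≈z x<y = <-≤-trans x<y (≤-reflexive y≈z)

  +-pos : ∀ {x y} → 0# < x → 0# ≤ y → 0# < x + y
  +-pos {x} {y} 0<x 0≤y = <-≤-trans 0<x (≤-respˡ-≈ (+-identityʳ x) (+-monoʳ-≤ x 0≤y))

  0≤1 : 0# ≤ 1#
  0≤1 = ≤-respʳ-≈ (*-identityˡ 1#) (square-nonneg 1#)

  0<1 : 0# < 1#
  0<1 = 0≤1 , λ 0≈1 → 1≉0 (sym 0≈1)

  pos⇒≉0 : ∀ {x} → 0# < x → ¬ (x ≈ 0#)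
  pos⇒≉0 (_ , 0≉x) x≈0 = 0≉x (sym x≈0)

  ⁻¹-inverseˡ : ∀ x → ¬ (x ≈ 0#) → x ⁻¹ * x ≈ 1#
  ⁻¹-inverseˡ x x≉0 = trans (*-comm _ _) (⁻¹-inverseʳ x x≉0)

  *-cancelˡ-≈0 : ∀ {x y} → ¬ (x ≈ 0#) → x * y ≈ 0# → y ≈ 0#
  *-cancelˡ-≈0 {x} {y} x≉0 xy≈0 = begin
    y                ≈⟨ *-identityˡ y ⟨
    1# * y           ≈⟨ *-congʳ (⁻¹-inverseˡ x x≉0) ⟨
    x ⁻¹ * x * y     ≈⟨ *-assoc _ _ _ ⟩
    x ⁻¹ * (x * y)   ≈⟨ *-congˡ xy≈0 ⟩
    x ⁻¹ * 0#        ≈⟨ zeroʳ _ ⟩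
    0#               ∎
    where open SetoidReasoning setoid

  *-pos : ∀ {x y} → 0# < x → 0# < y → 0# < x * y
  *-pos 0<x 0<y = *-nonneg (proj₁ 0<x) (proj₁ 0<y) ,
    λ 0≈xy → pos⇒≉0 0<y (*-cancelˡ-≈0 (pos⇒≉0 0<x) (sym 0≈xy))

  square-pos : ∀ {x} → ¬ (x ≈ 0#) → 0# < x * x
  square-pos x≉0 = square-nonneg _ , λ 0≈xx → x≉0 (*-cancelˡ-≈0 x≉0 (sym 0≈xx))

  ⁻¹-pos : ∀ {x} → 0# < x → 0# < x ⁻¹
  ⁻¹-pos {x} 0<x = <-respʳ-≈
    (trans (sym (*-assoc _ _ _)) (trans (*-congʳ (⁻¹-inverseʳ x (pos⇒≉0 0<x))) (*-identityˡ _)))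
    (*-pos 0<x (square-pos x⁻¹≉0))
    where
    x⁻¹≉0 : ¬ (x ⁻¹ ≈ 0#)
    x⁻¹≉0 x⁻¹≈0 = 1≉0 (trans (sym (⁻¹-inverseʳ x (pos⇒≉0 0<x))) (trans (*-congˡ x⁻¹≈0) (zeroʳ x)))

  *-cancelˡ-≤ : ∀ {x y z} → 0# < z → z * x ≤ z * y → x ≤ y
  *-cancelˡ-≤ {x} {y} {z} 0<z zx≤zy =
    ≤-resp (cancel x) (cancel y) (*-monoˡ-≤ (proj₁ (⁻¹-pos 0<z)) zx≤zy)
    where
    cancel : ∀ x → z ⁻¹ * (z * x) ≈ x
    cancel x = trans (sym (*-assoc _ _ _)) (trans (*-congʳ (⁻¹-inverseˡ z (pos⇒≉0 0<z))) (*-identityˡ x))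

  0<2 : 0# < 2#
  0<2 = +-pos 0<1 0≤1

  ½ : Carrier
  ½ = 2# ⁻¹

  0<½ : 0# < ½
  0<½ = ⁻¹-pos 0<2

  ½+½≈1 : ½ + ½ ≈ 1#
  ½+½≈1 = trans (solve 1 (λ h → h :+ h := (con (+ 1) :+ con (+ 1)) :* h) refl ½) (⁻¹-inverseʳ 2# (pos⇒≉0 0<2))

  halves : ∀ x → ½ * x + ½ * x ≈ x
  halves x = trans (sym (distribʳ x ½ ½)) (trans (*-congʳ ½+½≈1) (*-identityˡ x))

  double-nonneg⁻ : ∀ {x} → 0# ≤ x + x → 0# ≤ x
  double-nonneg⁻ {x} 0≤x+x = ≤-respʳ-≈
    (trans (distribˡ ½ x x) (halves x)) (*-nonneg (proj₁ 0<½) 0≤x+x)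

  fromℕ-nonneg : ∀ n → 0# ≤ fromℕ n
  fromℕ-nonneg zero    = ≤-refl
  fromℕ-nonneg (suc n) = +-nonneg 0≤1 (fromℕ-nonneg n)

  fromℕ-pos : ∀ n → 0# < fromℕ (suc n)
  fromℕ-pos n = +-pos 0<1 (fromℕ-nonneg n)

  -- If every natural number lay below `x`, their supremum s would exist; as n + 1 ≤ s for all n,
  -- the number s - 1 would be a smaller upper bound.
  archimedean : ∀ x → ∃[ n ] x ≤ fromℕ n
  archimedean x = decidable-stable em λ unbounded →
    let bound : ∀ n → fromℕ n ≤ x
        bound n = ≰⇒≥ λ x≤n → unbounded (n , x≤n)
        s , s-upper , s-least = supremum (λ y → ∃[ n ] y ≈ fromℕ n) (0# , 0 , refl)
          (x , λ y (n , y≈n) → ≤-respˡ-≈ (sym y≈n) (bound n))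
        s≤s-1 = s-least (s - 1#) λ y (n , y≈n) →
          ≤-resp (trans (solve 1 (λ m → con (+ 1) :+ m :- con (+ 1) := m) refl (fromℕ n)) (sym y≈n)) refl
            (+-mono-≤ (s-upper (fromℕ (suc n)) (suc n , refl)) (≤-refl { - 1#}))
    in <⇒≱ 0<1 (≤-from-difference (difference-nonneg s≤s-1)
         (solve 1 (λ s → s :- con (+ 1) :- s := con (+ 0) :- con (+ 1)) refl s))

  infix 4 ∣_∣≤_
  -- Absolute values enter only through two-sided bounds, so that products can be estimated without
  -- distinguishing signs.
  ∣_∣≤_ : Carrier → Carrier → Set
  ∣ x ∣≤ r = - r ≤ x × x ≤ r

  ∣∣≤-resp : ∀ {x x′ r} → x ≈ x′ → ∣ x ∣≤ r → ∣ x′ ∣≤ r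
  ∣∣≤-resp x≈x′ (l , u) = ≤-respʳ-≈ x≈x′ l , ≤-respˡ-≈ x≈x′ u

  ∣∣≤-mono : ∀ {x r s} → r ≤ s → ∣ x ∣≤ r → ∣ x ∣≤ s
  ∣∣≤-mono r≤s (l , u) = ≤-trans (neg-mono-≤ r≤s) l , ≤-trans u r≤s

  ∣∣≤⇒0≤ : ∀ {x r} → ∣ x ∣≤ r → 0# ≤ r
  ∣∣≤⇒0≤ {x} {r} (l , u) = double-nonneg⁻ (≤-respʳ-≈
    (solve 1 (λ r → r :- (:- r) := r :+ r) refl r)
    (difference-nonneg (≤-trans l u)))

  ∣∣≤-neg : ∀ {x r} → ∣ x ∣≤ r → ∣ - x ∣≤ r
  ∣∣≤-neg {x} {r} (l , u) = neg-mono-≤ u , ≤-respʳ-≈ (solve 1 (λ r → :- (:- r) := r) refl r) (neg-mono-≤ l)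

  ∣∣≤-+ : ∀ {x y r s} → ∣ x ∣≤ r → ∣ y ∣≤ s → ∣ x + y ∣≤ r + s
  ∣∣≤-+ {x} {y} {r} {s} (l , u) (l′ , u′) =
    ≤-respˡ-≈ (solve 2 (λ r s → (:- r) :+ (:- s) := :- (r :+ s)) refl r s) (+-mono-≤ l l′) , +-mono-≤ u u′

  -- Twice the gap xy + rs equals (x + r)(y + s) + (r - x)(s - y), a sum of products of nonnegative
  -- numbers. The upper bound is the lower bound at `- x`.
  ∣∣≤-* : ∀ {x y r s} → ∣ x ∣≤ r → ∣ y ∣≤ s → ∣ x * y ∣≤ r * s
  ∣∣≤-* {x} {y} {r} {s} x≤r@(l , u) y≤s@(l′ , u′) = lower x≤r y≤s , upper
    where
    lower : ∀ {x y} → ∣ x ∣≤ r → ∣ y ∣≤ s → - (r * s) ≤ x * y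
    lower {x} {y} (l , u) (l′ , u′) = ≤-from-difference
      (*-nonneg (proj₁ 0<½) (+-nonneg (*-nonneg (difference-nonneg l) (difference-nonneg l′))
                                      (*-nonneg (difference-nonneg u) (difference-nonneg u′))))
      (cancel-double (solve 4 (λ x y r s →
         let t = (x :- (:- r)) :* (y :- (:- s)) :+ (r :- x) :* (s :- y); w = x :* y :- (:- (r :* s)) in
         t := w :+ w) refl x y r s))
      where
      cancel-double : ∀ {z w} → z ≈ w + w → ½ * z ≈ w
      cancel-double {z} {w} z≈w+w = trans (*-congˡ z≈w+w) (trans (distribˡ ½ w w) (halves w))
    upper : x * y ≤ r * s
    upper = ≤-resp (solve 2 (λ x y → :- ((:- x) :* y) := x :* y) refl x y) (solve 1 (λ z → :- (:- z) := z) refl (r * s))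
      (neg-mono-≤ (lower (∣∣≤-neg x≤r) y≤s))

  nonneg⇒∣∣≤ : ∀ {x} → 0# ≤ x → ∣ x ∣≤ x
  nonneg⇒∣∣≤ {x} 0≤x = ≤-from-difference (+-nonneg 0≤x 0≤x) (solve 1 (λ x → x :+ x := x :- (:- x)) refl x) , ≤-refl

  magnitude : ∀ x → ∃[ r ] ∣ x ∣≤ r
  magnitude x with total 0# x
  ... | inj₁ 0≤x = x , nonneg⇒∣∣≤ 0≤x
  ... | inj₂ x≤0 = - x , ∣∣≤-resp (solve 1 (λ x → :- (:- x) := x) refl x) (∣∣≤-neg (nonneg⇒∣∣≤
                     (≤-respʳ-≈ (+-identityˡ (- x)) (difference-nonneg x≤0))))

  ∣∣≤-square : ∀ {x r} → 0# < r → x * x ≤ r * r → ∣ x ∣≤ r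
  ∣∣≤-square {x} {r} 0<r xx≤rr = lower , upper x xx≤rr
    where
    upper : ∀ x → x * x ≤ r * r → x ≤ r
    upper x xx≤rr = ≮⇒≥ λ r<x → <⇒≱
      (<-respʳ-≈ (solve 2 (λ x r → (r :+ x) :* (x :- r) := x :* x :- r :* r) refl x r)
        (*-pos (+-pos 0<r (≤-trans (proj₁ 0<r) (proj₁ r<x))) (difference-pos r<x)))
      (≤-respʳ-≈ (-‿inverseʳ (r * r)) (+-mono-≤ xx≤rr (≤-refl { - (r * r)})))
    lower : - r ≤ x
    lower = ≤-respʳ-≈ (solve 1 (λ x → :- (:- x) := x) refl x)
      (neg-mono-≤ (upper (- x) (≤-respˡ-≈ (solve 1 (λ x → x :* x := (:- x) :* (:- x)) refl x) xx≤rr)))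

-- Series and limits

module Series {c ℓ} (R : CommutativeRing c ℓ) where
  open CommutativeRing R
  open IntegerCoefficients R
  open Solver
  open SetoidReasoning setoid

  partialSum : (ℕ → Carrier) → ℕ → Carrier
  partialSum a zero    = 0#
  partialSum a (suc n) = partialSum a n + a n

  infixl 7 _∗_
  -- The Cauchy product, the sum of `a i * b (n - i)` over i ≤ n. Peeling off `a 0` keeps `b` in
  -- place, so inductions only replace `a` by `a ∘ suc`.
  _∗_ : (ℕ → Carrier) → (ℕ → Carrier) → ℕ → Carrier
  (a ∗ b) zero    = a 0 * b 0
  (a ∗ b) (suc n) = a 0 * b (suc n) + (a ∘ suc ∗ b) n

  partialSum-cong : ∀ {a b} → (∀ n → a n ≈ b n) → ∀ n → partialSum a n ≈ partialSum b n
  partialSum-cong a≈b zero    = refl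
  partialSum-cong a≈b (suc n) = +-cong (partialSum-cong a≈b n) (a≈b n)

  partialSum-+ : ∀ a b n → partialSum (λ i → a i + b i) n ≈ partialSum a n + partialSum b n
  partialSum-+ a b zero    = sym (+-identityˡ 0#)
  partialSum-+ a b (suc n) = trans (+-congʳ (partialSum-+ a b n))
    (solve 4 (λ s t x y → (s :+ t) :+ (x :+ y) := (s :+ x) :+ (t :+ y)) refl _ _ _ _)

  partialSum-head : ∀ a n → partialSum a (suc n) ≈ a 0 + partialSum (a ∘ suc) n
  partialSum-head a zero    = +-comm _ _
  partialSum-head a (suc n) = trans (+-congʳ (partialSum-head a n)) (+-assoc _ _ _)

  -- Splits the triangle of index pairs into the row of `a 0` and a triangle one size smaller, the
  -- recursion behind both later estimates for products of series.
  partialSum-∗ : ∀ a b n → partialSum (a ∗ b) (suc n) ≈ a 0 * partialSum b (suc n) + partialSum (a ∘ suc ∗ b) n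
  partialSum-∗ a b zero    = solve 2 (λ a b → con (+ 0) :+ a :* b := a :* (con (+ 0) :+ b) :+ con (+ 0)) refl _ _
  partialSum-∗ a b (suc n) = trans (+-congʳ (partialSum-∗ a b n))
    (solve 5 (λ a s t b x → (a :* s :+ t) :+ (a :* b :+ x) := a :* (s :+ b) :+ (t :+ x)) refl (a 0) _ _ _ _)

  ∗-congˡ : ∀ {a a′} b → (∀ n → a n ≈ a′ n) → ∀ n → (a ∗ b) n ≈ (a′ ∗ b) n
  ∗-congˡ b a≈a′ zero    = *-congʳ (a≈a′ 0)
  ∗-congˡ b a≈a′ (suc n) = +-cong (*-congʳ (a≈a′ 0)) (∗-congˡ b (a≈a′ ∘ suc) n)

  ∗-congʳ : ∀ a {b b′} → (∀ n → b n ≈ b′ n) → ∀ n → (a ∗ b) n ≈ (a ∗ b′) n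
  ∗-congʳ a b≈b′ zero    = *-congˡ (b≈b′ 0)
  ∗-congʳ a b≈b′ (suc n) = +-cong (*-congˡ (b≈b′ (suc n))) (∗-congʳ (a ∘ suc) b≈b′ n)

  ∗-distribʳ-+ : ∀ a a′ b n → ((λ i → a i + a′ i) ∗ b) n ≈ (a ∗ b) n + (a′ ∗ b) n
  ∗-distribʳ-+ a a′ b zero    = distribʳ _ _ _
  ∗-distribʳ-+ a a′ b (suc n) = trans (+-congˡ (∗-distribʳ-+ (a ∘ suc) (a′ ∘ suc) b n))
    (solve 5 (λ a a′ b s t → (a :+ a′) :* b :+ (s :+ t) := (a :* b :+ s) :+ (a′ :* b :+ t)) refl _ _ _ _ _)

  ∗-scaleˡ : ∀ z a b n → ((λ i → z * a i) ∗ b) n ≈ z * (a ∗ b) n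
  ∗-scaleˡ z a b zero    = *-assoc _ _ _
  ∗-scaleˡ z a b (suc n) = trans (+-congˡ (∗-scaleˡ z (a ∘ suc) b n))
    (solve 4 (λ z a b s → (z :* a) :* b :+ z :* s := z :* (a :* b :+ s)) refl _ _ _ _)

  ∗-scaleʳ : ∀ z a b n → (a ∗ (λ i → z * b i)) n ≈ z * (a ∗ b) n
  ∗-scaleʳ z a b zero    = solve 3 (λ z a b → a :* (z :* b) := z :* (a :* b)) refl _ _ _
  ∗-scaleʳ z a b (suc n) = trans (+-congˡ (∗-scaleʳ z (a ∘ suc) b n))
    (solve 4 (λ z a b s → a :* (z :* b) :+ z :* s := z :* (a :* b :+ s)) refl _ _ _ _)

  ∗-shiftʳ : ∀ a b → b 0 ≈ 0# → ∀ n → (a ∗ b) (suc n) ≈ (a ∗ b ∘ suc) n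
  ∗-shiftʳ a b b₀≈0 zero    = trans (+-congˡ (trans (*-congˡ b₀≈0) (zeroʳ _))) (+-identityʳ _)
  ∗-shiftʳ a b b₀≈0 (suc n) = +-congˡ (∗-shiftʳ (a ∘ suc) b b₀≈0 n)

  #_ : ℕ → Carrier
  # n = ι (+ n)

  -- The Euler operator (D a) n = n a n is a derivation of ∗.
  D : (ℕ → Carrier) → ℕ → Carrier
  D a n = # n * a n

  D-∗ : ∀ a b n → # n * (a ∗ b) n ≈ (D a ∗ b) n + (a ∗ D b) n
  D-∗ a b zero    = solve 2 (λ a b → con (+ 0) :* (a :* b) := (con (+ 0) :* a) :* b :+ a :* (con (+ 0) :* b)) refl _ _
  D-∗ a b (suc n) = begin
    # suc n * (a 0 * b (suc n) + (a⁺ ∗ b) n)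
      ≈⟨ solve 4 (λ m a b s → (con (+ 1) :+ m) :* (a :* b :+ s) := (con (+ 1) :+ m) :* (a :* b) :+
          (s :+ m :* s)) refl (# n) (a 0) (b (suc n)) ((a⁺ ∗ b) n) ⟩
    # suc n * (a 0 * b (suc n)) + ((a⁺ ∗ b) n + # n * (a⁺ ∗ b) n)
      ≈⟨ +-congˡ (+-congˡ (D-∗ a⁺ b n)) ⟩
    # suc n * (a 0 * b (suc n)) + ((a⁺ ∗ b) n + ((D a⁺ ∗ b) n + (a⁺ ∗ D b) n))
      ≈⟨ solve 6 (λ k a b x y z → k :* (a :* b) :+ (x :+ (y :+ z)) := (con (+ 0) :* a :* b :+ (x :+ y)) :+
          (a :* (k :* b) :+ z)) refl (# suc n) (a 0) (b (suc n)) _ _ _ ⟩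
    (# 0 * a 0 * b (suc n) + ((a⁺ ∗ b) n + (D a⁺ ∗ b) n)) + (a 0 * D b (suc n) + (a⁺ ∗ D b) n)
      ≈⟨ +-congʳ (+-congˡ (trans (sym (∗-distribʳ-+ a⁺ (D a⁺) b n)) (∗-congˡ b (λ i → solve 2 (λ m a → a :+ m :* a
          := (con (+ 1) :+ m) :* a) refl (# i) (a⁺ i)) n))) ⟩
    (# 0 * a 0 * b (suc n) + (D a ∘ suc ∗ b) n) + (a 0 * D b (suc n) + (a⁺ ∗ D b) n) ∎
    where a⁺ = a ∘ suc

  -- The hypotheses are the recurrences of exponential series for `z` and `w`. Since `D` is a
  -- derivation, the product obeys the one for `z + w`; the boundary terms drop out because `D`
  -- vanishes at index 0.
  ∗-D-scale : ∀ z w a b → (∀ n → D a (suc n) ≈ z * a n) → (∀ n → D b (suc n) ≈ w * b n) →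
              ∀ n → D (a ∗ b) (suc n) ≈ (z + w) * (a ∗ b) n
  ∗-D-scale z w a b Da Db n = begin
    D (a ∗ b) (suc n)                                 ≈⟨ D-∗ a b (suc n) ⟩
    (# 0 * a 0 * b (suc n) + (D a ∘ suc ∗ b) n) + (a ∗ D b) (suc n)
      ≈⟨ +-cong (trans (+-congʳ (trans (*-congʳ (zeroˡ _)) (zeroˡ _))) (+-identityˡ _)) (∗-shiftʳ a (D b) (zeroˡ _) n) ⟩
    (D a ∘ suc ∗ b) n + (a ∗ D b ∘ suc) n             ≈⟨ +-cong (∗-congˡ b Da n) (∗-congʳ a Db n) ⟩
    ((λ i → z * a i) ∗ b) n + (a ∗ (λ i → w * b i)) n ≈⟨ +-cong (∗-scaleˡ z a b n) (∗-scaleʳ w a b n) ⟩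
    z * (a ∗ b) n + w * (a ∗ b) n                     ≈⟨ distribʳ _ _ _ ⟨
    (z + w) * (a ∗ b) n                               ∎

  -- Inverse factorials and cancellation by positive integers are parameters because the series is
  -- used over ℝ and over ℂ, in the latter case with coefficients coming from ℝ.
  module Exponential (1/_! : ℕ → Carrier) (1/0! : 1/ 0 ! ≈ 1#)
                     (1/suc! : ∀ n → # suc n * 1/ suc n ! ≈ 1/ n !)
                     (#-cancel : ∀ n {x y} → # suc n * x ≈ # suc n * y → x ≈ y) where
    open SemiringExp semiring

    term : Carrier → ℕ → Carrier
    term z n = 1/ n ! * z ^ n

    D-term : ∀ z n → D (term z) (suc n) ≈ z * term z n
    D-term z n = trans
      (solve 4 (λ m f z p → m :* (f :* (z :* p)) := z :* ((m :* f) :* p)) refl (# suc n) (1/ suc n !) z (z ^ n))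
      (*-congˡ (*-congʳ (1/suc! n)))

    -- Both sides satisfy the recurrence of `∗-D-scale` and agree at index 0, and the factor n + 1
    -- can be cancelled. This takes the place of the binomial theorem.
    term-∗ : ∀ z w n → (term z ∗ term w) n ≈ term (z + w) n
    term-∗ z w zero = trans (solve 1 (λ f → (f :* con (+ 1)) :* (f :* con (+ 1)) := f :* f) refl (1/ 0 !))
      (*-congˡ 1/0!)
    term-∗ z w (suc n) = #-cancel n (trans (∗-D-scale z w (term z) (term w) (D-term z) (D-term w) n)
      (trans (*-congˡ (term-∗ z w n)) (sym (D-term (z + w) n))))

-- Limits of real sequences

module Limits (em : ExcludedMiddle 0ℓ) (ℝ : Reals) where
  open Reals ℝ
  open RealProperties em ℝ
  open Series commutativeRing using (partialSum)

  Null : (ℕ → Carrier) → Set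
  Null s = ∀ ε → 0# < ε → ∃[ N ] (∀ n → N ℕ.≤ n → ∣ s n ∣≤ ε)

  infix 4 _⟶ᴿ_
  _⟶ᴿ_ : (ℕ → Carrier) → Carrier → Set
  s ⟶ᴿ l = Null λ n → s n - l

  Null-cong : ∀ {s t} → (∀ n → s n ≈ t n) → Null s → Null t
  Null-cong s≈t s→0 ε 0<ε =
    let N , bound = s→0 ε 0<ε in N , λ n N≤n → ∣∣≤-resp (s≈t n) (bound n N≤n)

  Null-squeeze : ∀ {s t} → (∀ n → ∣ s n ∣≤ t n) → Null t → Null s
  Null-squeeze s≤t t→0 ε 0<ε =
    let N , bound = t→0 ε 0<ε in N , λ n N≤n → ∣∣≤-mono (proj₂ (bound n N≤n)) (s≤t n)

  Null-subsequence : ∀ {s} f → (∀ n → n ℕ.≤ f n) → Null s → Null (s ∘ f)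
  Null-subsequence f n≤fn s→0 ε 0<ε =
    let N , bound = s→0 ε 0<ε in N , λ n N≤n → bound (f n) (ℕ.≤-trans N≤n (n≤fn n))

  Null-+ : ∀ {s t} → Null s → Null t → Null (λ n → s n + t n)
  Null-+ s→0 t→0 ε 0<ε =
    let M , s≤ = s→0 (½ * ε) (*-pos 0<½ 0<ε)
        N , t≤ = t→0 (½ * ε) (*-pos 0<½ 0<ε)
    in M ⊔ N , λ n M⊔N≤n → ∣∣≤-mono (≤-reflexive (halves ε))
         (∣∣≤-+ (s≤ n (ℕ.≤-trans (ℕ.m≤m⊔n M N) M⊔N≤n)) (t≤ n (ℕ.≤-trans (ℕ.m≤n⊔m M N) M⊔N≤n)))

  Null-scale : ∀ {s} c → Null s → Null (λ n → c * s n)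
  Null-scale c s→0 ε 0<ε =
    let r , c≤r = magnitude c
        -- The bound `r` may be 0, so 1 + r is inverted instead.
        0<1+r = +-pos 0<1 (∣∣≤⇒0≤ c≤r)
        δ = (1# + r) ⁻¹ * ε
        N , s≤δ = s→0 δ (*-pos (⁻¹-pos 0<1+r) 0<ε)
        c≤1+r = ∣∣≤-mono (≤-respˡ-≈ (+-identityˡ r) (+-mono-≤ 0≤1 ≤-refl)) c≤r
    in N , λ n N≤n → ∣∣≤-mono
         (≤-reflexive (trans (sym (*-assoc _ _ _)) (trans (*-congʳ (⁻¹-inverseʳ _ (pos⇒≉0 0<1+r))) (*-identityˡ ε))))
         (∣∣≤-* c≤1+r (s≤δ n N≤n))

  Null-* : ∀ {s t} → Null s → Null t → Null (λ n → s n * t n)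
  Null-* s→0 t→0 ε 0<ε =
    let M , s≤ = s→0 ε 0<ε
        N , t≤ = t→0 1# 0<1
    in M ⊔ N , λ n M⊔N≤n → ∣∣≤-mono (≤-reflexive (*-identityʳ ε))
         (∣∣≤-* (s≤ n (ℕ.≤-trans (ℕ.m≤m⊔n M N) M⊔N≤n)) (t≤ n (ℕ.≤-trans (ℕ.m≤n⊔m M N) M⊔N≤n)))

  Null-constant : ∀ {x} → Null (λ _ → x) → x ≈ 0#
  Null-constant {x} x→0 = antisym x≤0 (≤-respʳ-≈ (solve 1 (λ x → :- (:- x) := x) refl x)
    (≤-respˡ-≈ (solve 0 (:- con (+ 0) := con (+ 0)) refl) (neg-mono-≤ -x≤0)))
    where
    bound : ∀ ε → 0# < ε → ∣ x ∣≤ ε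
    bound ε 0<ε = let N , small = x→0 ε 0<ε in small N ℕ.≤-refl
    nonpos : ∀ {y} → (∀ ε → 0# < ε → y ≤ ε) → y ≤ 0#
    nonpos {y} small = ≮⇒≥ λ 0<y → <⇒≱ (*-pos 0<½ 0<y)
      (≤-from-difference (difference-nonneg (small (½ * y) (*-pos 0<½ 0<y)))
        (trans (+-congˡ (-‿cong (sym (halves y))))
               (solve 1 (λ h → h :- (h :+ h) := con (+ 0) :- h) refl (½ * y))))
    x≤0 : x ≤ 0#
    x≤0 = nonpos λ ε 0<ε → proj₂ (bound ε 0<ε)
    -x≤0 : - x ≤ 0#
    -x≤0 = nonpos λ ε 0<ε → proj₂ (∣∣≤-neg (bound ε 0<ε))

  ⟶ᴿ-unique : ∀ {s l m} → s ⟶ᴿ l → s ⟶ᴿ m → l ≈ m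
  ⟶ᴿ-unique {s} {l} {m} s→l s→m = x-y≈0⇒x≈y (Null-constant (Null-cong
    (λ n → solve 3 (λ s l m → (s :- m) :+ (:- con (+ 1)) :* (s :- l) := l :- m) refl (s n) l m)
    (Null-+ s→m (Null-scale (- 1#) s→l))))

  ⟶ᴿ-cong : ∀ {s t l} → (∀ n → s n ≈ t n) → s ⟶ᴿ l → t ⟶ᴿ l
  ⟶ᴿ-cong s≈t = Null-cong λ n → +-congʳ (s≈t n)

  ⟶ᴿ-constant : ∀ {x} → (λ _ → x) ⟶ᴿ x
  ⟶ᴿ-constant {x} ε 0<ε = 0 , λ n _ → ∣∣≤-resp (sym (-‿inverseʳ x))
    (∣∣≤-mono (proj₁ 0<ε) (nonneg⇒∣∣≤ ≤-refl))

  ⟶ᴿ-+ : ∀ {s t l m} → s ⟶ᴿ l → t ⟶ᴿ m → (λ n → s n + t n) ⟶ᴿ (l + m)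
  ⟶ᴿ-+ {s} {t} {l} {m} s→l t→m = Null-cong
    (λ n → solve 4 (λ s t l m → (s :- l) :+ (t :- m) := (s :+ t) :- (l :+ m)) refl (s n) (t n) l m)
    (Null-+ s→l t→m)

  ⟶ᴿ-neg : ∀ {s l} → s ⟶ᴿ l → (λ n → - s n) ⟶ᴿ - l
  ⟶ᴿ-neg {s} {l} s→l = Null-cong
    (λ n → solve 2 (λ s l → (:- con (+ 1)) :* (s :- l) := (:- s) :- (:- l)) refl (s n) l)
    (Null-scale (- 1#) s→l)

  ⟶ᴿ-* : ∀ {s t l m} → s ⟶ᴿ l → t ⟶ᴿ m → (λ n → s n * t n) ⟶ᴿ l * m
  ⟶ᴿ-* {s} {t} {l} {m} s→l t→m = Null-cong
    (λ n → solve 4 (λ s t l m → (s :- l) :* (t :- m) :+ (l :* (t :- m) :+ m :* (s :- l)) := s :* t :- l :* m) refl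
        (s n) (t n) l m)
    (Null-+ (Null-* s→l t→m) (Null-+ (Null-scale l t→m) (Null-scale m s→l)))

  increasing : (s : ℕ → Carrier) → (∀ n → s n ≤ s (suc n)) → ∀ {m n} → m ℕ.≤ n → s m ≤ s n
  increasing s step m≤n = go (ℕ.≤⇒≤′ m≤n)
    where
    go : ∀ {m n} → m ℕ.≤′ n → s m ≤ s n
    go ℕ.≤′-refl       = ≤-refl
    go (ℕ.≤′-step m≤n) = ≤-trans (go m≤n) (step _)

  monotone-convergence : ∀ s B → (∀ n → s n ≤ s (suc n)) → (∀ n → s n ≤ B) → ∃[ l ] s ⟶ᴿ l
  monotone-convergence s B step s≤B = l , converges
    where
    sup = supremum (λ x → ∃[ n ] x ≈ s n) (s 0 , 0 , refl) (B , λ x (n , x≈sn) → ≤-respˡ-≈ (sym x≈sn) (s≤B n))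
    l = proj₁ sup
    s≤l : ∀ n → s n ≤ l
    s≤l n = proj₁ (proj₂ sup) (s n) (n , refl)
    converges : s ⟶ᴿ l
    converges ε 0<ε = decidable-stable em λ ¬near →
      let far : ∀ n → s n ≤ l - ε
          far n = ≰⇒≥ λ l-ε≤sn → ¬near (n , λ m n≤m →
            ≤-from-difference (difference-nonneg (≤-trans l-ε≤sn (increasing s step n≤m)))
              (solve 3 (λ s l ε → s :- (l :- ε) := (s :- l) :- (:- ε)) refl (s m) l ε) ,
            ≤-trans (≤-from-difference (difference-nonneg (s≤l m))
                      (solve 2 (λ s l → l :- s := con (+ 0) :- (s :- l)) refl (s m) l)) (proj₁ 0<ε))
          l≤l-ε = proj₂ (proj₂ sup) (l - ε) λ x (n , x≈sn) → ≤-respˡ-≈ (sym x≈sn) (far n)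
      in <⇒≱ 0<ε (≤-from-difference (difference-nonneg l≤l-ε)
           (solve 2 (λ l ε → l :- ε :- l := con (+ 0) :- ε) refl l ε))

  -- Reduces to monotone convergence: the terms of `a + b` are nonnegative with partial sums below
  -- 2B, so the series of `a + b` and of `b` converge, and `a` is their difference.
  comparison : ∀ a b B → (∀ n → ∣ a n ∣≤ b n) → (∀ n → partialSum b n ≤ B) → ∃[ l ] partialSum a ⟶ᴿ l
  comparison a b B a≤b b≤B =
    let 0≤b = λ n → ∣∣≤⇒0≤ (a≤b n)
        l , b→l = monotone-convergence (partialSum b) B (λ n → grow _ (0≤b n)) b≤B
        m , c→m = monotone-convergence (partialSum c) (B + B)
          (λ n → grow _ (≤-respʳ-≈ (solve 2 (λ a b → a :- (:- b) := a :+ b) refl (a n) (b n)) (difference-nonneg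
              (proj₁ (a≤b n)))))
          (λ n → ≤-respˡ-≈ (sym (partialSum-+ a b n)) (+-mono-≤ (≤-trans (partialSum-mono (λ i → proj₂ (a≤b i)) n)
              (b≤B n)) (b≤B n)))
    in m - l , ⟶ᴿ-cong (λ n → trans (+-congʳ (partialSum-+ a b n)) (solve 2 (λ x y → (x :+ y) :- y := x) refl _ _))
         (⟶ᴿ-+ c→m (⟶ᴿ-neg b→l))
    where
    open Series commutativeRing using (partialSum-+)
    c = λ n → a n + b n
    grow : ∀ x {y} → 0# ≤ y → x ≤ x + y
    grow x {y} 0≤y = ≤-respˡ-≈ (+-identityʳ x) (+-monoʳ-≤ x 0≤y)
    partialSum-mono : ∀ {a b} → (∀ n → a n ≤ b n) → ∀ n → partialSum a n ≤ partialSum b n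
    partialSum-mono a≤b zero    = ≤-refl
    partialSum-mono a≤b (suc n) = +-mono-≤ (partialSum-mono a≤b n) (a≤b n)

-- Complex numbers and the exponential series

module ComplexNumbers (em : ExcludedMiddle 0ℓ) (ℝ : Reals) where
  open Reals ℝ
  open Theory ℝ
  open RealProperties em ℝ
  open Limits em ℝ

  ℂ-commutativeRing : CommutativeRing 0ℓ 0ℓ
  ℂ-commutativeRing = record
    { Carrier = ℂ
    ; _≈_     = _≈ᶜ_
    ; _+_     = ℂᴿ._+_
    ; _*_     = ℂᴿ._*_
    ; -_      = ℂᴿ.-_
    ; 0#      = ℂᴿ.0#
    ; 1#      = ℂᴿ.1#
    ; isCommutativeRing = record
      { isRing = record
        { +-isAbelianGroup = record
          { isGroup = record
            { isMonoid = record
              { isSemigroup = record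
                { isMagma = record
                  { isEquivalence = record
                    { refl  = refl , refl
                    ; sym   = λ (p , q) → sym p , sym q
                    ; trans = λ (p , q) (p′ , q′) → trans p p′ , trans q q′
                    }
                  ; ∙-cong = λ (p , q) (p′ , q′) → +-cong p p′ , +-cong q q′
                  }
                ; assoc = λ _ _ _ → +-assoc _ _ _ , +-assoc _ _ _
                }
              ; identity = (λ _ → +-identityˡ _ , +-identityˡ _) , (λ _ → +-identityʳ _ , +-identityʳ _)
              }
            ; inverse = (λ _ → -‿inverseˡ _ , -‿inverseˡ _) , (λ _ → -‿inverseʳ _ , -‿inverseʳ _)
            ; ⁻¹-cong = λ (p , q) → -‿cong p , -‿cong q
            }
          ; comm = λ _ _ → +-comm _ _ , +-comm _ _
          }
        ; *-cong = λ (p , q) (p′ , q′) →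
            +-cong (*-cong p p′) (-‿cong (*-cong q q′)) , +-cong (*-cong p q′) (*-cong q p′)
        ; *-assoc = λ (a +i b) (c +i d) (e +i f) →
            solve 6 (λ a b c d e f → (a :* c :- b :* d) :* e :- (a :* d :+ b :* c) :* f
                                  := a :* (c :* e :- d :* f) :- b :* (c :* f :+ d :* e)) refl a b c d e f ,
            solve 6 (λ a b c d e f → (a :* c :- b :* d) :* f :+ (a :* d :+ b :* c) :* e
                                  := a :* (c :* f :+ d :* e) :+ b :* (c :* e :- d :* f)) refl a b c d e f
        ; *-identity =
            (λ (a +i b) →
              solve 2 (λ a b → con (+ 1) :* a :- con (+ 0) :* b := a) refl a b ,
              solve 2 (λ a b → con (+ 1) :* b :+ con (+ 0) :* a := b) refl a b) ,
            (λ (a +i b) →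
              solve 2 (λ a b → a :* con (+ 1) :- b :* con (+ 0) := a) refl a b ,
              solve 2 (λ a b → a :* con (+ 0) :+ b :* con (+ 1) := b) refl a b)
        ; distrib =
            (λ (a +i b) (c +i d) (e +i f) →
              solve 6 (λ a b c d e f → a :* (c :+ e) :- b :* (d :+ f) := (a :* c :- b :* d) :+
                  (a :* e :- b :* f)) refl a b c d e f ,
              solve 6 (λ a b c d e f → a :* (d :+ f) :+ b :* (c :+ e) := (a :* d :+ b :* c) :+
                  (a :* f :+ b :* e)) refl a b c d e f) ,
            (λ (a +i b) (c +i d) (e +i f) →
              solve 6 (λ a b c d e f → (c :+ e) :* a :- (d :+ f) :* b := (c :* a :- d :* b) :+
                  (e :* a :- f :* b)) refl a b c d e f ,
              solve 6 (λ a b c d e f → (c :+ e) :* b :+ (d :+ f) :* a := (c :* b :+ d :* a) :+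
                  (e :* b :+ f :* a)) refl a b c d e f)
        }
      ; *-comm = λ (a +i b) (c +i d) →
          solve 4 (λ a b c d → a :* c :- b :* d := c :* a :- d :* b) refl a b c d ,
          solve 4 (λ a b c d → a :* d :+ b :* c := c :* b :+ d :* a) refl a b c d
      }
    }

  module ℂᶜ = CommutativeRing ℂ-commutativeRing
  module ℂₛ = IntegerCoefficients.Solver ℂ-commutativeRing
  module Sᴿ = Series commutativeRing
  module Sᶜ = Series ℂ-commutativeRing
  module ^ᴿ = SemiringExp semiring
  module ^ᶜ = SemiringExp ℂᶜ.semiring

  conj : ℂ → ℂ
  conj (x +i y) = x +i (- y)

  0+0≈0 : 0# ≈ 0# + 0#
  0+0≈0 = sym (+-identityˡ 0#)

  -0≈0 : - 0# ≈ 0#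
  -0≈0 = solve 0 (:- con (+ 0) := con (+ 0)) refl

  ofℝ-* : ∀ x y → ofℝ (x * y) ≈ᶜ ofℝ x ℂᴿ.* ofℝ y
  ofℝ-* x y = solve 2 (λ x y → x :* y := x :* y :- con (+ 0) :* con (+ 0)) refl x y ,
              solve 2 (λ x y → con (+ 0) := x :* con (+ 0) :+ con (+ 0) :* y) refl x y

  ofℝ-fromℕ : ∀ n → Sᶜ.# n ≈ᶜ ofℝ (fromℕ n)
  ofℝ-fromℕ zero    = refl , refl
  ofℝ-fromℕ (suc n) = +-congˡ (proj₁ (ofℝ-fromℕ n)) , trans (+-identityˡ _) (proj₂ (ofℝ-fromℕ n))

  infix 4 _≼_
  -- A bound on the 1-norm |re z| + |im z|. It is submultiplicative and involves no square roots,
  -- which is all that majorant series require.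
  _≼_ : ℂ → Carrier → Set
  z ≼ r = ∃[ p ] ∃[ q ] (∣ re z ∣≤ p × ∣ im z ∣≤ q × p + q ≤ r)

  ≼-resp : ∀ {z w r} → z ≈ᶜ w → z ≼ r → w ≼ r
  ≼-resp (re≈ , im≈) (p , q , z≤p , z≤q , p+q≤r) = p , q , ∣∣≤-resp re≈ z≤p , ∣∣≤-resp im≈ z≤q , p+q≤r

  ≼-cong : ∀ {z w r s} → z ≈ᶜ w → r ≈ s → z ≼ r → w ≼ s
  ≼-cong z≈w r≈s z≼r = let p , q , w≤p , w≤q , p+q≤r = ≼-resp z≈w z≼r in p , q , w≤p , w≤q , ≤-respʳ-≈ r≈s p+q≤r

  ≼-+ : ∀ {z w r s} → z ≼ r → w ≼ s → z ℂᴿ.+ w ≼ r + s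
  ≼-+ (p , q , z≤p , z≤q , p+q≤r) (p′ , q′ , w≤p′ , w≤q′ , p′+q′≤s) =
    p + p′ , q + q′ , ∣∣≤-+ z≤p w≤p′ , ∣∣≤-+ z≤q w≤q′ ,
    ≤-respˡ-≈ (solve 4 (λ p q p′ q′ → (p :+ q) :+ (p′ :+ q′) := (p :+ p′) :+ (q :+ q′)) refl p q p′ q′)
        (+-mono-≤ p+q≤r p′+q′≤s)

  ≼⇒0≤ : ∀ {z r} → z ≼ r → 0# ≤ r
  ≼⇒0≤ (p , q , z≤p , z≤q , p+q≤r) = ≤-trans (+-nonneg (∣∣≤⇒0≤ z≤p) (∣∣≤⇒0≤ z≤q)) p+q≤r

  ≼-* : ∀ {z w r s} → z ≼ r → w ≼ s → z ℂᴿ.* w ≼ r * s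
  ≼-* w≼r@(p , q , z≤p , z≤q , p+q≤r) (p′ , q′ , w≤p′ , w≤q′ , p′+q′≤s) =
    p * p′ + q * q′ , p * q′ + q * p′ ,
    ∣∣≤-+ (∣∣≤-* z≤p w≤p′) (∣∣≤-neg (∣∣≤-* z≤q w≤q′)) ,
    ∣∣≤-+ (∣∣≤-* z≤p w≤q′) (∣∣≤-* z≤q w≤p′) ,
    ≤-respˡ-≈ (solve 4 (λ p q p′ q′ → (p :+ q) :* (p′ :+ q′) := (p :* p′ :+ q :* q′) :+ (p :* q′ :+ q :* p′)) refl
        p q p′ q′)
      (*-mono-≤ (+-nonneg (∣∣≤⇒0≤ z≤p) (∣∣≤⇒0≤ z≤q)) (+-nonneg (∣∣≤⇒0≤ w≤p′) (∣∣≤⇒0≤ w≤q′)) p+q≤r p′+q′≤s)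

  ofℝ-≼ : ∀ {r} → 0# ≤ r → ofℝ r ≼ r
  ofℝ-≼ {r} 0≤r = r , 0# , nonneg⇒∣∣≤ 0≤r , nonneg⇒∣∣≤ ≤-refl , ≤-reflexive (+-identityʳ r)

  ∣re∣≤ : ∀ {z r} → z ≼ r → ∣ re z ∣≤ r
  ∣re∣≤ (p , q , z≤p , z≤q , p+q≤r) = ∣∣≤-mono (≤-trans (≤-respˡ-≈ (+-identityʳ p) (+-monoʳ-≤ p (∣∣≤⇒0≤ z≤q)))
      p+q≤r) z≤p

  ∣im∣≤ : ∀ {z r} → z ≼ r → ∣ im z ∣≤ r
  ∣im∣≤ (p , q , z≤p , z≤q , p+q≤r) = ∣∣≤-mono (≤-trans (≤-respˡ-≈ (+-identityˡ q) (+-mono-≤ (∣∣≤⇒0≤ z≤p) ≤-refl))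
      p+q≤r) z≤q

  ⟶-components : ∀ {s z} → s ⟶ z → (re ∘ s ⟶ᴿ re z) × (im ∘ s ⟶ᴿ im z)
  ⟶-components {s} {z} s→z =
    (λ ε 0<ε → let N , near = s→z ε 0<ε in N , λ n N≤n →
      ∣∣≤-square 0<ε (≤-trans (≤-respˡ-≈ (+-identityʳ _) (+-monoʳ-≤ _ (square-nonneg _)))
          (proj₁ (proj₂ (near n N≤n))))) ,
    (λ ε 0<ε → let N , near = s→z ε 0<ε in N , λ n N≤n →
      ∣∣≤-square 0<ε (≤-trans (≤-respˡ-≈ (+-identityˡ _) (+-mono-≤ (square-nonneg _) ≤-refl))
          (proj₁ (proj₂ (near n N≤n)))))

  components-⟶ : ∀ {s z} → re ∘ s ⟶ᴿ re z → im ∘ s ⟶ᴿ im z → s ⟶ z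
  components-⟶ {s} {z} re→ im→ ε 0<ε =
    -- Half of ε in each component leaves a total square of at most ε²/2, which gives the strict
    -- inequality that `_⟶_` asks for.
    let δ = ½ * ε
        0<δ = *-pos 0<½ 0<ε
        M , re≤ = re→ δ 0<δ
        N , im≤ = im→ δ 0<δ
    in M ⊔ N , λ n M⊔N≤n → 0<ε ,
      strict (∣∣≤-* (re≤ n (ℕ.≤-trans (ℕ.m≤m⊔n M N) M⊔N≤n)) (re≤ n (ℕ.≤-trans (ℕ.m≤m⊔n M N) M⊔N≤n)))
             (∣∣≤-* (im≤ n (ℕ.≤-trans (ℕ.m≤n⊔m M N) M⊔N≤n)) (im≤ n (ℕ.≤-trans (ℕ.m≤n⊔m M N) M⊔N≤n)))
    where
    strict : ∀ {x y} → ∣ x ∣≤ (½ * ε) * (½ * ε) → ∣ y ∣≤ (½ * ε) * (½ * ε) → x + y < ε * ε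
    strict {x} {y} (_ , x≤) (_ , y≤) = ≰⇒> λ εε≤x+y → <⇒≱ (*-pos 0<2 (*-pos 0<δ 0<δ))
      (≤-from-difference (difference-nonneg (≤-trans εε≤x+y (+-mono-≤ x≤ y≤)))
        (trans (+-congˡ (-‿cong (*-cong (sym (halves ε)) (sym (halves ε)))))
          (solve 1 (λ h → h :* h :+ h :* h :- (h :+ h) :* (h :+ h) := con (+ 0) :- (con (+ 1) :+ con (+ 1)) :*
              (h :* h)) refl (½ * ε))))
      where 0<δ = *-pos 0<½ 0<ε

  ⟶-cong : ∀ {s t z} → (∀ n → s n ≈ᶜ t n) → s ⟶ z → t ⟶ z
  ⟶-cong s≈t s→z = let re→ , im→ = ⟶-components s→z in
    components-⟶ (⟶ᴿ-cong (proj₁ ∘ s≈t) re→) (⟶ᴿ-cong (proj₂ ∘ s≈t) im→)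

  ⟶-unique : ∀ {s z w} → s ⟶ z → s ⟶ w → z ≈ᶜ w
  ⟶-unique s→z s→w = ⟶ᴿ-unique (proj₁ (⟶-components s→z)) (proj₁ (⟶-components s→w)) ,
                      ⟶ᴿ-unique (proj₂ (⟶-components s→z)) (proj₂ (⟶-components s→w))

  ⟶-+ : ∀ {s t z w} → s ⟶ z → t ⟶ w → (λ n → s n ℂᴿ.+ t n) ⟶ (z ℂᴿ.+ w)
  ⟶-+ s→z t→w = let re→z , im→z = ⟶-components s→z; re→w , im→w = ⟶-components t→w in
    components-⟶ (⟶ᴿ-+ re→z re→w) (⟶ᴿ-+ im→z im→w)

  ⟶-* : ∀ {s t z w} → s ⟶ z → t ⟶ w → (λ n → s n ℂᴿ.* t n) ⟶ (z ℂᴿ.* w)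
  ⟶-* s→z t→w = let re→z , im→z = ⟶-components s→z; re→w , im→w = ⟶-components t→w in
    components-⟶ (⟶ᴿ-+ (⟶ᴿ-* re→z re→w) (⟶ᴿ-neg (⟶ᴿ-* im→z im→w))) (⟶ᴿ-+ (⟶ᴿ-* re→z im→w) (⟶ᴿ-* im→z re→w))

  ⟶-constant : ∀ {z} → (λ _ → z) ⟶ z
  ⟶-constant = components-⟶ ⟶ᴿ-constant ⟶ᴿ-constant

  ⟶-conj : ∀ {s z} → s ⟶ z → (conj ∘ s) ⟶ (conj z)
  ⟶-conj s→z = let re→ , im→ = ⟶-components s→z in components-⟶ re→ (⟶ᴿ-neg im→)

  conj-* : ∀ z w → conj (z ℂᴿ.* w) ≈ᶜ conj z ℂᴿ.* conj w
  conj-* (a +i b) (c +i d) =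
    solve 4 (λ a b c d → a :* c :- b :* d := a :* c :- (:- b) :* (:- d)) refl a b c d ,
    solve 4 (λ a b c d → :- (a :* d :+ b :* c) := a :* (:- d) :+ (:- b) :* c) refl a b c d

  fromℕ-pos′ : ∀ {n} → 1 ℕ.≤ n → 0# < fromℕ n
  fromℕ-pos′ {suc n} _ = fromℕ-pos n

  1/_! : ℕ → Carrier
  1/ n ! = fromℕ (n !) ⁻¹

  n!>0 : ∀ n → 0# < fromℕ (n !)
  n!>0 n = fromℕ-pos′ (ℕ.1≤n! n)

  1/0!≈1 : 1/ 0 ! ≈ 1#
  1/0!≈1 = trans (sym (*-identityˡ _)) (trans (*-congʳ (sym (+-identityʳ 1#))) (⁻¹-inverseʳ _ (pos⇒≉0 (n!>0 0))))

  1/suc! : ∀ n → fromℕ (suc n) * 1/ suc n ! ≈ 1/ n !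
  1/suc! n = begin
    a * c ⁻¹                ≈⟨ *-identityʳ _ ⟨
    a * c ⁻¹ * 1#           ≈⟨ *-congˡ (⁻¹-inverseʳ b (pos⇒≉0 (n!>0 n))) ⟨
    a * c ⁻¹ * (b * b ⁻¹)
      ≈⟨ solve 4 (λ a c′ b b′ → (a :* c′) :* (b :* b′) := (a :* b) :* c′ :* b′) refl a (c ⁻¹) b (b ⁻¹) ⟩
    a * b * c ⁻¹ * b ⁻¹     ≈⟨ *-congʳ (*-congʳ (SemiringMult.×1-homo-* semiring (suc n) (n !))) ⟨
    c * c ⁻¹ * b ⁻¹         ≈⟨ *-congʳ (⁻¹-inverseʳ c (pos⇒≉0 (n!>0 (suc n)))) ⟩
    1# * b ⁻¹               ≈⟨ *-identityˡ _ ⟩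
    b ⁻¹                    ∎
    where
    open SetoidReasoning setoid
    a = fromℕ (suc n)
    b = fromℕ (n !)
    c = fromℕ (suc n !)

  *-cancelˡ : ∀ {z x y} → ¬ (z ≈ 0#) → z * x ≈ z * y → x ≈ y
  *-cancelˡ {z} {x} {y} z≉0 zx≈zy = x-y≈0⇒x≈y (*-cancelˡ-≈0 z≉0
    (trans (solve 3 (λ x y z → z :* (x :- y) := z :* x :- z :* y) refl x y z) (trans (+-congʳ zx≈zy) (-‿inverseʳ _))))

  module Eᴿ = Sᴿ.Exponential 1/_! 1/0!≈1 1/suc! (λ n → *-cancelˡ (pos⇒≉0 (fromℕ-pos n)))

  ofℝ-*-components : ∀ x z → ofℝ x ℂᴿ.* z ≈ᶜ (x * re z) +i (x * im z)
  ofℝ-*-components x (a +i b) =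
    solve 3 (λ x a b → x :* a :- con (+ 0) :* b := x :* a) refl x a b ,
    solve 3 (λ x a b → x :* b :+ con (+ 0) :* a := x :* b) refl x a b

  private
    #-cancel : ∀ n {z w} → Sᶜ.# suc n ℂᴿ.* z ≈ᶜ Sᶜ.# suc n ℂᴿ.* w → z ≈ᶜ w
    #-cancel n {z} {w} nz≈nw =
      *-cancelˡ n≉0 (trans (sym (proj₁ (scale z))) (trans (proj₁ nz≈nw) (proj₁ (scale w)))) ,
      *-cancelˡ n≉0 (trans (sym (proj₂ (scale z))) (trans (proj₂ nz≈nw) (proj₂ (scale w))))
      where
      n≉0 = pos⇒≉0 (fromℕ-pos n)
      scale : ∀ z → Sᶜ.# suc n ℂᴿ.* z ≈ᶜ (fromℕ (suc n) * re z) +i (fromℕ (suc n) * im z)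
      scale z = ℂᶜ.trans (ℂᶜ.*-congʳ (ofℝ-fromℕ (suc n))) (ofℝ-*-components _ z)

  module Eᶜ = Sᶜ.Exponential (λ n → ofℝ (1/ n !)) (1/0!≈1 , refl)
    (λ n → ℂᶜ.trans (ℂᶜ.*-congʳ (ofℝ-fromℕ (suc n))) (ℂᶜ.trans (ℂᶜ.sym (ofℝ-* _ _)) (1/suc! n , refl)))
    #-cancel

  ^-≼ : ∀ {z r} → z ≼ r → ∀ n → z ^ᶜ.^ n ≼ r ^ᴿ.^ n
  ^-≼ z≼r zero    = ofℝ-≼ 0≤1
  ^-≼ z≼r (suc n) = ≼-* z≼r (^-≼ z≼r n)

  term-≼ : ∀ {z r} → z ≼ r → ∀ n → Eᶜ.term z n ≼ Eᴿ.term r n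
  term-≼ z≼r n = ≼-* (ofℝ-≼ (proj₁ (⁻¹-pos (n!>0 n)))) (^-≼ z≼r n)

  term-nonneg : ∀ {r} → 0# ≤ r → ∀ n → 0# ≤ Eᴿ.term r n
  term-nonneg 0≤r n = ≼⇒0≤ (term-≼ (ofℝ-≼ 0≤r) n)

  -- From the first index N₀ ≥ 2r on, terms at least halve, so the sum
  -- partialSum n + 2 term n no longer increases.
  exponential-bounded : ∀ r → 0# ≤ r → ∃[ B ] (∀ n → Sᴿ.partialSum (Eᴿ.term r) n ≤ B)
  exponential-bounded r 0≤r =
    let N₀ , 2r≤N₀ = archimedean (2# * r) in S N₀ + 2# * t N₀ , λ n → ≤-trans
      (increasing S (λ m → ≤-respˡ-≈ (+-identityʳ _) (+-monoʳ-≤ _ (0≤t m))) (ℕ.m≤n+m n N₀))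
      (≤-trans (≤-respˡ-≈ (+-identityʳ _) (+-monoʳ-≤ _ (*-nonneg (proj₁ 0<2) (0≤t (N₀ ℕ.+ n))))) (tail N₀ 2r≤N₀ n))
    where
    t = Eᴿ.term r
    S = Sᴿ.partialSum t
    0≤t = term-nonneg 0≤r
    halving : ∀ n → 2# * r ≤ fromℕ n → 2# * t (suc n) ≤ t n
    halving n 2r≤n = *-cancelˡ-≤ (fromℕ-pos n)
      (≤-respˡ-≈ (trans (trans (*-assoc _ _ _) (*-congˡ (sym (Eᴿ.D-term r n))))
                   (solve 3 (λ c m t → c :* (m :* t) := m :* (c :* t)) refl 2# (fromℕ (suc n)) (t (suc n))))
        (≤-trans (≤-resp (*-comm _ _) (*-comm _ _) (*-monoˡ-≤ (0≤t n) 2r≤n))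
          (≤-resp (+-identityˡ _) (solve 2 (λ n t → t :+ n :* t := (con (+ 1) :+ n) :* t) refl (fromℕ n) (t n))
            (+-mono-≤ (0≤t n) (≤-refl {fromℕ n * t n})))))
    tail : ∀ N₀ → 2# * r ≤ fromℕ N₀ → ∀ n → S (N₀ ℕ.+ n) + 2# * t (N₀ ℕ.+ n) ≤ S N₀ + 2# * t N₀
    tail N₀ 2r≤N₀ zero    rewrite ℕ.+-identityʳ N₀ = ≤-refl
    tail N₀ 2r≤N₀ (suc n) rewrite ℕ.+-suc N₀ n = ≤-trans
      (≤-respʳ-≈ (solve 2 (λ s t → s :+ t :+ t := s :+ (con (+ 1) :+ con (+ 1)) :* t) refl (S m) (t m))
        (+-mono-≤ (≤-refl {S m + t m}) (halving m (≤-trans 2r≤N₀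
          (≤-resp (+-identityʳ _) (sym (SemiringMult.×-homo-+ semiring 1# N₀ n)) (+-monoʳ-≤ (fromℕ N₀)
              (fromℕ-nonneg n)))))))
      (tail N₀ 2r≤N₀ n)
      where m = N₀ ℕ.+ n

  re-partialSum : ∀ a n → re (Sᶜ.partialSum a n) ≈ Sᴿ.partialSum (re ∘ a) n
  re-partialSum a zero    = refl
  re-partialSum a (suc n) = +-congʳ (re-partialSum a n)

  im-partialSum : ∀ a n → im (Sᶜ.partialSum a n) ≈ Sᴿ.partialSum (im ∘ a) n
  im-partialSum a zero    = refl
  im-partialSum a (suc n) = +-congʳ (im-partialSum a n)

  bound : ∀ z → ∃[ r ] z ≼ r
  bound z = let p , re≤p = magnitude (re z); q , im≤q = magnitude (im z) in p + q , p , q , re≤p , im≤q , ≤-refl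

  abstract
    -- The real and imaginary parts of the terms are dominated by the terms of the bounded real
    -- series at `r`, so `comparison` yields a limit for each.
    exp-converges : ∀ z → ∃[ w ] Sᶜ.partialSum (Eᶜ.term z) ⟶ w
    exp-converges z =
      let r , z≼r = bound z
          B , ≤B = exponential-bounded r (≼⇒0≤ z≼r)
          c , re→c = comparison (re ∘ Eᶜ.term z) (Eᴿ.term r) B (λ n → ∣re∣≤ (term-≼ z≼r n)) ≤B
          s , im→s = comparison (im ∘ Eᶜ.term z) (Eᴿ.term r) B (λ n → ∣im∣≤ (term-≼ z≼r n)) ≤B
      in c +i s , components-⟶ (⟶ᴿ-cong (λ n → sym (re-partialSum _ n)) re→c)
           (⟶ᴿ-cong (λ n → sym (im-partialSum _ n)) im→s)

  exp : ℂ → ℂ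
  exp z = proj₁ (exp-converges z)

  exp-limit : ∀ z → Sᶜ.partialSum (Eᶜ.term z) ⟶ (exp z)
  exp-limit z = proj₂ (exp-converges z)

-- Addition law of the exponential, and the unit circle

module ExponentialProperties (em : ExcludedMiddle 0ℓ) (ℝ : Reals) where
  open Reals ℝ
  open Theory ℝ
  open RealProperties em ℝ
  open Limits em ℝ
  open ComplexNumbers em ℝ

  0≼0 : ℂᴿ.0# ≼ 0#
  0≼0 = ofℝ-≼ ≤-refl

  tail-≼ : ∀ {b β} → (∀ n → b n ≼ β n) → ∀ {K M} → K ℕ.≤ M →
           (Sᶜ.partialSum b M ℂᴿ.+ ℂᴿ.- Sᶜ.partialSum b K) ≼ (Sᴿ.partialSum β M - Sᴿ.partialSum β K)
  tail-≼ {b} {β} b≼β K≤M = go (ℕ.≤⇒≤′ K≤M)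
    where
    go : ∀ {K M} → K ℕ.≤′ M → (Sᶜ.partialSum b M ℂᴿ.+ ℂᴿ.- Sᶜ.partialSum b K) ≼ (Sᴿ.partialSum β M - Sᴿ.partialSum β K)
    go {K} ℕ.≤′-refl = ≼-cong (ℂᶜ.sym (ℂᶜ.-‿inverseʳ (Sᶜ.partialSum b K))) (sym (-‿inverseʳ (Sᴿ.partialSum β K))) 0≼0
    go {K} (ℕ.≤′-step {m} K≤m) = ≼-cong
      (ℂₛ.solve 3 (λ s t x → (s ℂₛ.:- t) ℂₛ.:+ x ℂₛ.:= (s ℂₛ.:+ x) ℂₛ.:- t) ℂᶜ.refl (Sᶜ.partialSum b m)
          (Sᶜ.partialSum b K) (b m))
      (solve 3 (λ s t x → (s :- t) :+ x := (s :+ x) :- t) refl (Sᴿ.partialSum β m) (Sᴿ.partialSum β K) (β m))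
      (≼-+ (go K≤m) (b≼β m))

  -- The error of the triangular sum against the product of partial sums is
  -- dominated termwise by the corresponding error for the majorants.
  product-error : ∀ {a b α β} → (∀ n → a n ≼ α n) → (∀ n → b n ≼ β n) → ∀ N {M} → N ℕ.≤ M →
    (Sᶜ.partialSum a N ℂᴿ.* Sᶜ.partialSum b M ℂᴿ.+ ℂᴿ.- Sᶜ.partialSum (a Sᶜ.∗ b) N) ≼
    (Sᴿ.partialSum α N * Sᴿ.partialSum β M - Sᴿ.partialSum (α Sᴿ.∗ β) N)
  product-error {a} {b} {α} {β} a≼α b≼β zero {M} _ = ≼-cong
    (ℂₛ.solve 1 (λ s → ℂₛ.con (+ 0) ℂₛ.:= ℂₛ.con (+ 0) ℂₛ.:* s ℂₛ.:- ℂₛ.con (+ 0)) ℂᶜ.refl (Sᶜ.partialSum b M))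
    (solve 1 (λ s → con (+ 0) := con (+ 0) :* s :- con (+ 0)) refl (Sᴿ.partialSum β M))
    0≼0
  product-error {a} {b} {α} {β} a≼α b≼β (suc N) {M} N<M = ≼-cong
    (ℂᶜ.trans
      (ℂₛ.solve 5 (λ a A B B′ T → a ℂₛ.:* (B ℂₛ.:- B′) ℂₛ.:+ (A ℂₛ.:* B ℂₛ.:- T) ℂₛ.:= (a ℂₛ.:+ A) ℂₛ.:* B ℂₛ.:-
          (a ℂₛ.:* B′ ℂₛ.:+ T)) ℂᶜ.refl (a 0) (Sᶜ.partialSum (a ∘ suc) N) (Sᶜ.partialSum b M) (Sᶜ.partialSum b
          (suc N)) (Sᶜ.partialSum (a ∘ suc Sᶜ.∗ b) N))
      (ℂᶜ.+-cong (ℂᶜ.*-congʳ (ℂᶜ.sym (Sᶜ.partialSum-head a N))) (ℂᶜ.-‿cong (ℂᶜ.sym (Sᶜ.partialSum-∗ a b N)))))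
    (trans
      (solve 5 (λ a A B B′ T → a :* (B :- B′) :+ (A :* B :- T) := (a :+ A) :* B :- (a :* B′ :+ T)) refl (α 0)
          (Sᴿ.partialSum (α ∘ suc) N) (Sᴿ.partialSum β M) (Sᴿ.partialSum β (suc N)) (Sᴿ.partialSum
          (α ∘ suc Sᴿ.∗ β) N))
      (+-cong (*-congʳ (sym (Sᴿ.partialSum-head α N))) (-‿cong (sym (Sᴿ.partialSum-∗ α β N)))))
    (≼-+ (≼-* (a≼α 0) (tail-≼ b≼β N<M)) (product-error (a≼α ∘ suc) b≼β N (ℕ.<⇒≤ N<M)))

  partialSum-nonneg : ∀ {a} → (∀ n → 0# ≤ a n) → ∀ n → 0# ≤ Sᴿ.partialSum a n
  partialSum-nonneg 0≤a zero    = ≤-refl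
  partialSum-nonneg 0≤a (suc n) = +-nonneg (partialSum-nonneg 0≤a n) (0≤a n)

  partialSum-increasing : ∀ {a} → (∀ n → 0# ≤ a n) → ∀ {m n} → m ℕ.≤ n → Sᴿ.partialSum a m ≤ Sᴿ.partialSum a n
  partialSum-increasing {a} 0≤a = increasing (Sᴿ.partialSum a) λ n → ≤-respˡ-≈ (+-identityʳ _) (+-monoʳ-≤ _ (0≤a n))

  ∗-nonneg : ∀ {a b} → (∀ n → 0# ≤ a n) → (∀ n → 0# ≤ b n) → ∀ n → 0# ≤ (a Sᴿ.∗ b) n
  ∗-nonneg 0≤a 0≤b zero    = *-nonneg (0≤a 0) (0≤b 0)
  ∗-nonneg 0≤a 0≤b (suc n) = +-nonneg (*-nonneg (0≤a 0) (0≤b (suc n))) (∗-nonneg (0≤a ∘ suc) 0≤b n)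

  -- The rectangle of index pairs i < N, j < M lies in the triangle i + j < N + M, and all terms are
  -- nonnegative.
  square-≤-triangle : ∀ {a b} → (∀ n → 0# ≤ a n) → (∀ n → 0# ≤ b n) → ∀ N M →
                      Sᴿ.partialSum a N * Sᴿ.partialSum b M ≤ Sᴿ.partialSum (a Sᴿ.∗ b) (N ℕ.+ M)
  square-≤-triangle 0≤a 0≤b zero    M = ≤-respˡ-≈ (sym (zeroˡ _)) (partialSum-nonneg (∗-nonneg 0≤a 0≤b) M)
  square-≤-triangle {a} {b} 0≤a 0≤b (suc N) M =
    ≤-resp (trans (sym (distribʳ _ _ _)) (*-congʳ (sym (Sᴿ.partialSum-head a N)))) (sym (Sᴿ.partialSum-∗ a b (N ℕ.+ M)))
      (+-mono-≤ (*-monoˡ-≤ (0≤a 0) (partialSum-increasing 0≤b (ℕ.m≤n+m M (suc N))))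
                (square-≤-triangle (0≤a ∘ suc) 0≤b N M))

  exp-cong : ∀ {z w} → z ≈ᶜ w → exp z ≈ᶜ exp w
  exp-cong z≈w = ⟶-unique (⟶-cong (Sᶜ.partialSum-cong (λ n → ℂᶜ.*-congˡ (^ᶜ.^-congˡ n z≈w))) (exp-limit _))
      (exp-limit _)

  -- By `term-∗` the triangular sums are the partial sums of the series at `z + w`. So it suffices
  -- that their distance `e` from the product of partial sums tends to 0.
  exp-+ : ∀ z w → exp (z ℂᴿ.+ w) ≈ᶜ exp z ℂᴿ.* exp w
  exp-+ z w = ⟶-unique (exp-limit (z ℂᴿ.+ w)) (⟶-cong
    (λ n → ℂₛ.solve 2 (λ p t → p ℂₛ.:+ ℂₛ.:- (p ℂₛ.:- t) ℂₛ.:= t) ℂᶜ.refl (P n) (T n))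
    (components-⟶ (proj₁ diff) (proj₂ diff)))
    where
    r = proj₁ (bound z)
    s = proj₁ (bound w)
    z≼r = proj₂ (bound z)
    w≼s = proj₂ (bound w)
    0≤r = ≼⇒0≤ z≼r
    0≤s = ≼⇒0≤ w≼s
    P = λ n → Sᶜ.partialSum (Eᶜ.term z) n ℂᴿ.* Sᶜ.partialSum (Eᶜ.term w) n
    T = λ n → Sᶜ.partialSum (Eᶜ.term (z ℂᴿ.+ w)) n
    e = λ n → P n ℂᴿ.+ ℂᴿ.- T n
    S = Sᴿ.partialSum (Eᴿ.term (r + s))
    S→ = monotone-convergence S (proj₁ (exponential-bounded (r + s) (+-nonneg 0≤r 0≤s)))
           (λ n → partialSum-increasing (term-nonneg (+-nonneg 0≤r 0≤s)) (ℕ.n≤1+n n))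
           (proj₂ (exponential-bounded (r + s) (+-nonneg 0≤r 0≤s)))
    -- The error is bounded by that of the real majorants at `r` and `s`: their product of partial
    -- sums is at most S (n + n), and their triangular sum is S n. As `S` converges, the gap is
    -- null.
    e≼ : ∀ n → e n ≼ (S (n ℕ.+ n) - S n)
    e≼ n =
      let p , q , e≤p , e≤q , p+q≤ = product-error (term-≼ z≼r) (term-≼ w≼s) n (ℕ.≤-refl {n})
          E≈ : ∀ m → Sᴿ.partialSum (Eᴿ.term r Sᴿ.∗ Eᴿ.term s) m ≈ S m
          E≈ = Sᴿ.partialSum-cong (Eᴿ.term-∗ r s)
      in ≼-resp (ℂᶜ.+-congˡ (ℂᶜ.-‿cong (Sᶜ.partialSum-cong (Eᶜ.term-∗ z w) n)))
           (p , q , e≤p , e≤q , ≤-trans p+q≤ (+-mono-≤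
             (≤-respʳ-≈ (E≈ (n ℕ.+ n)) (square-≤-triangle (term-nonneg 0≤r) (term-nonneg 0≤s) n n))
             (≤-reflexive (-‿cong (E≈ n)))))
    gap→0 : Null (λ n → S (n ℕ.+ n) - S n)
    gap→0 = Null-cong (λ n → solve 3 (λ x y l → (x :- l) :+ (:- con (+ 1)) :* (y :- l) := x :- y) refl
        (S (n ℕ.+ n)) (S n) (proj₁ S→))
      (Null-+ (Null-subsequence (λ n → n ℕ.+ n) (λ n → ℕ.m≤m+n n n) (proj₂ S→)) (Null-scale (- 1#) (proj₂ S→)))
    P→ = ⟶-components (⟶-* (exp-limit z) (exp-limit w))
    diff : ((λ n → re (P n ℂᴿ.+ ℂᴿ.- e n)) ⟶ᴿ re (exp z ℂᴿ.* exp w)) × ((λ n → im (P n ℂᴿ.+ ℂᴿ.- e n)) ⟶ᴿ im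
        (exp z ℂᴿ.* exp w))
    diff = Null-cong (λ n → sub _ _ _) (Null-+ (proj₁ P→) (Null-scale (- 1#) (Null-squeeze (λ n → ∣re∣≤ (e≼ n))
        gap→0))) ,
           Null-cong (λ n → sub _ _ _) (Null-+ (proj₂ P→) (Null-scale (- 1#) (Null-squeeze (λ n → ∣im∣≤ (e≼ n)) gap→0)))
      where
      sub : ∀ p l x → (p - l) + (- 1#) * x ≈ (p + - x) - l
      sub = solve 3 (λ p l x → (p :- l) :+ (:- con (+ 1)) :* x := (p :+ :- x) :- l) refl

  exp-0 : exp ℂᴿ.0# ≈ᶜ ℂᴿ.1#
  exp-0 = ⟶-unique (exp-limit ℂᴿ.0#) (components-⟶ (from1 (λ n → proj₁ (sum≈1 n))) (from1 (λ n → proj₂ (sum≈1 n))))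
    where
    sum≈1 : ∀ n → Sᶜ.partialSum (Eᶜ.term ℂᴿ.0#) (suc n) ≈ᶜ ℂᴿ.1#
    sum≈1 zero    = ℂᶜ.trans (ℂᶜ.+-identityˡ _) (ℂᶜ.trans (ℂᶜ.*-identityʳ _) (1/0!≈1 , refl))
    sum≈1 (suc n) = ℂᶜ.trans (ℂᶜ.+-cong (sum≈1 n) (ℂᶜ.trans (ℂᶜ.*-congˡ (ℂᶜ.zeroˡ _)) (ℂᶜ.zeroʳ _))) (ℂᶜ.+-identityʳ _)
    -- The empty partial sum is 0, so the sequence is constant only from index 1 on.
    from1 : ∀ {s l} → (∀ n → s (suc n) ≈ l) → s ⟶ᴿ l
    from1 {s} {l} s≈l ε 0<ε = 1 , λ { (suc n) _ → ∣∣≤-resp (sym (trans (+-congʳ (s≈l n)) (-‿inverseʳ l)))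
      (∣∣≤-mono (proj₁ 0<ε) (nonneg⇒∣∣≤ ≤-refl)) }

  exp-conj : ∀ z → exp (conj z) ≈ᶜ conj (exp z)
  exp-conj z = ⟶-unique (exp-limit (conj z)) (⟶-cong conj-partialSum (⟶-conj (exp-limit z)))
    where
    conj-^ : ∀ n → conj (z ^ᶜ.^ n) ≈ᶜ conj z ^ᶜ.^ n
    conj-^ zero    = refl , -0≈0
    conj-^ (suc n) = ℂᶜ.trans (conj-* z (z ^ᶜ.^ n)) (ℂᶜ.*-congˡ (conj-^ n))
    conj-partialSum : ∀ n → conj (Sᶜ.partialSum (Eᶜ.term z) n) ≈ᶜ Sᶜ.partialSum (Eᶜ.term (conj z)) n
    conj-partialSum zero    = refl , -0≈0
    conj-partialSum (suc n) = ℂᶜ.trans (refl , solve 2 (λ x y → :- (x :+ y) := (:- x) :+ (:- y)) refl _ _)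
      (ℂᶜ.+-cong (conj-partialSum n) (ℂᶜ.trans (conj-* _ _) (ℂᶜ.*-cong (refl , -0≈0) (conj-^ n))))

  cis : Carrier → ℂ
  cis x = exp (0# +i x)

  cis-cong : ∀ {x y} → x ≈ y → cis x ≈ᶜ cis y
  cis-cong x≈y = exp-cong (refl , x≈y)

  cis-+ : ∀ x y → cis (x + y) ≈ᶜ cis x ℂᴿ.* cis y
  cis-+ x y = ℂᶜ.trans (exp-cong (0+0≈0 , refl)) (exp-+ (0# +i x) (0# +i y))

  cis-0 : cis 0# ≈ᶜ ℂᴿ.1#
  cis-0 = exp-0

  -- The squared modulus is `cis x` times its conjugate, which by `exp-conj` is `cis (- x)`; the
  -- addition law turns the product into `cis 0#`.
  ∣cis∣²≈1 : ∀ x → ∣ cis x ∣² ≈ 1#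
  ∣cis∣²≈1 x = trans
    (solve 2 (λ a b → a :* a :+ b :* b := a :* a :- b :* (:- b)) refl (re (cis x)) (im (cis x)))
    (proj₁ (ℂᶜ.trans (ℂᶜ.*-congˡ (ℂᶜ.sym (ℂᶜ.trans (exp-cong (refl , refl)) (exp-conj (0# +i x)))))
      (ℂᶜ.trans (ℂᶜ.sym (cis-+ x (- x))) (ℂᶜ.trans (cis-cong (-‿inverseʳ x)) cis-0))))

-- Linear algebra

module MatrixProperties {c ℓ} (R : CommutativeRing c ℓ) where
  open CommutativeRing R hiding (zero)
  open Matrices rawRing
  open IntegerCoefficients R
  open Solver
  open SemiringExp semiring using (_^_)
  open SemiringSum semiring public
    using (sum; sum-cong-≋; ∑-distrib-+; ∑-comm; *-distribˡ-sum; *-distribʳ-sum; sum-replicate; sum-replicate-zero)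

  infixl 6 _+[_]_
  -- One operation covers scaled sums and, with s = -1, differences, so each linear map needs a
  -- single linearity lemma.
  _+[_]_ : ∀ {n} → Vec n → Carrier → Vec n → Vec n
  (x +[ s ] y) i = x i + s * y i

  sum-zero : ∀ {n} (x : Vec n) → x ≋ 0ᵛ → sum x ≈ 0#
  sum-zero {n} x x≋0 = trans (sum-cong-≋ x≋0) (sum-replicate-zero n)

  sum-+[] : ∀ {n} (x : Vec n) s y → sum (x +[ s ] y) ≈ sum x + s * sum y
  sum-+[] x s y = trans (∑-distrib-+ x (λ i → s * y i)) (+-congˡ (sym (*-distribˡ-sum s y)))

  e-diagonal : ∀ {n} (a : Fin n) → e a a ≈ 1#
  e-diagonal zero    = refl
  e-diagonal (suc a) = e-diagonal a

  e-off-diagonal : ∀ {n} {a b : Fin n} → a ≢ b → e a b ≈ 0#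
  e-off-diagonal {a = a} {b} a≢b with a Fin.≟ b
  ... | yes a≡b = contradiction a≡b a≢b
  ... | no  _   = refl

  e-sym : ∀ {n} (a b : Fin n) → e a b ≈ e b a
  e-sym zero    zero    = refl
  e-sym zero    (suc b) = refl
  e-sym (suc a) zero    = refl
  e-sym (suc a) (suc b) = e-sym a b

  ⟨,e⟩ : ∀ {n} (x : Vec n) a → ⟨ x , e a ⟩ ≈ x a
  ⟨,e⟩ x zero    = trans (+-cong (*-identityʳ _) (sum-zero (λ i → x (suc i) * 0#) (λ i → zeroʳ _))) (+-identityʳ _)
  ⟨,e⟩ x (suc a) = trans (+-cong (zeroʳ _) (⟨,e⟩ (x ∘ suc) a)) (+-identityˡ _)

  ⟨⟩-comm : ∀ {n} (x y : Vec n) → ⟨ x , y ⟩ ≈ ⟨ y , x ⟩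
  ⟨⟩-comm x y = sum-cong-≋ λ i → *-comm (x i) (y i)

  ⟨⟩-cong : ∀ {n} {x x′ y y′ : Vec n} → x ≋ x′ → y ≋ y′ → ⟨ x , y ⟩ ≈ ⟨ x′ , y′ ⟩
  ⟨⟩-cong x≋x′ y≋y′ = sum-cong-≋ λ i → *-cong (x≋x′ i) (y≋y′ i)

  ⟨+[],⟩ : ∀ {n} (x : Vec n) s y z → ⟨ x +[ s ] y , z ⟩ ≈ ⟨ x , z ⟩ + s * ⟨ y , z ⟩
  ⟨+[],⟩ x s y z = trans
    (sum-cong-≋ λ i → solve 4 (λ x s y z → (x :+ s :* y) :* z := x :* z :+ s :* (y :* z)) refl (x i) s (y i) (z i))
    (sum-+[] (λ i → x i * z i) s (λ i → y i * z i))

  ⟨,+[]⟩ : ∀ {n} (x : Vec n) y s z → ⟨ x , y +[ s ] z ⟩ ≈ ⟨ x , y ⟩ + s * ⟨ x , z ⟩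
  ⟨,+[]⟩ x y s z = trans (⟨⟩-comm x (y +[ s ] z)) (trans (⟨+[],⟩ y s z x) (+-cong (⟨⟩-comm y x)
      (*-congˡ (⟨⟩-comm z x))))

  ⟨0,⟩ : ∀ {n} {x : Vec n} y → x ≋ 0ᵛ → ⟨ x , y ⟩ ≈ 0#
  ⟨0,⟩ {x = x} y x≋0 = sum-zero (λ i → x i * y i) λ i → trans (*-congʳ (x≋0 i)) (zeroˡ _)

  ⟨·,⟩ : ∀ {n} r (x y : Vec n) → ⟨ r ·ᵛ x , y ⟩ ≈ r * ⟨ x , y ⟩
  ⟨·,⟩ r x y = trans (sum-cong-≋ λ i → *-assoc r (x i) (y i)) (sym (*-distribˡ-sum r (λ i → x i * y i)))

  ⟨,·⟩ : ∀ {n} r (x y : Vec n) → ⟨ x , r ·ᵛ y ⟩ ≈ r * ⟨ x , y ⟩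
  ⟨,·⟩ r x y = trans (⟨⟩-comm x (r ·ᵛ y)) (trans (⟨·,⟩ r y x) (*-congˡ (⟨⟩-comm y x)))

  *ᵛ-cong : ∀ {n} (A : Matrix n) {x y} → x ≋ y → A *ᵛ x ≋ A *ᵛ y
  *ᵛ-cong A x≋y i = sum-cong-≋ λ j → *-congˡ (x≋y j)

  *ᵛ-congˡ : ∀ {n} {A B : Matrix n} x → (∀ i j → A i j ≈ B i j) → A *ᵛ x ≋ B *ᵛ x
  *ᵛ-congˡ x A≈B i = sum-cong-≋ λ j → *-congʳ (A≈B i j)

  *ᵛ-+[] : ∀ {n} (A : Matrix n) x s y → A *ᵛ (x +[ s ] y) ≋ A *ᵛ x +[ s ] A *ᵛ y
  *ᵛ-+[] A x s y i = ⟨,+[]⟩ (A i) x s y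

  *ᵛ-· : ∀ {n} (A : Matrix n) r x → A *ᵛ (r ·ᵛ x) ≋ r ·ᵛ (A *ᵛ x)
  *ᵛ-· A r x i = ⟨,·⟩ r (A i) x

  *ᵛ-e : ∀ {n} (A : Matrix n) a i → (A *ᵛ e a) i ≈ A i a
  *ᵛ-e A a i = ⟨,e⟩ (A i) a

  1ᴹ-*ᵛ : ∀ {n} (x : Vec n) → 1ᴹ *ᵛ x ≋ x
  1ᴹ-*ᵛ x i = trans (⟨⟩-comm (e i) x) (⟨,e⟩ x i)

  *ᴹ-*ᵛ : ∀ {n} (A B : Matrix n) x → (A *ᴹ B) *ᵛ x ≋ A *ᵛ (B *ᵛ x)
  *ᴹ-*ᵛ {n} A B x i = begin
    sum (λ j → sum (λ k → A i k * B k j) * x j)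
      ≈⟨ sum-cong-≋ (λ j → *-distribʳ-sum (x j) (λ k → A i k * B k j)) ⟩
    sum (λ j → sum (λ k → A i k * B k j * x j))     ≈⟨ ∑-comm {n} {n} (λ j k → A i k * B k j * x j) ⟩
    sum (λ k → sum (λ j → A i k * B k j * x j))
      ≈⟨ sum-cong-≋ (λ k → sum-cong-≋ {n} (λ j → *-assoc (A i k) (B k j) (x j))) ⟩
    sum (λ k → sum (λ j → A i k * (B k j * x j)))
      ≈⟨ sum-cong-≋ (λ k → *-distribˡ-sum (A i k) (λ j → B k j * x j)) ⟨
    sum (λ k → A i k * sum (λ j → B k j * x j))     ∎
    where open SetoidReasoning setoid

  ^ᴹ-eigenvector : ∀ {n} {A : Matrix n} {r x} → A *ᵛ x ≋ r ·ᵛ x → ∀ k → (A ^ᴹ k) *ᵛ x ≋ (r ^ k) ·ᵛ x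
  ^ᴹ-eigenvector {x = x} Ax zero i = trans (1ᴹ-*ᵛ x i) (sym (*-identityˡ (x i)))
  ^ᴹ-eigenvector {A = A} {r} {x} Ax (suc k) i = begin
    ((A *ᴹ A ^ᴹ k) *ᵛ x) i      ≈⟨ *ᴹ-*ᵛ A (A ^ᴹ k) x i ⟩
    (A *ᵛ ((A ^ᴹ k) *ᵛ x)) i    ≈⟨ *ᵛ-cong A (^ᴹ-eigenvector {A = A} {r} {x} Ax k) i ⟩
    (A *ᵛ ((r ^ k) ·ᵛ x)) i     ≈⟨ *ᵛ-· A (r ^ k) x i ⟩
    r ^ k * (A *ᵛ x) i          ≈⟨ *-congˡ (Ax i) ⟩
    r ^ k * (r * x i)           ≈⟨ solve 3 (λ p r x → p :* (r :* x) := (r :* p) :* x) refl (r ^ k) r (x i) ⟩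
    r ^ suc k * x i             ∎
    where open SetoidReasoning setoid

  *ᵛ-sum : ∀ {n r} (A : Matrix n) (x : Fin r → Vec n) → A *ᵛ (λ l → sum λ i → x i l) ≋ λ l → sum λ i → (A *ᵛ x i) l
  *ᵛ-sum {n} {r} A x l = trans (sum-cong-≋ λ j → *-distribˡ-sum (A l j) (λ i → x i j)) (∑-comm {n} {r} λ j i → A l
      j * x i j)

  ⟨sum,⟩ : ∀ {n r} (x : Fin r → Vec n) y → ⟨ (λ l → sum λ i → x i l) , y ⟩ ≈ sum λ i → ⟨ x i , y ⟩
  ⟨sum,⟩ {n} {r} x y = trans (sum-cong-≋ λ l → *-distribʳ-sum (y l) (λ i → x i l)) (∑-comm {n} {r} λ l i → x i l * y l)

  self-adjoint : ∀ {n} {A : Matrix n} → Symmetric A → ∀ x y → ⟨ A *ᵛ x , y ⟩ ≈ ⟨ x , A *ᵛ y ⟩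
  self-adjoint {n} {A} A-sym x y = begin
    sum (λ i → sum (λ j → A i j * x j) * y i)   ≈⟨ sum-cong-≋ (λ i → *-distribʳ-sum (y i) (λ j → A i j * x j)) ⟩
    sum (λ i → sum (λ j → A i j * x j * y i))   ≈⟨ ∑-comm {n} {n} (λ i j → A i j * x j * y i) ⟩
    sum (λ j → sum (λ i → A i j * x j * y i))   ≈⟨ sum-cong-≋ (λ j → sum-cong-≋ {n} (λ i →
                                                     trans (*-congʳ (trans (*-congʳ (A-sym i j)) (*-comm _ _)))
                                                         (*-assoc _ _ _))) ⟩
    sum (λ j → sum (λ i → x j * (A j i * y i))) ≈⟨ sum-cong-≋ (λ j → *-distribˡ-sum (x j) (λ i → A j i * y i)) ⟨
    sum (λ j → x j * sum (λ i → A j i * y i))   ∎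
    where open SetoidReasoning setoid

-- Linear dependence and quadratic forms over the reals

module LinearAlgebra (em : ExcludedMiddle 0ℓ) (ℝ : Reals) where
  open Reals ℝ hiding (zero)
  open Theory ℝ using (module Mᴿ)
  open Mᴿ
  open RealProperties em ℝ
  open MatrixProperties commutativeRing

  ≉0⇒entry : ∀ {n} {x : Vec n} → ¬ (x ≋ 0ᵛ) → ∃[ i ] ¬ (x i ≈ 0#)
  ≉0⇒entry x≉0 = decidable-stable em λ no-entry → x≉0 λ i → decidable-stable em λ xi≉0 → no-entry (i , xi≉0)

  sum-nonneg : ∀ {n} {x : Vec n} → (∀ i → 0# ≤ x i) → 0# ≤ sum x
  sum-nonneg {zero}  0≤x = ≤-refl
  sum-nonneg {suc n} 0≤x = +-nonneg (0≤x zero) (sum-nonneg (0≤x ∘ suc))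

  entry≤sum : ∀ {n} {x : Vec n} → (∀ i → 0# ≤ x i) → ∀ i → x i ≤ sum x
  entry≤sum 0≤x zero    = ≤-respˡ-≈ (+-identityʳ _) (+-monoʳ-≤ _ (sum-nonneg (0≤x ∘ suc)))
  entry≤sum 0≤x (suc i) = ≤-respˡ-≈ (+-identityˡ _) (+-mono-≤ (0≤x zero) (entry≤sum (0≤x ∘ suc) i))

  sum≈0⇒≋0 : ∀ {n} {x : Vec n} → (∀ i → 0# ≤ x i) → sum x ≈ 0# → x ≋ 0ᵛ
  sum≈0⇒≋0 0≤x sum≈0 i = antisym (≤-respʳ-≈ sum≈0 (entry≤sum 0≤x i)) (0≤x i)

  ⟨x,x⟩-nonneg : ∀ {n} (x : Vec n) → 0# ≤ ⟨ x , x ⟩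
  ⟨x,x⟩-nonneg x = sum-nonneg λ i → square-nonneg (x i)

  square≈0 : ∀ {x} → x * x ≈ 0# → x ≈ 0#
  square≈0 xx≈0 = decidable-stable em λ x≉0 → x≉0 (*-cancelˡ-≈0 x≉0 xx≈0)

  ⟨x,x⟩≈0⇒≋0 : ∀ {n} {x : Vec n} → ⟨ x , x ⟩ ≈ 0# → x ≋ 0ᵛ
  ⟨x,x⟩≈0⇒≋0 {x = x} xx≈0 i = square≈0 (sum≈0⇒≋0 (λ i → square-nonneg (x i)) xx≈0 i)

  ⟨x,x⟩-pos : ∀ {n} {x : Vec n} → ¬ (x ≋ 0ᵛ) → 0# < ⟨ x , x ⟩
  ⟨x,x⟩-pos {x = x} x≉0 = ⟨x,x⟩-nonneg x , λ 0≈xx → x≉0 (⟨x,x⟩≈0⇒≋0 (sym 0≈xx))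

  LinearlyDependent : ∀ {m n} → (Fin n → Vec m) → Set
  LinearlyDependent {m} {n} a = ∃[ x ] (¬ (_≋_ {n} x 0ᵛ) × ∀ i → sum (λ j → a j i * x j) ≈ 0#)

  -- A left inverse, given by its rows, of the matrix with columns `a`.
  HasDualFamily : ∀ {m n} → (Fin n → Vec m) → Set
  HasDualFamily {m} {n} a = Σ[ g ∈ (Fin n → Vec m) ] (∀ (j k : Fin n) → ⟨ g j , a k ⟩ ≈ e j k)

  -- Elimination one column at a time. Given a dual family for the later columns, the residual is
  -- the part of the first column that they do not account for. If it is 0, the first column is a
  -- combination of the others; otherwise a nonzero entry of it gives a functional separating the
  -- first column from them.
  dependent-or-dual : ∀ {m} n (a : Fin n → Vec m) → LinearlyDependent a ⊎ HasDualFamily a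
  dependent-or-dual zero a = inj₂ ((λ ()) , λ ())
  dependent-or-dual {m} (suc n) a with dependent-or-dual n (a ∘ suc)
  ... | inj₁ (x , x≉0 , ax≈0) = inj₁ (x⁺ , (λ x⁺≋0 → x≉0 (x⁺≋0 ∘ suc)) , λ i →
          trans (+-cong (zeroʳ _) (ax≈0 i)) (+-identityˡ _))
    where
    x⁺ : Vec (suc n)
    x⁺ zero    = 0#
    x⁺ (suc j) = x j
  ... | inj₂ (g , g-dual) with em {residual ≋ 0ᵛ}
    where
    residual : Vec m
    residual i = a zero i - sum (λ k → a (suc k) i * ⟨ g k , a zero ⟩)
  ...   | yes residual≋0 = inj₁ (x , (λ x≋0 → 1≉0 (x≋0 zero)) , λ i →
            trans (+-cong (*-identityʳ _) (trans (sum-cong-≋ λ k → solve 2 (λ a g → a :* (:- g) := (:- con (+ 1))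
                :* (a :* g)) refl (a (suc k) i) _)
                                          (sym (*-distribˡ-sum (- 1#) λ k → a (suc k) i * ⟨ g k , a zero ⟩))))
            (trans (solve 2 (λ x y → x :+ (:- con (+ 1)) :* y := x :- y) refl _ _) (residual≋0 i)))
    where
    x : Vec (suc n)
    x zero    = 1#
    x (suc k) = - ⟨ g k , a zero ⟩
  ...   | no  residual≉0 = inj₂ (g⁺ , g⁺-dual)
    where
    i = proj₁ (≉0⇒entry residual≉0)
    r = a zero i - sum (λ k → a (suc k) i * ⟨ g k , a zero ⟩)
    r≉0 : ¬ (r ≈ 0#)
    r≉0 = proj₂ (≉0⇒entry residual≉0)
    h : Vec m
    -- Pairing with `h` reads off entry `i` of the residual of a vector: 0 for the later columns,
    -- `r` for the first.
    h = e i +[ - 1# ] (λ l → sum λ k → a (suc k) i * g k l)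
    ⟨h,⟩ : ∀ y → ⟨ h , y ⟩ ≈ y i - sum (λ k → a (suc k) i * ⟨ g k , y ⟩)
    ⟨h,⟩ y = trans (⟨+[],⟩ (e i) (- 1#) _ y) (trans
      (+-cong (trans (⟨⟩-comm (e i) y) (⟨,e⟩ y i)) (*-congˡ (trans (⟨sum,⟩ (λ k → a (suc k) i ·ᵛ g k) y)
          (sum-cong-≋ λ k → ⟨·,⟩ (a (suc k) i) (g k) y))))
      (solve 2 (λ x y → x :+ (:- con (+ 1)) :* y := x :- y) refl _ _))
    g₀ : Vec m
    g₀ = r ⁻¹ ·ᵛ h
    ⟨g₀,a₀⟩ : ⟨ g₀ , a zero ⟩ ≈ 1#
    ⟨g₀,a₀⟩ = trans (⟨·,⟩ (r ⁻¹) h (a zero)) (trans (*-congˡ (⟨h,⟩ (a zero))) (⁻¹-inverseˡ r r≉0))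
    ⟨g₀,a⟩ : ∀ k → ⟨ g₀ , a (suc k) ⟩ ≈ 0#
    ⟨g₀,a⟩ k = trans (⟨·,⟩ (r ⁻¹) h (a (suc k))) (trans (*-congˡ (trans (⟨h,⟩ (a (suc k)))
      (trans (+-congˡ (-‿cong (trans (sum-cong-≋ λ l → *-congˡ (trans (g-dual l k) (e-sym l k)))
          (⟨,e⟩ (λ l → a (suc l) i) k))))
             (-‿inverseʳ _)))) (zeroʳ _))
    g⁺ : Fin (suc n) → Vec m
    g⁺ zero    = g₀
    -- The correction by `g₀` kills the pairing with the first column and leaves the other pairings
    -- unchanged.
    g⁺ (suc j) = g j +[ - ⟨ g j , a zero ⟩ ] g₀
    g⁺-dual : ∀ j k → ⟨ g⁺ j , a k ⟩ ≈ e j k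
    g⁺-dual zero    zero    = ⟨g₀,a₀⟩
    g⁺-dual zero    (suc k) = ⟨g₀,a⟩ k
    g⁺-dual (suc j) zero    = trans (⟨+[],⟩ (g j) _ g₀ (a zero)) (trans (+-congˡ (*-congˡ ⟨g₀,a₀⟩))
      (solve 1 (λ x → x :+ (:- x) :* con (+ 1) := con (+ 0)) refl _))
    g⁺-dual (suc j) (suc k) = trans (⟨+[],⟩ (g j) _ g₀ (a (suc k))) (trans (+-cong (g-dual j k)
        (trans (*-congˡ (⟨g₀,a⟩ k)) (zeroʳ _))) (+-identityʳ _))

  ∣sum∣≤ : ∀ {n} {x h : Vec n} → (∀ i → ∣ x i ∣≤ h i) → ∣ sum x ∣≤ sum h
  ∣sum∣≤ {zero}  x≤h = nonneg⇒∣∣≤ ≤-refl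
  ∣sum∣≤ {suc n} x≤h = ∣∣≤-+ (x≤h zero) (∣sum∣≤ (x≤h ∘ suc))

  -- This is ±2ab ≤ a² + b² ≤ 2N with N = `⟨ x , x ⟩`; bounding each square by N separately includes
  -- the case i = j.
  product≤norm² : ∀ {n} (x : Vec n) i j → ∣ x i * x j ∣≤ ⟨ x , x ⟩
  product≤norm² x i j =
    ≤-from-difference (*-nonneg (proj₁ 0<½) (+-nonneg (square-nonneg (x i + x j)) gap))
      (double (solve 3 (λ a b N → (a :+ b) :* (a :+ b) :+ ((N :- a :* a) :+ (N :- b :* b)) := (a :* b :- (:- N))
          :+ (a :* b :- (:- N))) refl (x i) (x j) N)) ,
    ≤-from-difference (*-nonneg (proj₁ 0<½) (+-nonneg (square-nonneg (x i - x j)) gap))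
      (double (solve 3 (λ a b N → (a :- b) :* (a :- b) :+ ((N :- a :* a) :+ (N :- b :* b)) := (N :- a :* b) :+
          (N :- a :* b)) refl (x i) (x j) N))
    where
    N = ⟨ x , x ⟩
    gap : 0# ≤ (N - x i * x i) + (N - x j * x j)
    gap = +-nonneg (difference-nonneg (entry≤sum (λ i → square-nonneg (x i)) i)) (difference-nonneg
        (entry≤sum (λ i → square-nonneg (x i)) j))
    double : ∀ {z w} → z ≈ w + w → ½ * z ≈ w
    double {z} {w} z≈w+w = trans (*-congˡ z≈w+w) (trans (distribˡ ½ w w) (halves w))

  abstract
    -- Products of two entries of `x` are at most `⟨ x , x ⟩` in size, so the sum of bounds for the
    -- entries of `A` works; adding 1 makes the constant positive, hence invertible.
    form-bounded : ∀ {n} (A : Matrix n) → ∃[ K ] (0# < K × ∀ x → ⟨ A *ᵛ x , x ⟩ ≤ K * ⟨ x , x ⟩)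
    form-bounded {n} A = 1# + K , +-pos 0<1 0≤K , λ x →
      ≤-trans (proj₂ (∣∣≤-resp (sum-cong-≋ λ i → sym (*-distribʳ-sum (x i) (λ j → A i j * x j)))
        (∣sum∣≤ λ i → ∣sum∣≤ λ j → ∣∣≤-resp (solve 3 (λ a x y → a :* (x :* y) := a :* x :* y) refl (A i j) (x j) (x i))
          (∣∣≤-* (proj₂ (magnitude (A i j))) (product≤norm² x j i)))))
      (≤-respˡ-≈ (trans (*-distribʳ-sum ⟨ x , x ⟩ (λ i → sum (h i))) (sum-cong-≋ λ i → *-distribʳ-sum ⟨ x , x ⟩ (h i)))
        (≤-resp (*-comm _ _) (*-comm _ _) (*-monoˡ-≤ (⟨x,x⟩-nonneg x) (≤-respˡ-≈ (+-identityˡ K)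
            (+-mono-≤ 0≤1 ≤-refl)))))
      where
      h : Fin n → Fin n → Carrier
      h i j = proj₁ (magnitude (A i j))
      K : Carrier
      K = sum λ i → sum (h i)
      0≤K : 0# ≤ K
      0≤K = sum-nonneg λ i → sum-nonneg λ j → ∣∣≤⇒0≤ (proj₂ (magnitude (A i j)))

  PositiveSemidefinite : ∀ {n} → Matrix n → Set
  PositiveSemidefinite A = ∀ x → 0# ≤ ⟨ A *ᵛ x , x ⟩

  -- If A is invertible, y = A⁻¹ x and K bounds the form of A⁻¹, then expanding
  -- 0 ≤ ⟨A (x - y / K), x - y / K⟩ bounds the form of A below by 1 / K.
  singular-or-coercive : ∀ {n} {A : Matrix n} → Symmetric A → PositiveSemidefinite A →
    (∃[ x ] (¬ (x ≋ 0ᵛ) × A *ᵛ x ≋ 0ᵛ)) ⊎ (∃[ δ ] (0# < δ × ∀ x → δ * ⟨ x , x ⟩ ≤ ⟨ A *ᵛ x , x ⟩))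
  singular-or-coercive {n} {A} A-sym A≥0 with dependent-or-dual n (λ j i → A i j)
  ... | inj₁ singular = inj₁ singular
  ... | inj₂ (g , g-dual) = inj₂ (s , ⁻¹-pos 0<K , coercive)
    where
    G : Matrix n
    G i j = g j i
    K = proj₁ (form-bounded G)
    0<K = proj₁ (proj₂ (form-bounded G))
    s = K ⁻¹
    -- The rows `g` form a left inverse of `A`; as `A` is symmetric, the transpose `G` is a right
    -- inverse.
    A-inverse : ∀ x → A *ᵛ (G *ᵛ x) ≋ x
    A-inverse x i = trans (sym (*ᴹ-*ᵛ A G x i)) (trans (*ᵛ-congˡ {A = A *ᴹ G} {B = 1ᴹ} x
      (λ i j → trans (⟨⟩-comm (A i) (g j)) (trans (⟨⟩-cong {x = g j} (λ _ → refl) (A-sym i)) (trans (g-dual j i)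
          (e-sym j i)))) i) (1ᴹ-*ᵛ x i))
    coercive : ∀ x → s * ⟨ x , x ⟩ ≤ ⟨ A *ᵛ x , x ⟩
    coercive x = ≤-from-difference
      (+-nonneg (A≥0 (x +[ - s ] y))
        (*-nonneg (square-nonneg s) (difference-nonneg (≤-respˡ-≈ (⟨⟩-comm y x) (proj₂ (proj₂ (form-bounded G)) x)))))
      (trans (+-congʳ expand)
        (trans (solve 5 (λ b s N c K → (b :+ (:- s) :* N) :+ (:- s) :* (N :+ (:- s) :* c) :+ s :* s :* (K :* N :- c)
                   := b :- s :* N :+ s :* N :* (s :* K :- con (+ 1))) refl ⟨ A *ᵛ x , x ⟩ s ⟨ x , x ⟩ ⟨ x , y ⟩ K)
          (trans (+-congˡ (trans (*-congˡ (trans (+-congʳ (⁻¹-inverseˡ K (pos⇒≉0 0<K))) (-‿inverseʳ 1#)))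
              (zeroʳ _))) (+-identityʳ _))))
      where
      y = G *ᵛ x
      Ay≋x = A-inverse x
      expand : ⟨ A *ᵛ (x +[ - s ] y) , x +[ - s ] y ⟩ ≈ (⟨ A *ᵛ x , x ⟩ + - s * ⟨ x , x ⟩) + - s *
          (⟨ x , x ⟩ + - s * ⟨ x , y ⟩)
      expand = begin
        ⟨ A *ᵛ (x +[ - s ] y) , x +[ - s ] y ⟩
          ≈⟨ ⟨⟩-cong {y = x +[ - s ] y} (*ᵛ-+[] A x (- s) y) (λ _ → refl) ⟩
        ⟨ A *ᵛ x +[ - s ] A *ᵛ y , x +[ - s ] y ⟩
          ≈⟨ ⟨⟩-cong {y = x +[ - s ] y} (λ i → +-congˡ (*-congˡ (Ay≋x i))) (λ _ → refl) ⟩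
        ⟨ A *ᵛ x +[ - s ] x , x +[ - s ] y ⟩                ≈⟨ ⟨,+[]⟩ (A *ᵛ x +[ - s ] x) x (- s) y ⟩
        ⟨ A *ᵛ x +[ - s ] x , x ⟩ + - s * ⟨ A *ᵛ x +[ - s ] x , y ⟩
          ≈⟨ +-cong (⟨+[],⟩ (A *ᵛ x) (- s) x x) (*-congˡ (⟨+[],⟩ (A *ᵛ x) (- s) x y)) ⟩
        (⟨ A *ᵛ x , x ⟩ + - s * ⟨ x , x ⟩) + - s * (⟨ A *ᵛ x , y ⟩ + - s * ⟨ x , y ⟩)
          ≈⟨ +-congˡ (*-congˡ (+-congʳ (trans (self-adjoint A-sym x y) (⟨⟩-cong {x = x} (λ _ → refl) Ay≋x)))) ⟩
        (⟨ A *ᵛ x , x ⟩ + - s * ⟨ x , x ⟩) + - s * (⟨ x , x ⟩ + - s * ⟨ x , y ⟩) ∎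
        where open SetoidReasoning setoid

-- Spectral theorem

module SpectralTheorem (em : ExcludedMiddle 0ℓ) (ℝ : Reals) {n : ℕ}
                       (H : Matrices.Matrix (Reals.rawRing ℝ) n)
                       (H-sym : Matrices.Symmetric (Reals.rawRing ℝ) H) where
  open Reals ℝ hiding (zero)
  open Theory ℝ
  open Mᴿ
  open RealProperties em ℝ
  open MatrixProperties commutativeRing
  open LinearAlgebra em ℝ

  sum-single : ∀ {r} (x : Vec r) i → (∀ j → i ≢ j → x j ≈ 0#) → sum x ≈ x i
  sum-single x i x≈0 = trans (sum-cong-≋ x≈xe) (⟨,e⟩ x i)
    where
    x≈xe : ∀ j → x j ≈ x j * e i j
    x≈xe j with i Fin.≟ j
    ... | yes _   = sym (*-identityʳ (x j))
    ... | no  i≢j = trans (x≈0 j i≢j) (sym (zeroʳ (x j)))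

  eigenvectors-orthogonal : ∀ {λ₁ λ₂ x y} → ¬ (λ₁ ≈ λ₂) → Eigenspace H λ₁ x → Eigenspace H λ₂ y → ⟨ x , y ⟩ ≈ 0#
  eigenvectors-orthogonal {λ₁} {λ₂} {x} {y} λ₁≉λ₂ Hx Hy = *-cancelˡ-≈0 (λ₁≉λ₂ ∘ x-y≈0⇒x≈y) (begin
    (λ₁ - λ₂) * ⟨ x , y ⟩           ≈⟨ solve 3 (λ a b c → (a :- b) :* c := a :* c :- b :* c) refl λ₁ λ₂ ⟨ x , y ⟩ ⟩
    λ₁ * ⟨ x , y ⟩ - λ₂ * ⟨ x , y ⟩ ≈⟨ +-cong (sym (trans (⟨⟩-cong {y = y} Hx (λ _ → refl)) (⟨·,⟩ λ₁ x y)))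
                                              (-‿cong (sym (trans (⟨⟩-cong {x = x} (λ _ → refl) Hy) (⟨,·⟩ λ₂ x y)))) ⟩
    ⟨ H *ᵛ x , y ⟩ - ⟨ x , H *ᵛ y ⟩ ≈⟨ +-congʳ (self-adjoint H-sym x y) ⟩
    ⟨ x , H *ᵛ y ⟩ - ⟨ x , H *ᵛ y ⟩ ≈⟨ -‿inverseʳ _ ⟩
    0#                              ∎)
    where open SetoidReasoning setoid

  -- The record asks for what deflation delivers directly. For `P = 1ᴹ`, orthogonality of the
  -- eigenspaces then forces the components to be the eigenprojections.
  record Resolution (P : Matrix n) : Set where
    field
      size       : ℕ
      eigenvalue : Fin size → Carrier
      component  : Fin size → Matrix n
      distinct   : ∀ {i j} → i ≢ j → ¬ (eigenvalue i ≈ eigenvalue j)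
      range      : ∀ i x → Eigenspace H (eigenvalue i) (component i *ᵛ x)
      component-sum      : ∀ l m → sum (λ i → component i l m) ≈ P l m

  empty-resolution : ∀ {P} → (∀ l m → P l m ≈ 0#) → Resolution P
  empty-resolution P≈0 = record
    { size       = 0
    ; eigenvalue = λ ()
    ; component  = λ ()
    ; distinct   = λ { {()} }
    ; range      = λ ()
    ; component-sum      = λ l m → sym (P≈0 l m)
    }

  -- Deflation may meet an eigenvalue again. To keep the list distinct, `Q` is then added to the
  -- component already listed for `μ`.
  extend-resolution : ∀ {P P′ Q} μ → (∀ x → Eigenspace H μ (Q *ᵛ x)) → (∀ l m → Q l m + P l m ≈ P′ l m) →
                      Resolution P → Resolution P′
  extend-resolution {P} {P′} {Q} μ HQ Q+P≈P′ res with em {∃[ i ] Resolution.eigenvalue res i ≈ μ}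
  ... | no new = record
    { size       = suc size
    ; eigenvalue = eigenvalue⁺
    ; component  = component⁺
    ; distinct   = distinct⁺
    ; range      = range⁺
    ; component-sum      = λ l m → trans (+-congˡ (component-sum l m)) (Q+P≈P′ l m)
    }
    where
    open Resolution res
    eigenvalue⁺ : Fin (suc size) → Carrier
    eigenvalue⁺ zero    = μ
    eigenvalue⁺ (suc i) = eigenvalue i
    component⁺ : Fin (suc size) → Matrix n
    component⁺ zero    = Q
    component⁺ (suc i) = component i
    distinct⁺ : ∀ {i j} → i ≢ j → ¬ (eigenvalue⁺ i ≈ eigenvalue⁺ j)
    distinct⁺ {zero}  {zero}  0≢0 _ = 0≢0 ≡.refl
    distinct⁺ {zero}  {suc j} _ μ≈  = new (j , sym μ≈)
    distinct⁺ {suc i} {zero}  _ ≈μ  = new (i , ≈μ)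
    distinct⁺ {suc i} {suc j} i≢j   = distinct (i≢j ∘ ≡.cong suc)
    range⁺ : ∀ i x → Eigenspace H (eigenvalue⁺ i) (component⁺ i *ᵛ x)
    range⁺ zero    = HQ
    range⁺ (suc i) = range i
  ... | yes (i , λᵢ≈μ) = record
    { size       = size
    ; eigenvalue = eigenvalue
    ; component  = component⁺
    ; distinct   = distinct
    ; range      = range⁺
    ; component-sum      = λ l m → trans (sum-+[] (λ j → component j l m) (Q l m) (e i)) (trans
        (+-cong (component-sum l m) (*-congˡ (trans (sum-single (e i) i (λ j → e-off-diagonal)) (e-diagonal i))))
        (trans (trans (+-comm _ _) (+-congʳ (*-identityʳ _))) (Q+P≈P′ l m)))
    }
    where
    open Resolution res
    component⁺ : Fin size → Matrix n
    component⁺ j l m = component j l m + Q l m * e i j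
    action : ∀ j x → component⁺ j *ᵛ x ≋ component j *ᵛ x +[ e i j ] Q *ᵛ x
    action j x l = trans
      (sum-cong-≋ λ m → solve 4 (λ c q d x → (c :+ q :* d) :* x := c :* x :+ d :* (q :* x)) refl (component j l m)
          (Q l m) (e i j) (x m))
      (sum-+[] (λ m → component j l m * x m) (e i j) (λ m → Q l m * x m))
    eigenvalue-match : ∀ j → e i j * μ ≈ e i j * eigenvalue j
    eigenvalue-match j with i Fin.≟ j
    ... | yes ≡.refl = *-congˡ (sym λᵢ≈μ)
    ... | no  _      = trans (zeroˡ _) (sym (zeroˡ _))
    range⁺ : ∀ j x → Eigenspace H (eigenvalue j) (component⁺ j *ᵛ x)
    range⁺ j x l = begin
      (H *ᵛ (component⁺ j *ᵛ x)) l
        ≈⟨ *ᵛ-cong H (action j x) l ⟩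
      (H *ᵛ (component j *ᵛ x +[ e i j ] Q *ᵛ x)) l
        ≈⟨ *ᵛ-+[] H (component j *ᵛ x) (e i j) (Q *ᵛ x) l ⟩
      (H *ᵛ (component j *ᵛ x)) l + e i j * (H *ᵛ (Q *ᵛ x)) l
        ≈⟨ +-cong (range j x l) (trans (*-congˡ (HQ x l)) (trans (sym (*-assoc _ _ _))
            (*-congʳ (eigenvalue-match j)))) ⟩
      eigenvalue j * (component j *ᵛ x) l + e i j * eigenvalue j * (Q *ᵛ x) l
        ≈⟨ solve 4 (λ a c d q → a :* c :+ d :* a :* q := a :* (c :+ d :* q)) refl (eigenvalue j)
            ((component j *ᵛ x) l) (e i j) ((Q *ᵛ x) l) ⟩
      eigenvalue j * ((component j *ᵛ x) l + e i j * (Q *ᵛ x) l)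
        ≈⟨ *-congˡ (action j x l) ⟨
      eigenvalue j * (component⁺ j *ᵛ x) l ∎
      where open SetoidReasoning setoid

  record IsInvariantProjector (P : Matrix n) : Set where
    field
      symmetric  : Symmetric P
      idempotent : ∀ x → P *ᵛ (P *ᵛ x) ≋ P *ᵛ x
      commutes   : ∀ x → H *ᵛ (P *ᵛ x) ≋ P *ᵛ (H *ᵛ x)

  module Extremal {P : Matrix n} (isProjector : IsInvariantProjector P)
                  (z : Vec n) (Pz≉0 : ¬ (P *ᵛ z ≋ 0ᵛ)) where
    open IsInvariantProjector isProjector

    -- Denominator and numerator of the Rayleigh quotient of `H` at `P *ᵛ x`, as the next two lemmas
    -- show.
    α β : Vec n → Carrier
    α x = ⟨ P *ᵛ x , x ⟩
    β x = ⟨ H *ᵛ (P *ᵛ x) , x ⟩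

    ⟨Px,Px⟩≈α : ∀ x → ⟨ P *ᵛ x , P *ᵛ x ⟩ ≈ α x
    ⟨Px,Px⟩≈α x = trans (sym (self-adjoint symmetric (P *ᵛ x) x)) (⟨⟩-cong {y = x} (idempotent x) (λ _ → refl))

    ⟨HPx,Px⟩≈β : ∀ x → ⟨ H *ᵛ (P *ᵛ x) , P *ᵛ x ⟩ ≈ β x
    ⟨HPx,Px⟩≈β x = trans (sym (self-adjoint symmetric (H *ᵛ (P *ᵛ x)) x))
      (⟨⟩-cong {y = x} (λ i → trans (sym (commutes (P *ᵛ x) i)) (*ᵛ-cong H (idempotent x) i)) (λ _ → refl))

    α-nonneg : ∀ x → 0# ≤ α x
    α-nonneg x = ≤-respʳ-≈ (⟨Px,Px⟩≈α x) (⟨x,x⟩-nonneg (P *ᵛ x))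

    -- Written without division, so that vectors killed by `P` impose no condition.
    LowerBound : Carrier → Set
    LowerBound s = ∀ x → s * α x ≤ β x

    lowerBound-exists : ∃ LowerBound
    lowerBound-exists = - K , λ x → ≤-resp
      (trans (solve 2 (λ k a → :- (k :* a) := (:- k) :* a) refl K ⟨ P *ᵛ x , P *ᵛ x ⟩) (*-congˡ (⟨Px,Px⟩≈α x)))
      (trans (-‿cong (trans (⟨⟩-cong {y = P *ᵛ x} (negate (P *ᵛ x)) (λ _ → refl)) (⟨·,⟩ (- 1#) (H *ᵛ (P *ᵛ x))
          (P *ᵛ x))))
        (trans (solve 1 (λ b → :- ((:- con (+ 1))   :* b) := b) refl ⟨ H *ᵛ (P *ᵛ x) , P *ᵛ x ⟩) (⟨HPx,Px⟩≈β x)))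
      (neg-mono-≤ (proj₂ (proj₂ -H-bounded) (P *ᵛ x)))
      where
      -H : Matrix n
      -H i j = - 1# * H i j
      -H-bounded = form-bounded -H
      K = proj₁ -H-bounded
      negate : ∀ y → -H *ᵛ y ≋ - 1# ·ᵛ (H *ᵛ y)
      negate y i = trans (sum-cong-≋ λ j → *-assoc (- 1#) (H i j) (y j)) (sym (*-distribˡ-sum (- 1#)
          (λ j → H i j * y j)))

    lowerBound≤quotient : ∀ {x} → 0# < α x → ∀ s → LowerBound s → s ≤ (α x) ⁻¹ * β x
    lowerBound≤quotient {x} 0<α s s-lower = *-cancelˡ-≤ 0<α (≤-resp (*-comm _ _)
      (trans (sym (*-identityˡ _)) (trans (*-congʳ (sym (⁻¹-inverseʳ (α x) (pos⇒≉0 0<α)))) (*-assoc _ _ _)))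
          (s-lower x))

    0<αz : 0# < α z
    0<αz = <-respʳ-≈ (⟨Px,Px⟩≈α z) (⟨x,x⟩-pos {x = P *ᵛ z} Pz≉0)

    abstract
      least : ∃[ s ] (UpperBound LowerBound s × ∀ u → UpperBound LowerBound u → s ≤ u)
      least = supremum LowerBound lowerBound-exists ((α z) ⁻¹ * β z , lowerBound≤quotient {z} 0<αz)

    μ : Carrier
    μ = proj₁ least

    μ-lower : LowerBound μ
    μ-lower x with em {α x ≈ 0#}
    -- All multiples of `α x` are 0 here, so the inequality for any known lower bound is already the
    -- one for `μ`.
    ... | yes α≈0 = ≤-respˡ-≈ (scaled (proj₁ lowerBound-exists) μ) (proj₂ lowerBound-exists x)
      where
      scaled : ∀ s t → s * α x ≈ t * α x
      scaled s t = trans (trans (*-congˡ α≈0) (zeroʳ s)) (sym (trans (*-congˡ α≈0) (zeroʳ t)))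
    ... | no  α≉0 = ≤-resp (*-comm (α x) μ)
                      (trans (sym (*-assoc (α x) ((α x) ⁻¹) (β x))) (trans (*-congʳ (⁻¹-inverseʳ (α x) α≉0))
                          (*-identityˡ (β x))))
                      (*-monoˡ-≤ (α-nonneg x) (proj₂ (proj₂ least) ((α x) ⁻¹ * β x) (lowerBound≤quotient {x} 0<α)))
      where
      0<α : 0# < α x
      0<α = α-nonneg x , α≉0 ∘ sym

    -- H - μ on the range of P and the identity on its orthogonal complement.
    M : Matrix n
    M i j = (H *ᴹ P) i j + (- μ) * P i j + (1ᴹ i j - P i j)

    M-action : ∀ x → M *ᵛ x ≋ (H *ᵛ (P *ᵛ x) +[ - μ ] P *ᵛ x) +[ 1# ] (x +[ - 1# ] P *ᵛ x)
    M-action x i = begin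
      sum (λ j → M i j * x j)
        ≈⟨ sum-cong-≋ (λ j → solve 5 (λ h m p d x → (h :+ m :* p :+ (d :- p)) :* x
             := (h :* x :+ m :* (p :* x)) :+ con (+ 1) :* (d :* x :+ (:- con (+ 1)) :* (p :* x))) refl
                 ((H *ᴹ P) i j) (- μ) (P i j) (1ᴹ i j) (x j)) ⟩
      sum ((hx +[ - μ ] px) +[ 1# ] (dx +[ - 1# ] px))
        ≈⟨ trans (sum-+[] (hx +[ - μ ] px) 1# (dx +[ - 1# ] px)) (+-cong (sum-+[] hx (- μ) px)
            (*-congˡ (sum-+[] dx (- 1#) px))) ⟩
      (sum hx + - μ * sum px) + 1# * (sum dx + - 1# * sum px)
        ≈⟨ +-cong (+-congʳ (*ᴹ-*ᵛ H P x i)) (*-congˡ (+-congʳ (1ᴹ-*ᵛ x i))) ⟩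
      ((H *ᵛ (P *ᵛ x) +[ - μ ] P *ᵛ x) +[ 1# ] (x +[ - 1# ] P *ᵛ x)) i ∎
      where
      open SetoidReasoning setoid
      hx px dx : Vec n
      hx j = (H *ᴹ P) i j * x j
      px j = P i j * x j
      dx j = 1ᴹ i j * x j

    M-symmetric : Symmetric M
    M-symmetric i j = +-cong (+-cong HP-symmetric (*-congˡ (symmetric i j))) (+-cong (e-sym i j)
        (-‿cong (symmetric i j)))
      where
      HP-symmetric : (H *ᴹ P) i j ≈ (H *ᴹ P) j i
      HP-symmetric = begin
        (H *ᴹ P) i j                       ≈⟨ sum-cong-≋ (λ k → *-congˡ (*ᵛ-e P j k)) ⟨
        (H *ᵛ (P *ᵛ e j)) i                ≈⟨ commutes (e j) i ⟩
        (P *ᵛ (H *ᵛ e j)) i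
          ≈⟨ sum-cong-≋ (λ k → *-cong (symmetric i k) (trans (*ᵛ-e H j k) (H-sym k j))) ⟩
        sum (λ k → P k i * H j k)          ≈⟨ ⟨⟩-comm (λ k → P k i) (H j) ⟩
        (H *ᴹ P) j i                       ∎
        where open SetoidReasoning setoid

    M-form : ∀ x → ⟨ M *ᵛ x , x ⟩ ≈ (β x + - μ * α x) + 1# * (⟨ x , x ⟩ + - 1# * α x)
    M-form x = trans (⟨⟩-cong {y = x} (M-action x) (λ _ → refl)) (trans
      (⟨+[],⟩ (H *ᵛ (P *ᵛ x) +[ - μ ] P *ᵛ x) 1# (x +[ - 1# ] P *ᵛ x) x)
      (+-cong (⟨+[],⟩ (H *ᵛ (P *ᵛ x)) (- μ) (P *ᵛ x) x) (*-congˡ (⟨+[],⟩ x (- 1#) (P *ᵛ x) x))))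

    -- The expression is the squared norm of x - P x.
    complement-nonneg : ∀ x → 0# ≤ ⟨ x , x ⟩ + - 1# * α x
    complement-nonneg x = ≤-respʳ-≈ (begin
      ⟨ x +[ - 1# ] P *ᵛ x , x +[ - 1# ] P *ᵛ x ⟩
        ≈⟨ ⟨+[],⟩ x (- 1#) (P *ᵛ x) (x +[ - 1# ] P *ᵛ x) ⟩
      ⟨ x , x +[ - 1# ] P *ᵛ x ⟩ + - 1# * ⟨ P *ᵛ x , x +[ - 1# ] P *ᵛ x ⟩
        ≈⟨ +-cong (⟨,+[]⟩ x x (- 1#) (P *ᵛ x)) (*-congˡ (⟨,+[]⟩ (P *ᵛ x) x (- 1#) (P *ᵛ x))) ⟩
      (⟨ x , x ⟩ + - 1# * ⟨ x , P *ᵛ x ⟩) + - 1# * (α x + - 1# * ⟨ P *ᵛ x , P *ᵛ x ⟩)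
        ≈⟨ +-cong (+-congˡ (*-congˡ (⟨⟩-comm x (P *ᵛ x)))) (*-congˡ (+-congˡ (*-congˡ (⟨Px,Px⟩≈α x)))) ⟩
      (⟨ x , x ⟩ + - 1# * α x) + - 1# * (α x + - 1# * α x)
        ≈⟨ solve 2 (λ N a → (N :+ (:- con (+ 1)) :* a) :+ (:- con (+ 1)) :* (a :+ (:- con (+ 1)) :* a) := N :+
            (:- con (+ 1)) :* a) refl ⟨ x , x ⟩ (α x) ⟩
      ⟨ x , x ⟩ + - 1# * α x ∎)
      (⟨x,x⟩-nonneg (x +[ - 1# ] P *ᵛ x))
      where open SetoidReasoning setoid

    M-psd : PositiveSemidefinite M
    M-psd x = ≤-respʳ-≈ (sym (M-form x)) (+-nonneg
      (≤-respʳ-≈ (solve 3 (λ a b m → b :- m :* a := b :+ (:- m) :* a) refl (α x) (β x) μ) (difference-nonneg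
          (μ-lower x)))
      (*-nonneg 0≤1 (complement-nonneg x)))

    -- On `P *ᵛ x` the matrix `M` acts as H - μ, so coercivity would make `μ + δ` a lower bound,
    -- beyond the supremum of all of them.
    M-not-coercive : ∀ {δ} → 0# < δ → ¬ (∀ x → δ * ⟨ x , x ⟩ ≤ ⟨ M *ᵛ x , x ⟩)
    M-not-coercive {δ} 0<δ coercive = <⇒≱ 0<δ (≤-from-difference
      (difference-nonneg (proj₁ (proj₂ least) (μ + δ) raised))
      (solve 2 (λ m d → m :- (m :+ d) := con (+ 0) :- d) refl μ δ))
      where
      raised : LowerBound (μ + δ)
      raised x = ≤-from-difference (difference-nonneg (≤-resp (*-congˡ (⟨Px,Px⟩≈α x))
        (trans (M-form (P *ᵛ x)) (+-cong
          (+-cong (trans (⟨⟩-cong {y = P *ᵛ x} (*ᵛ-cong H (idempotent x)) (λ _ → refl)) (⟨HPx,Px⟩≈β x)) (*-congˡ αP))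
          (*-congˡ (+-cong (⟨Px,Px⟩≈α x) (*-congˡ αP))))) (coercive (P *ᵛ x))))
        (solve 4 (λ a b m d → ((b :+ (:- m) :* a) :+ con (+ 1) :* (a :+ (:- con (+ 1)) :* a)) :- d :* a := b :-
            (m :+ d) :* a) refl (α x) (β x) μ δ)
        where
        αP : α (P *ᵛ x) ≈ α x
        αP = trans (⟨⟩-cong {y = P *ᵛ x} (idempotent x) (λ _ → refl)) (⟨Px,Px⟩≈α x)

    -- Applying `P` to the kernel equation removes the complement term and leaves (H - μ) P v = 0.
    -- What then remains of the equation is v - P v = 0, so `v` itself is an eigenvector in the
    -- range of `P`.
    eigenvector-from-kernel : (∃[ v ] (¬ (v ≋ 0ᵛ) × M *ᵛ v ≋ 0ᵛ)) → ∃[ v ] (¬ (v ≋ 0ᵛ) × P *ᵛ v ≋ v × Eigenspace H μ v)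
    eigenvector-from-kernel (v , v≉0 , Mv≋0) = v , v≉0 , Pv≋v , Hv≋μv
      where
      open SetoidReasoning setoid
      Hv = H *ᵛ (P *ᵛ v)
      Pv = P *ᵛ v
      kernel : (Hv +[ - μ ] Pv) +[ 1# ] (v +[ - 1# ] Pv) ≋ 0ᵛ
      kernel i = trans (sym (M-action v i)) (Mv≋0 i)
      P-kernel : ∀ i → Hv i + - μ * Pv i ≈ 0#
      P-kernel i = begin
        Hv i + - μ * Pv i
          ≈⟨ solve 2 (λ h p → h := h :+ con (+ 1) :* (p :+ (:- con (+ 1)) :* p)) refl (Hv i + - μ * Pv i) (Pv i) ⟩
        (Hv i + - μ * Pv i) + 1# * (Pv i + - 1# * Pv i)
          ≈⟨ +-cong (+-cong (trans (sym (*ᵛ-cong H (idempotent v) i)) (commutes Pv i)) (*-congˡ (sym (idempotent v i))))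
                    (*-congˡ (+-congˡ (*-congˡ (sym (idempotent v i))))) ⟩
        ((P *ᵛ Hv) i + - μ * (P *ᵛ Pv) i) + 1# * ((P *ᵛ v) i + - 1# * (P *ᵛ Pv) i)
          ≈⟨ +-cong (*ᵛ-+[] P Hv (- μ) Pv i) (*-congˡ (*ᵛ-+[] P v (- 1#) Pv i)) ⟨
        (P *ᵛ (Hv +[ - μ ] Pv)) i + 1# * (P *ᵛ (v +[ - 1# ] Pv)) i
          ≈⟨ *ᵛ-+[] P (Hv +[ - μ ] Pv) 1# (v +[ - 1# ] Pv) i ⟨
        (P *ᵛ ((Hv +[ - μ ] Pv) +[ 1# ] (v +[ - 1# ] Pv))) i
          ≈⟨ sum-zero (λ j → P i j * ((Hv +[ - μ ] Pv) +[ 1# ] (v +[ - 1# ] Pv)) j) (λ j → trans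
              (*-congˡ (kernel j)) (zeroʳ _)) ⟩
        0# ∎
      Pv≋v : Pv ≋ v
      Pv≋v i = sym (x-y≈0⇒x≈y (trans (solve 2 (λ v p → v :- p := con (+ 0) :+ con (+ 1) :* (v :+ (:- con (+ 1)) :*
          p)) refl (v i) (Pv i))
        (trans (+-congʳ (sym (P-kernel i))) (kernel i))))
      Hv≋μv : Eigenspace H μ v
      Hv≋μv i = x-y≈0⇒x≈y (trans (+-cong (sym (*ᵛ-cong H Pv≋v i)) (-‿cong (*-congˡ (sym (Pv≋v i)))))
        (trans (solve 3 (λ h m p → h :- m :* p := h :+ (:- m) :* p) refl (Hv i) μ (Pv i)) (P-kernel i)))

    eigenvector : ∃[ v ] (¬ (v ≋ 0ᵛ) × P *ᵛ v ≋ v × Eigenspace H μ v)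
    eigenvector = [ eigenvector-from-kernel , (λ (δ , 0<δ , coercive) → contradiction coercive (M-not-coercive 0<δ)) ]′
      (singular-or-coercive M-symmetric M-psd)

  trace : Matrix n → Carrier
  trace A = sum λ i → A i i

  -- `Q` is the orthogonal projection onto the line of `v`. As `v` lies in the range of `P` and is
  -- an eigenvector, the difference `P′` is again an invariant projector, of trace one less.
  module Deflation {P : Matrix n} (isProjector : IsInvariantProjector P) {μ : Carrier} {v : Vec n}
                   (v≉0 : ¬ (v ≋ 0ᵛ)) (Pv≋v : P *ᵛ v ≋ v) (Hv : Eigenspace H μ v) where
    open IsInvariantProjector isProjector

    w : Carrier
    w = ⟨ v , v ⟩ ⁻¹

    w-inverse : w * ⟨ v , v ⟩ ≈ 1#
    w-inverse = ⁻¹-inverseˡ ⟨ v , v ⟩ (pos⇒≉0 (⟨x,x⟩-pos {x = v} v≉0))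

    Q P′ : Matrix n
    Q i j  = w * (v i * v j)
    P′ i j = P i j + - 1# * Q i j

    c : Vec n → Carrier
    c x = w * ⟨ v , x ⟩

    Q-action : ∀ x → Q *ᵛ x ≋ c x ·ᵛ v
    Q-action x i = trans
      (sum-cong-≋ λ j → solve 4 (λ w a b x → (w :* (a :* b)) :* x := (w :* a) :* (b :* x)) refl w (v i) (v j) (x j))
      (trans (sym (*-distribˡ-sum (w * v i) (λ j → v j * x j)))
        (solve 3 (λ w a s → (w :* a) :* s := (w :* s) :* a) refl w (v i) ⟨ v , x ⟩))

    P′-action : ∀ x → P′ *ᵛ x ≋ P *ᵛ x +[ - c x ] v
    P′-action x i = trans
      (sum-cong-≋ λ j → solve 3 (λ p q x → (p :+ (:- con (+ 1)) :* q) :* x := p :* x :+ (:- con (+ 1)) :*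
          (q :* x)) refl (P i j) (Q i j) (x j))
      (trans (sum-+[] (λ j → P i j * x j) (- 1#) (λ j → Q i j * x j))
        (+-congˡ (trans (*-congˡ (Q-action x i)) (solve 2 (λ c v → (:- con (+ 1)) :* (c :* v) := (:- c) :* v) refl
            (c x) (v i)))))

    Q-range : ∀ x → Eigenspace H μ (Q *ᵛ x)
    Q-range x i = trans (*ᵛ-cong H (Q-action x) i) (trans (*ᵛ-· H (c x) v i)
      (trans (*-congˡ (Hv i)) (trans (solve 3 (λ c m v → c :* (m :* v) := m :* (c :* v)) refl (c x) μ (v i))
          (*-congˡ (sym (Q-action x i))))))

    Q+P′≈P : ∀ l m → Q l m + P′ l m ≈ P l m
    Q+P′≈P l m = solve 2 (λ q p → q :+ (p :+ (:- con (+ 1)) :* q) := p) refl (Q l m) (P l m)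

    -- Orthogonality of `v` to the range of `P′`, from which idempotence follows.
    c-P′ : ∀ x → c (P′ *ᵛ x) ≈ 0#
    c-P′ x = begin
      w * ⟨ v , P′ *ᵛ x ⟩
        ≈⟨ *-congˡ (trans (⟨⟩-cong {x = v} (λ _ → refl) (P′-action x)) (⟨,+[]⟩ v (P *ᵛ x) (- c x) v)) ⟩
      w * (⟨ v , P *ᵛ x ⟩ + - c x * ⟨ v , v ⟩)
        ≈⟨ *-congˡ (+-congʳ (trans (sym (self-adjoint symmetric v x)) (⟨⟩-cong {y = x} Pv≋v (λ _ → refl)))) ⟩
      w * (⟨ v , x ⟩ + - c x * ⟨ v , v ⟩)
        ≈⟨ solve 3 (λ w a b → w :* (a :+ (:- (w :* a)) :* b) := w :* a :* (con (+ 1) :- w :* b)) refl w ⟨ v , x ⟩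
            ⟨ v , v ⟩ ⟩
      w * ⟨ v , x ⟩ * (1# - w * ⟨ v , v ⟩)
        ≈⟨ *-congˡ (trans (+-congˡ (-‿cong w-inverse)) (-‿inverseʳ 1#)) ⟩
      w * ⟨ v , x ⟩ * 0#                                 ≈⟨ zeroʳ _ ⟩
      0#                                                 ∎
      where open SetoidReasoning setoid

    P′-isProjector : IsInvariantProjector P′
    P′-isProjector = record
      { symmetric  = λ i j → +-cong (symmetric i j) (*-congˡ (*-congˡ (*-comm (v i) (v j))))
      ; idempotent = λ x i → begin
          (P′ *ᵛ (P′ *ᵛ x)) i                       ≈⟨ P′-action (P′ *ᵛ x) i ⟩
          (P *ᵛ (P′ *ᵛ x)) i + - c (P′ *ᵛ x) * v i
            ≈⟨ +-cong (trans (*ᵛ-cong P (P′-action x) i) (*ᵛ-+[] P (P *ᵛ x) (- c x) v i))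
                                                          (*-congʳ (-‿cong (c-P′ x))) ⟩
          ((P *ᵛ (P *ᵛ x)) i + - c x * (P *ᵛ v) i) + - 0# * v i
                                                    ≈⟨ +-congʳ (+-cong (idempotent x i) (*-congˡ (Pv≋v i))) ⟩
          ((P *ᵛ x) i + - c x * v i) + - 0# * v i
            ≈⟨ solve 2 (λ a v → a :+ (:- con (+ 0)) :* v := a) refl ((P *ᵛ x) i + - c x * v i) (v i) ⟩
          (P *ᵛ x) i + - c x * v i                  ≈⟨ P′-action x i ⟨
          (P′ *ᵛ x) i                               ∎
      ; commutes   = λ x i → begin
          (H *ᵛ (P′ *ᵛ x)) i
            ≈⟨ trans (*ᵛ-cong H (P′-action x) i) (*ᵛ-+[] H (P *ᵛ x) (- c x) v i) ⟩
          (H *ᵛ (P *ᵛ x)) i + - c x * (H *ᵛ v) i    ≈⟨ +-cong (commutes x i) (*-congˡ (Hv i)) ⟩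
          (P *ᵛ (H *ᵛ x)) i + - c x * (μ * v i)
            ≈⟨ +-congˡ (trans (solve 4 (λ w a m v → (:- (w :* a)) :* (m :* v) := (:- (w :* (m :* a))) :* v) refl w
                ⟨ v , x ⟩ μ (v i))
                                                         (*-congʳ (-‿cong (*-congˡ (trans (sym (⟨·,⟩ μ v x))
                                                             (trans (⟨⟩-cong {y = x} (sym ∘ Hv) (λ _ → refl))
                                                             (self-adjoint H-sym v x))))))) ⟩
          (P *ᵛ (H *ᵛ x)) i + - c (H *ᵛ x) * v i    ≈⟨ P′-action (H *ᵛ x) i ⟨
          (P′ *ᵛ (H *ᵛ x)) i                        ∎
      }
      where open SetoidReasoning setoid

    trace-P′ : 1# + trace P′ ≈ trace P
    trace-P′ = trans (+-congˡ (trans (sum-+[] (λ i → P i i) (- 1#) (λ i → Q i i))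
      (+-congˡ (*-congˡ (trans (sym (*-distribˡ-sum w (λ i → v i * v i))) w-inverse)))))
      (solve 1 (λ t → con (+ 1) :+ (t :+ (:- con (+ 1)) :* con (+ 1)) := t) refl (trace P))

  -- The trace of a projector is its rank, and each deflation lowers it by 1. At trace 0 the
  -- diagonal entries, squared norms of the columns, are nonnegative with sum 0, so `P` vanishes. At
  -- a positive trace some diagonal entry is nonzero, so the range contains an eigenvector.
  resolve : ∀ k {P} → IsInvariantProjector P → trace P ≈ fromℕ k → Resolution P
  resolve zero {P} isProjector trace≈0 = empty-resolution λ l m →
    trans (sym (*ᵛ-e P m l)) (⟨x,x⟩≈0⇒≋0 {x = P *ᵛ e m} (trans (sym (diagonal m)) (sum≈0⇒≋0 (λ i → ≤-respʳ-≈
        (sym (diagonal i)) (⟨x,x⟩-nonneg (P *ᵛ e i))) trace≈0 m)) l)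
    where
    open IsInvariantProjector isProjector
    diagonal : ∀ i → P i i ≈ ⟨ P *ᵛ e i , P *ᵛ e i ⟩
    diagonal i = sym (trans (sym (self-adjoint symmetric (P *ᵛ e i) (e i))) (trans (⟨,e⟩ (P *ᵛ (P *ᵛ e i)) i)
      (trans (idempotent (e i) i) (*ᵛ-e P i i))))
  resolve (suc k) {P} isProjector trace≈1+k =
    let v , v≉0 , Pv≋v , Hv = Extremal.eigenvector isProjector (proj₁ nonzero) (proj₂ nonzero)
        open Deflation isProjector v≉0 Pv≋v Hv
    in extend-resolution _ Q-range Q+P′≈P (resolve k P′-isProjector
         (trans (solve 1 (λ t → t := (con (+ 1) :+ t) :- con (+ 1)) refl (trace P′))
           (trans (+-congʳ (trans trace-P′ trace≈1+k)) (solve 1 (λ t → (con (+ 1) :+ t) :- con (+ 1) := t) refl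
               (fromℕ k)))))
    where
    nonzero : ∃[ z ] ¬ (P *ᵛ z ≋ 0ᵛ)
    nonzero = decidable-stable em λ all-zero → pos⇒≉0 (fromℕ-pos k) (trans (sym trace≈1+k)
      (sum-zero (λ i → P i i) λ i → trans (sym (*ᵛ-e P i i)) (decidable-stable em λ Pii≉0 → all-zero
          (e i , λ Pe≋0 → Pii≉0 (Pe≋0 i)))))

  abstract
    spectral-theorem : Resolution 1ᴹ
    spectral-theorem = resolve n
      (record
        { symmetric  = e-sym
        ; idempotent = λ x → 1ᴹ-*ᵛ (1ᴹ *ᵛ x)
        ; commutes   = λ x i → trans (*ᵛ-cong H (1ᴹ-*ᵛ x) i) (sym (1ᴹ-*ᵛ (H *ᵛ x) i))
        })
      (trans (sum-cong-≋ {n} e-diagonal) (sum-replicate n))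

  open Resolution spectral-theorem public

  decompose : ∀ x → (λ l → sum λ i → (component i *ᵛ x) l) ≋ x
  decompose x l = trans (refl) (trans (∑-comm {size} {n} λ i m → component i l m * x m)
    (trans (sum-cong-≋ {n} λ m → trans (sym (*-distribʳ-sum (x m) (λ i → component i l m)))
        (*-congʳ (component-sum l m))) (1ᴹ-*ᵛ x l)))

  -- An eigenvector for `eigenvalue i` is orthogonal to every other component of `x`, so its pairing
  -- with `x` is its pairing with component `i`.
  component-isEigenprojection : ∀ i → IsEigenprojection H (eigenvalue i) (component i)
  component-isEigenprojection i = record
    { range    = range i
    ; residual = λ x y Hy → begin
        ⟨ x -ᵛ (component i *ᵛ x) , y ⟩
          ≈⟨ sum-cong-≋ (λ l → solve 3 (λ x p y → (x :- p) :* y := (x :+ (:- con (+ 1)) :* p) :* y) refl (x l)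
              ((component i *ᵛ x) l) (y l)) ⟩
        ⟨ x +[ - 1# ] component i *ᵛ x , y ⟩
          ≈⟨ ⟨+[],⟩ x (- 1#) (component i *ᵛ x) y ⟩
        ⟨ x , y ⟩ + - 1# * ⟨ component i *ᵛ x , y ⟩
          ≈⟨ +-congʳ (trans (⟨⟩-cong {y = y} (λ l → sym (decompose x l)) (λ _ → refl))
              (trans (⟨sum,⟩ (λ j → component j *ᵛ x) y)
               (sum-single (λ j → ⟨ component j *ᵛ x , y ⟩) i λ j i≢j → eigenvectors-orthogonal
                   (λ λⱼ≈λᵢ → distinct i≢j (sym λⱼ≈λᵢ)) (range j x) Hy))) ⟩
        ⟨ component i *ᵛ x , y ⟩ + - 1# * ⟨ component i *ᵛ x , y ⟩
          ≈⟨ solve 1 (λ a → a :+ (:- con (+ 1)) :* a := con (+ 0)) refl ⟨ component i *ᵛ x , y ⟩ ⟩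
        0# ∎
    }
    where open SetoidReasoning setoid

  -- Pairing the vanishing sum with `y i` leaves only the squared norm of `y i`.
  eigenvectors-independent : (y : Fin size → Vec n) → (∀ i → Eigenspace H (eigenvalue i) (y i)) →
    (λ l → sum λ i → y i l) ≋ 0ᵛ → ∀ i → y i ≋ 0ᵛ
  eigenvectors-independent y Hy sum≋0 i = ⟨x,x⟩≈0⇒≋0 {x = y i} (trans
    (sym (sum-single (λ j → ⟨ y j , y i ⟩) i λ j i≢j → eigenvectors-orthogonal (λ λⱼ≈λᵢ → distinct i≢j
        (sym λⱼ≈λᵢ)) (Hy j) (Hy i)))
    (trans (sym (⟨sum,⟩ y (y i))) (⟨0,⟩ (y i) sum≋0)))

-- Divisibility of differences of powers

module IntegerPowers where
  open import Data.Integer.Base using (_+_; _*_; _-_; _^_; -_)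
  open ℤSolver.+-*-Solver

  Even Odd : ℤ → Set
  Even i = ∃[ w ] i ≡ + 2 * w
  Odd  i = ∃[ w ] i ≡ + 2 * w + + 1

  parity : ∀ i → Even i ⊎ Odd i
  parity i with i ℤ.%ℕ 2 | ℤ.n%ℕd<d i 2 | ℤ.a≡a%ℕn+[a/ℕn]*n i 2
  ... | 0 | _ | i≡ = inj₁ (i ℤ./ℕ 2 , ≡.trans i≡ (solve 1 (λ q → con (+ 0) :+ q :* con (+ 2) := con (+ 2) :* q)
          ≡.refl (i ℤ./ℕ 2)))
  ... | 1 | _ | i≡ = inj₂ (i ℤ./ℕ 2 , ≡.trans i≡ (solve 1 (λ q → con (+ 1) :+ q :* con (+ 2) := con (+ 2) :* q :+
          con (+ 1)) ≡.refl (i ℤ./ℕ 2)))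
  ... | suc (suc _) | ℕ.s≤s (ℕ.s≤s ()) | _

  odd-* : ∀ {i j} → Odd i → Odd j → Odd (i * j)
  odd-* (v , ≡.refl) (w , ≡.refl) = + 2 * v * w + v + w ,
    solve 2 (λ v w → (con (+ 2) :* v :+ con (+ 1)) :* (con (+ 2) :* w :+ con (+ 1))
                  := con (+ 2) :* (con (+ 2) :* v :* w :+ v :+ w) :+ con (+ 1)) ≡.refl v w

  even-*ˡ : ∀ {i} → Even i → ∀ j → Even (i * j)
  even-*ˡ (v , ≡.refl) j = v * j , ℤ.*-assoc (+ 2) v j

  even+even : ∀ {i j} → Even i → Even j → Even (i + j)
  even+even (v , ≡.refl) (w , ≡.refl) = v + w , ≡.sym (ℤ.*-distribˡ-+ (+ 2) v w)

  odd+odd : ∀ {i j} → Odd i → Odd j → Even (i + j)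
  odd+odd (v , ≡.refl) (w , ≡.refl) = v + w + + 1 ,
    solve 2 (λ v w → (con (+ 2) :* v :+ con (+ 1)) :+ (con (+ 2) :* w :+ con (+ 1)) := con (+ 2) :* (v :+ w :+ con
        (+ 1))) ≡.refl v w

  even+odd : ∀ {i j} → Even i → Odd j → Odd (i + j)
  even+odd (v , ≡.refl) (w , ≡.refl) = v + w ,
    solve 2 (λ v w → con (+ 2) :* v :+ (con (+ 2) :* w :+ con (+ 1)) := con (+ 2) :* (v :+ w) :+ con (+ 1)) ≡.refl v w

  odd-neg : ∀ {i} → Odd i → Odd (- i)
  odd-neg (v , ≡.refl) = - v - + 1 ,
    solve 1 (λ v → :- (con (+ 2) :* v :+ con (+ 1)) := con (+ 2) :* (:- v :- con (+ 1)) :+ con (+ 1)) ≡.refl v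

  even-neg : ∀ {i} → Even i → Even (- i)
  even-neg (v , ≡.refl) = - v , ℤ.neg-distribʳ-* (+ 2) v

  odd-^ : ∀ {i} → Odd i → ∀ k → Odd (i ^ k)
  odd-^ i-odd zero    = + 0 , ≡.refl
  odd-^ i-odd (suc k) = odd-* i-odd (odd-^ i-odd k)

  -- Every positive power of `i` has the parity of `i`; the successors exclude exponent 0.
  ^-parity : ∀ i k l → Even (i ^ suc k - i ^ suc l)
  ^-parity i k l with parity i
  ... | inj₁ i-even = even+even (even-*ˡ i-even (i ^ k)) (even-neg (even-*ˡ i-even (i ^ l)))
  ... | inj₂ i-odd  = odd+odd (odd-^ i-odd (suc k)) (odd-neg (odd-^ i-odd (suc l)))

  -- The sum of x^i y^(k-1-i) over i < k, the cofactor of x - y in x^k - y^k.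
  geometric : ℤ → ℤ → ℕ → ℤ
  geometric x y zero    = + 0
  geometric x y (suc k) = x * geometric x y k + y ^ k

  ^-difference : ∀ x y k → x ^ k - y ^ k ≡ geometric x y k * (x - y)
  ^-difference x y zero    = ≡.sym (ℤ.*-zeroˡ (x - y))
  ^-difference x y (suc k) = begin
    x * x ^ k - y * y ^ k
      ≡⟨ solve 4 (λ x y a b → x :* a :- y :* b := x :* (a :- b) :+ b :* (x :- y)) ≡.refl x y (x ^ k) (y ^ k) ⟩
    x * (x ^ k - y ^ k) + y ^ k * (x - y)           ≡⟨ ≡.cong (λ z → x * z + y ^ k * (x - y)) (^-difference x y k) ⟩
    x * (geometric x y k * (x - y)) + y ^ k * (x - y)
      ≡⟨ solve 4 (λ x g d b → x :* (g :* d) :+ b :* d := (x :* g :+ b) :* d) ≡.refl x (geometric x y k) (x - y)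
          (y ^ k) ⟩
    (x * geometric x y k + y ^ k) * (x - y)         ∎
    where open ≡.≡-Reasoning

  -- The number of summands is odd. If `x` is odd, all of them are odd; if `x` is even, only the
  -- pure power of `y` is.
  geometric-odd : ∀ x {y} → Odd y → ∀ l → Odd (geometric x y (suc (l ℕ.+ l)))
  geometric-odd x {y} y-odd zero    = + 0 , solve 1 (λ x → x :* con (+ 0) :+ con (+ 1) := con (+ 1)) ≡.refl x
  geometric-odd x {y} y-odd (suc l) rewrite ℕ.+-suc l l =
    even-or-odd (parity x)
    where
    k = suc (l ℕ.+ l)
    even-or-odd : Even x ⊎ Odd x → Odd (x * (x * geometric x y k + y ^ k) + y ^ suc k)
    even-or-odd (inj₁ x-even) = even+odd (even-*ˡ x-even (x * geometric x y k + y ^ k)) (odd-^ y-odd (suc k))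
    even-or-odd (inj₂ x-odd)  = ≡.subst Odd
      (solve 4 (λ x g a b → (x :* x :* g) :+ (x :* a) :+ b := x :* (x :* g :+ a) :+ b) ≡.refl x (geometric x y k)
          (y ^ k) (y ^ suc k))
      (even+odd (odd+odd (odd-* (odd-* x-odd x-odd) (geometric-odd x y-odd l)) (odd-* x-odd (odd-^ y-odd k)))
          (odd-^ y-odd (suc k)))

  -- Odd squares have this residue and powers preserve it. Unlike mere oddness, it ensures that the
  -- sum of two such numbers is divisible by 2 but not by 4.
  1mod4 : ℤ → Set
  1mod4 i = ∃[ w ] i ≡ + 4 * w + + 1

  1mod4⇒odd : ∀ {i} → 1mod4 i → Odd i
  1mod4⇒odd (w , ≡.refl) = + 2 * w , solve 1 (λ w → con (+ 4) :* w :+ con (+ 1) := con (+ 2) :* (con (+ 2) :* w)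
      :+ con (+ 1)) ≡.refl w

  1mod4-* : ∀ {i j} → 1mod4 i → 1mod4 j → 1mod4 (i * j)
  1mod4-* (v , ≡.refl) (w , ≡.refl) = + 4 * v * w + v + w ,
    solve 2 (λ v w → (con (+ 4) :* v :+ con (+ 1)) :* (con (+ 4) :* w :+ con (+ 1))
                  := con (+ 4) :* (con (+ 4) :* v :* w :+ v :+ w) :+ con (+ 1)) ≡.refl v w

  1mod4-^ : ∀ {i} → 1mod4 i → ∀ k → 1mod4 (i ^ k)
  1mod4-^ i≡1 zero    = + 0 , ≡.refl
  1mod4-^ i≡1 (suc k) = 1mod4-* i≡1 (1mod4-^ i≡1 k)

  -- Meant for x^j + y^j, the new factor when the exponent of x^j - y^j is doubled: it contributes
  -- exactly one 2.
  1mod4-+ : ∀ {i j} → 1mod4 i → 1mod4 j → ∃[ u ] (Odd u × i + j ≡ + 2 * u)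
  1mod4-+ (v , ≡.refl) (w , ≡.refl) = + 2 * (v + w) + + 1 , (v + w , ≡.refl) ,
    solve 2 (λ v w → (con (+ 4) :* v :+ con (+ 1)) :+ (con (+ 4) :* w :+ con (+ 1)) := con (+ 2) :* (con (+ 2) :*
        (v :+ w) :+ con (+ 1))) ≡.refl v w

  odd-square : ∀ {i} → Odd i → 1mod4 (i ^ 2)
  odd-square (v , ≡.refl) = v * v + v ,
    solve 1 (λ v → let i = con (+ 2) :* v :+ con (+ 1) in i :* (i :* con (+ 1)) := con (+ 4) :* (v :* v :+ v) :+ con (+ 1)) ≡.refl v

  half : ∀ n → (∃[ l ] n ≡ l ℕ.+ l) ⊎ (∃[ l ] n ≡ suc (l ℕ.+ l))
  half zero    = inj₁ (0 , ≡.refl)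
  half (suc n) with half n
  ... | inj₁ (l , ≡.refl) = inj₂ (l , ≡.refl)
  ... | inj₂ (l , ≡.refl) = inj₁ (suc l , ≡.cong suc (≡.sym (ℕ.+-suc l l)))

  binary-induction : (P : ℕ → Set) → (∀ l → P (suc (l ℕ.+ l))) → (∀ n → P n → P (n ℕ.+ n)) → ∀ n → 1 ℕ.≤ n → P n
  binary-induction P odd double = <-rec (λ n → 1 ℕ.≤ n → P n) step
    where
    step : ∀ n → (∀ {m} → m ℕ.< n → 1 ℕ.≤ m → P m) → 1 ℕ.≤ n → P n
    step n rec 1≤n with half n
    ... | inj₂ (l , ≡.refl) = odd l
    ... | inj₁ (suc l , ≡.refl) = double (suc l) (rec (ℕ.m<m+n (suc l) (ℕ.s≤s ℕ.z≤n)) (ℕ.s≤s ℕ.z≤n))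
    step n rec () | inj₁ (zero , ≡.refl)

  2^*odd : ∀ n → 1 ℕ.≤ n → ∃[ t ] ∃[ l ] n ≡ 2 ℕ.^ t ℕ.* suc (l ℕ.+ l)
  2^*odd = binary-induction _ (λ l → 0 , l , ≡.sym (ℕ.+-identityʳ _))
    (λ { n (t , l , ≡.refl) → suc t , l , S.solve 2 (λ a b → a S.:* b S.:+ a S.:* b S.:= (a S.:+ (a S.:+ S.con 0))
        S.:* b) ≡.refl (2 ℕ.^ t) (suc (l ℕ.+ l)) })
    where module S = ℕSolver.+-*-Solver

  -- The 2-adic "lifting the exponent" lemma: t is the 2-adic valuation of j.
  abstract
    ^-difference-1mod4 : ∀ j → 1 ℕ.≤ j → ∃[ t ] (∀ {x y} → 1mod4 x → 1mod4 y →
                         ∃[ u ] (Odd u × x ^ j - y ^ j ≡ + (2 ℕ.^ t) * u * (x - y)))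
    ^-difference-1mod4 = binary-induction _
      (λ l → 0 , λ {x} {y} x≡1 y≡1 → geometric x y (suc (l ℕ.+ l)) , geometric-odd x (1mod4⇒odd y≡1) l ,
        ≡.trans (^-difference x y (suc (l ℕ.+ l))) (≡.cong (_* (x - y)) (≡.sym (ℤ.*-identityˡ (geometric x y
            (suc (l ℕ.+ l)))))))
      (λ j (t , lift) → suc t , λ {x} {y} x≡1 y≡1 →
        let u , u-odd , diff = lift x≡1 y≡1
            v , v-odd , sum = 1mod4-+ (1mod4-^ x≡1 j) (1mod4-^ y≡1 j)
        in u * v , odd-* u-odd v-odd , (begin
          x ^ (j ℕ.+ j) - y ^ (j ℕ.+ j)
            ≡⟨ ≡.cong₂ _-_ (ℤ.^-distribˡ-+-* x j j) (ℤ.^-distribˡ-+-* y j j) ⟩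
          x ^ j * x ^ j - y ^ j * y ^ j
            ≡⟨ solve 2 (λ a b → a :* a :- b :* b := (a :- b) :* (a :+ b)) ≡.refl (x ^ j) (y ^ j) ⟩
          (x ^ j - y ^ j) * (x ^ j + y ^ j)               ≡⟨ ≡.cong₂ _*_ diff sum ⟩
          (+ (2 ℕ.^ t) * u * (x - y)) * (+ 2 * v)
            ≡⟨ solve 4 (λ p u d v → (p :* u :* d) :* (con (+ 2) :* v) := (con (+ 2) :* p) :* (u :* v) :* d) ≡.refl
                (+ (2 ℕ.^ t)) u (x - y) v ⟩
          + 2 * + (2 ℕ.^ t) * (u * v) * (x - y)
            ≡⟨ ≡.cong (λ p → p * (u * v) * (x - y)) (ℤ.pos-* 2 (2 ℕ.^ t)) ⟨
          + (2 ℕ.^ suc t) * (u * v) * (x - y)             ∎))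
      where open ≡.≡-Reasoning

-- Characters of (ℝ, +) and sign patterns

module Characters (em : ExcludedMiddle 0ℓ) (ℝ : Reals) where
  open Reals ℝ hiding (zero)
  open Theory ℝ
  open RealProperties em ℝ
  open ComplexNumbers em ℝ
  open IntegerPowers

  -- The argument is real, so exponents can be rescaled by reals and in particular divided by powers
  -- of 2.
  record Character : Set where
    field
      F      : Carrier → ℂ
      F-cong : ∀ {x y} → x ≈ y → F x ≈ᶜ F y
      F-+    : ∀ x y → F (x + y) ≈ᶜ F x ℂᴿ.* F y
      F-0    : F 0# ≈ᶜ ℂᴿ.1#

  module CharacterProperties (character : Character) where
    open Character character

    -- z = ±1 as a single equation; for z = F x it says that doubling the argument gives 1.
    IsSign : ℂ → Set
    IsSign z = z ℂᴿ.* z ≈ᶜ ℂᴿ.1#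

    isSign-resp : ∀ {z w} → z ≈ᶜ w → IsSign z → IsSign w
    isSign-resp z≈w zz≈1 = ℂᶜ.trans (ℂᶜ.sym (ℂᶜ.*-cong z≈w z≈w)) zz≈1

    F-1+1 : ∀ {x y} → F x ≈ᶜ ℂᴿ.1# → F y ≈ᶜ ℂᴿ.1# → F (x + y) ≈ᶜ ℂᴿ.1#
    F-1+1 Fx≈1 Fy≈1 = ℂᶜ.trans (F-+ _ _) (ℂᶜ.trans (ℂᶜ.*-cong Fx≈1 Fy≈1) (ℂᶜ.*-identityˡ _))

    F-1+ : ∀ {x} → F x ≈ᶜ ℂᴿ.1# → ∀ y → F (x + y) ≈ᶜ F y
    F-1+ Fx≈1 y = ℂᶜ.trans (F-+ _ _) (ℂᶜ.trans (ℂᶜ.*-congʳ Fx≈1) (ℂᶜ.*-identityˡ _))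

    F-neg-1 : ∀ {x} → F x ≈ᶜ ℂᴿ.1# → F (- x) ≈ᶜ ℂᴿ.1#
    F-neg-1 {x} Fx≈1 = ℂᶜ.trans (ℂᶜ.sym (F-1+ Fx≈1 (- x))) (ℂᶜ.trans (F-cong (-‿inverseʳ x)) F-0)

    F-*ℕ-1 : ∀ {x} → F x ≈ᶜ ℂᴿ.1# → ∀ n → F (x * fromℕ n) ≈ᶜ ℂᴿ.1#
    F-*ℕ-1 {x} Fx≈1 zero    = ℂᶜ.trans (F-cong (zeroʳ x)) F-0
    F-*ℕ-1 {x} Fx≈1 (suc n) = ℂᶜ.trans
      (F-cong (solve 2 (λ x n → x :* (con (+ 1) :+ n) := x :+ x :* n) refl x (fromℕ n)))
      (F-1+1 Fx≈1 (F-*ℕ-1 Fx≈1 n))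

    F-*ℤ-1 : ∀ {x} → F x ≈ᶜ ℂᴿ.1# → ∀ i → F (x * ι i) ≈ᶜ ℂᴿ.1#
    F-*ℤ-1 Fx≈1 (+ n)        = F-*ℕ-1 Fx≈1 n
    F-*ℤ-1 {x} Fx≈1 -[1+ n ] = ℂᶜ.trans
      (F-cong (solve 2 (λ x n → x :* (:- n) := :- (x :* n)) refl x (fromℕ (suc n))))
      (F-neg-1 (F-*ℕ-1 Fx≈1 (suc n)))

    ι-2 : ι (+ 2) ≈ 2#
    ι-2 = +-congˡ (+-identityʳ 1#)

    F-double : ∀ {x} → IsSign (F x) → F (x + x) ≈ᶜ ℂᴿ.1#
    F-double sign = ℂᶜ.trans (F-+ _ _) sign

    F-even : ∀ {x} → IsSign (F x) → ∀ {i} → Even i → F (x * ι i) ≈ᶜ ℂᴿ.1#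
    F-even {x} sign {i} (w , i≡2w) = ℂᶜ.trans
      (F-cong (trans (*-congˡ (trans (ι-cong i≡2w) (trans (ι-* (+ 2) w) (*-congʳ ι-2))))
        (solve 2 (λ x w → x :* ((con (+ 1) :+ con (+ 1)) :* w) := (x :+ x) :* w) refl x (ι w))))
      (F-*ℤ-1 (F-double sign) w)

    F-odd : ∀ {x} → IsSign (F x) → ∀ {i} → Odd i → F (x * ι i) ≈ᶜ F x
    F-odd {x} sign {i} (w , i≡2w+1) = ℂᶜ.trans
      (F-cong (trans (*-congˡ (trans (ι-cong i≡2w+1) (ι-+ (+ 2 ℤ.* w) (+ 1))))
        (solve 2 (λ x y → x :* (y :+ (con (+ 1) :+ con (+ 0))) := x :* y :+ x) refl x (ι (+ 2 ℤ.* w)))))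
      (F-1+ (F-even sign (w , ≡.refl)) x)

    -- `F x` has order dividing 2^s, and an odd power of it can be a sign only if `F x` is one.
    -- Doubling `x` lowers s, so by induction F (x + x) = F ((x + x) u) = 1; hence `F x` is a sign
    -- and `F-odd` applies.
    F-odd-cancel : ∀ s {x} → F (x * fromℕ (2 ℕ.^ s)) ≈ᶜ ℂᴿ.1# → ∀ {u} → Odd u → IsSign (F (x * ι u)) →
                   F x ≈ᶜ F (x * ι u)
    F-odd-cancel zero    {x} F≈1 {u} u-odd sign = ℂᶜ.trans Fx≈1 (ℂᶜ.sym (F-*ℤ-1 Fx≈1 u))
      where
      Fx≈1 = ℂᶜ.trans (F-cong (solve 1 (λ x → x := x :* (con (+ 1) :+ con (+ 0))) refl x)) F≈1
    F-odd-cancel (suc s) {x} F≈1 {u} u-odd sign = ℂᶜ.sym (F-odd Fx-sign u-odd)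
      where
      F2xu≈1 : F ((x + x) * ι u) ≈ᶜ ℂᴿ.1#
      F2xu≈1 = ℂᶜ.trans (F-cong (distribʳ (ι u) x x)) (F-double sign)
      F2x≈1 : F (x + x) ≈ᶜ ℂᴿ.1#
      F2x≈1 = ℂᶜ.trans
        (F-odd-cancel s (ℂᶜ.trans (F-cong (trans
            (trans (solve 2 (λ x p → (x :+ x) :* p := x :* ((con (+ 1) :+ con (+ 1)) :* p)) refl x
                (fromℕ (2 ℕ.^ s))) (*-congˡ (*-congʳ (sym ι-2))))
            (*-congˡ (sym (trans (ι-cong (ℤ.pos-* 2 (2 ℕ.^ s))) (ι-* (+ 2) (+ (2 ℕ.^ s)))))))) F≈1)
          u-odd (isSign-resp (ℂᶜ.sym F2xu≈1) (ℂᶜ.*-identityˡ _)))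
        F2xu≈1
      Fx-sign : IsSign (F x)
      Fx-sign = ℂᶜ.trans (ℂᶜ.sym (F-+ x x)) F2x≈1

    module Family {I : Set} (Active : I → Set) (m : I → ℤ) (i₀ : I) (m₀-odd : Odd (m i₀)) where

      -- Exponents relative to a reference index, so that the common phase cancels.
      d : ℕ → I → ℤ
      d k i = m i ℤ.^ k ℤ.- m i₀ ℤ.^ k

      -- What state transfer at exponent `k` says about φ = τ c^k. The last field provides a sign
      -- other than 1 and so makes `F φ` an element of finite order.
      record SignPattern (k : ℕ) (φ : Carrier) : Set where
        field
          positive    : 0# < φ
          sign        : ∀ i → Active i → IsSign (F (φ * ι (d k i)))
          nonconstant : ∃[ j ] (Active j × ¬ (F (φ * ι (d k j)) ≈ᶜ ℂᴿ.1#))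

      Realises : ℕ → ℕ → Carrier → Set
      Realises k k′ φ = ∃[ φ′ ] (0# < φ′ × ∀ i → Active i → F (φ′ * ι (d k′ i)) ≈ᶜ F (φ * ι (d k i)))

      fromℕ-odd : ∀ l → Odd (+ suc (l ℕ.+ l))
      fromℕ-odd l = + l , ≡.trans (≡.cong +_ (≡.trans (ℕ.+-comm 1 (l ℕ.+ l)) (≡.cong (λ z → l ℕ.+ z ℕ.+ 1)
          (≡.sym (ℕ.+-identityʳ l)))))
        (≡.cong (ℤ._+ + 1) (ℤ.pos-* 2 l))

      2^-pos : ∀ t → 0# < fromℕ (2 ℕ.^ t)
      2^-pos t = fromℕ-pos′ (ℕ.>-nonZero⁻¹ (2 ℕ.^ t) {{ℕ.m^n≢0 2 t}})

      -- Take j with a sign other than 1, so that `d k j` is nonzero, and write |d k j| = 2^t o with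
      -- o odd. Passing to φ o changes no sign, and φ o 2^(t+1) is 2 φ |d k j|, where `F` is 1
      -- because its value at φ d k j is a sign.
      dyadic : ∀ {k φ} → SignPattern k φ → ∃[ φ₁ ] ∃[ s ] (0# < φ₁ × F (φ₁ * fromℕ (2 ℕ.^ s)) ≈ᶜ ℂᴿ.1# ×
               ∀ i → Active i → F (φ₁ * ι (d k i)) ≈ᶜ F (φ * ι (d k i)))
      dyadic {k} {φ} pattern-φ = φ * o , suc t , *-pos positive (fromℕ-pos (l ℕ.+ l)) , F≈1 , same
        where
        open SignPattern pattern-φ
        j = proj₁ nonconstant
        dⱼ = d k j
        dⱼ≢0 : dⱼ ≢ + 0
        dⱼ≢0 dⱼ≡0 = proj₂ (proj₂ nonconstant) (ℂᶜ.trans (F-cong (trans (*-congˡ (ι-cong dⱼ≡0)) (zeroʳ φ))) F-0)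
        nonzero : ∀ {i} → i ≢ + 0 → 1 ℕ.≤ ℤ.∣ i ∣
        nonzero {+ zero}  i≢0 = contradiction ≡.refl i≢0
        nonzero {+ suc n} i≢0 = ℕ.s≤s ℕ.z≤n
        nonzero { -[1+ n ]} i≢0 = ℕ.s≤s ℕ.z≤n
        factorisation = 2^*odd ℤ.∣ dⱼ ∣ (nonzero dⱼ≢0)
        t = proj₁ factorisation
        l = proj₁ (proj₂ factorisation)
        o = fromℕ (suc (l ℕ.+ l))
        F-double-∣∣ : ∀ i → IsSign (F (φ * ι i)) → F (φ * ι (+ ℤ.∣ i ∣) + φ * ι (+ ℤ.∣ i ∣)) ≈ᶜ ℂᴿ.1#
        F-double-∣∣ (+ n)    sign = F-double sign
        F-double-∣∣ -[1+ n ] sign = ℂᶜ.trans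
          (F-cong (solve 2 (λ p n → p :* n :+ p :* n := :- (p :* (:- n) :+ p :* (:- n))) refl φ (fromℕ (suc n))))
          (F-neg-1 (F-double sign))
        F≈1 : F (φ * o * fromℕ (2 ℕ.^ suc t)) ≈ᶜ ℂᴿ.1#
        F≈1 = ℂᶜ.trans (F-cong (begin
          φ * o * fromℕ (2 ℕ.^ suc t)
            ≈⟨ *-congˡ (trans (ι-cong (ℤ.pos-* 2 (2 ℕ.^ t))) (trans (ι-* (+ 2) (+ (2 ℕ.^ t))) (*-congʳ ι-2))) ⟩
          φ * o * (2# * fromℕ (2 ℕ.^ t))
            ≈⟨ solve 3 (λ p o q → p :* o :* ((con (+ 1) :+ con (+ 1)) :* q) := p :* (q :* o) :+ p :*
                (q :* o)) refl φ o (fromℕ (2 ℕ.^ t)) ⟩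
          φ * (fromℕ (2 ℕ.^ t) * o) + φ * (fromℕ (2 ℕ.^ t) * o) ≈⟨ +-cong split split ⟩
          φ * fromℕ ℤ.∣ dⱼ ∣ + φ * fromℕ ℤ.∣ dⱼ ∣ ∎))
          (F-double-∣∣ dⱼ (sign j (proj₁ (proj₂ nonconstant))))
          where
          open SetoidReasoning setoid
          split : φ * (fromℕ (2 ℕ.^ t) * o) ≈ φ * fromℕ ℤ.∣ dⱼ ∣
          split = *-congˡ (trans (sym (ι-*⁺ (2 ℕ.^ t) (suc (l ℕ.+ l))))
            (ι-cong (≡.trans (≡.sym (ℤ.pos-* (2 ℕ.^ t) (suc (l ℕ.+ l))))
                (≡.cong +_ (≡.sym (proj₂ (proj₂ factorisation)))))))
        same : ∀ i → Active i → F (φ * o * ι (d k i)) ≈ᶜ F (φ * ι (d k i))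
        same i active = ℂᶜ.trans (F-cong (solve 3 (λ p o d → p :* o :* d := p :* d :* o) refl φ o (ι (d k i))))
          (F-odd (sign i active) (fromℕ-odd l))

      -- The order of quantifiers matters: `t` is common to all indices and is absorbed by rescaling
      -- φ, while `u` depends on `i` and has to be removed by parity.
      OddMultiple : ℕ → ℕ → ℕ → Set
      OddMultiple t k k′ = ∀ i → Active i → ∃[ u ] (Odd u × d k i ≡ + (2 ℕ.^ t) ℤ.* u ℤ.* d k′ i)

      ι-oddMultiple : ∀ t {u i j} → i ≡ + (2 ℕ.^ t) ℤ.* u ℤ.* j → ι i ≈ fromℕ (2 ℕ.^ t) * ι u * ι j
      ι-oddMultiple t {u} {i} {j} i≡ = trans (ι-cong i≡)
        (trans (ι-* (+ (2 ℕ.^ t) ℤ.* u) j) (*-congʳ (ι-* (+ (2 ℕ.^ t)) u)))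

      -- The arguments φ₁ d k i and φ₁ 2^t d k′ i differ by the odd factor `u`. Only the value with
      -- `u` is known to be a sign, so cancelling it relies on the 2-power order supplied by
      -- `dyadic`.
      descend : ∀ t k k′ {φ} → OddMultiple t k k′ → SignPattern k φ → Realises k k′ φ
      descend t k k′ {φ} multiple pattern-φ = φ₁ * q , *-pos 0<φ₁ (2^-pos t) , λ i active →
        let u , u-odd , d≡ = multiple i active
            factor : φ₁ * ι (d k i) ≈ φ₁ * q * ι (d k′ i) * ι u
            factor = trans (*-congˡ (ι-oddMultiple t {u} {d k i} {d k′ i} d≡))
              (solve 4 (λ p q u d → p :* (q :* u :* d) := p :* q :* d :* u) refl φ₁ q (ι u) (ι (d k′ i)))
        in ℂᶜ.trans
          (F-odd-cancel s
            (ℂᶜ.trans (F-cong (trans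
                (solve 4 (λ p q d r → p :* q :* d :* r := p :* r :* (q :* d)) refl φ₁ q (ι (d k′ i)) (fromℕ (2 ℕ.^ s)))
                (*-congˡ (sym (ι-* (+ (2 ℕ.^ t)) (d k′ i))))))
              (F-*ℤ-1 F≈1 (+ (2 ℕ.^ t) ℤ.* d k′ i)))
            u-odd
            (isSign-resp (ℂᶜ.trans (ℂᶜ.sym (same i active)) (F-cong factor)) (SignPattern.sign pattern-φ i active)))
          (ℂᶜ.trans (F-cong (sym factor)) (same i active))
        where
        q = fromℕ (2 ℕ.^ t)
        reduction = dyadic pattern-φ
        φ₁ = proj₁ reduction
        s = proj₁ (proj₂ reduction)
        0<φ₁ = proj₁ (proj₂ (proj₂ reduction))
        F≈1 = proj₁ (proj₂ (proj₂ (proj₂ reduction)))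
        same = proj₂ (proj₂ (proj₂ (proj₂ reduction)))

      -- In this direction the values without `u` are the known signs, so `F-odd` inserts `u`
      -- directly and dividing φ by 2^t is enough.
      ascend : ∀ t k k′ {φ} → OddMultiple t k k′ → SignPattern k′ φ → Realises k′ k φ
      ascend t k k′ {φ} multiple pattern-φ = φ * q ⁻¹ , *-pos positive (⁻¹-pos (2^-pos t)) , λ i active →
        let u , u-odd , d≡ = multiple i active
        in ℂᶜ.trans
          (F-cong (trans (*-congˡ (ι-oddMultiple t {u} {d k i} {d k′ i} d≡))
            (trans (solve 5 (λ p r q u d → p :* r :* (q :* u :* d) := (q :* r) :* (p :* d :* u)) refl φ (q ⁻¹) q
                (ι u) (ι (d k′ i)))
              (trans (*-congʳ (⁻¹-inverseʳ q (pos⇒≉0 (2^-pos t)))) (*-identityˡ _)))))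
          (F-odd (sign i active) u-odd)
        where
        open SignPattern pattern-φ
        q = fromℕ (2 ℕ.^ t)

      odd-multiple : ∀ l → OddMultiple 0 (suc (l ℕ.+ l)) 1
      odd-multiple l i active = geometric (m i) (m i₀) k , geometric-odd (m i) m₀-odd l ,
        ≡.trans (^-difference (m i) (m i₀) k) (≡.cong₂ ℤ._*_ (≡.sym (ℤ.*-identityˡ (geometric (m i) (m i₀) k)))
          (≡.sym (≡.cong₂ ℤ._-_ (ℤ.^-identityʳ (m i)) (ℤ.^-identityʳ (m i₀)))))
        where k = suc (l ℕ.+ l)

      -- The exponent 2j is treated as the j-th power of odd squares, which are 1 mod 4.
      even-multiple : (∀ i → Active i → Odd (m i)) → ∀ j → 1 ℕ.≤ j → ∃[ t ] OddMultiple t (2 ℕ.* j) 2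
      even-multiple all-odd j 1≤j =
        let t , lift = ^-difference-1mod4 j 1≤j in t , λ i active →
          let u , u-odd , d≡ = lift (odd-square (all-odd i active)) (odd-square m₀-odd)
          in u , u-odd , ≡.trans (≡.sym (≡.cong₂ ℤ._-_ (ℤ.^-*-assoc (m i) 2 j) (ℤ.^-*-assoc (m i₀) 2 j))) d≡

      -- An even m i makes d k i odd, so after the dyadic reduction F φ₁ is a sign
      -- and only the parities of the d k i matter, which do not depend on k.
      mixed : ∀ k k′ {φ i} → Active i → Even (m i) → SignPattern (suc k) φ → Realises (suc k) (suc k′) φ
      mixed k k′ {φ} {i} active i-even pattern-φ = φ₁ , 0<φ₁ , λ j j-active → ℂᶜ.trans
        (F-cong (trans (*-congˡ (trans (ι-cong (d-split j)) (ι-+ (d (suc k′) j ℤ.- d (suc k) j) (d (suc k) j))))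
            (distribˡ _ _ _)))
        (ℂᶜ.trans (F-1+ (F-even φ₁-sign (d-parity j)) _) (same j j-active))
        where
        reduction = dyadic pattern-φ
        φ₁ = proj₁ reduction
        s = proj₁ (proj₂ reduction)
        0<φ₁ = proj₁ (proj₂ (proj₂ reduction))
        F≈1 = proj₁ (proj₂ (proj₂ (proj₂ reduction)))
        same = proj₂ (proj₂ (proj₂ (proj₂ reduction)))
        d-odd : Odd (d (suc k) i)
        d-odd = even+odd (even-*ˡ i-even (m i ℤ.^ k)) (odd-neg (odd-^ m₀-odd (suc k)))
        φ₁d-sign : IsSign (F (φ₁ * ι (d (suc k) i)))
        φ₁d-sign = isSign-resp (ℂᶜ.sym (same i active)) (SignPattern.sign pattern-φ i active)
        φ₁-sign : IsSign (F φ₁)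
        φ₁-sign = isSign-resp (ℂᶜ.sym (F-odd-cancel s F≈1 d-odd φ₁d-sign)) φ₁d-sign
        d-split : ∀ j → d (suc k′) j ≡ (d (suc k′) j ℤ.- d (suc k) j) ℤ.+ d (suc k) j
        d-split j = Z.solve 2 (λ x y → x Z.:= (x Z.:- y) Z.:+ y) ≡.refl (d (suc k′) j) (d (suc k) j)
          where module Z = ℤSolver.+-*-Solver
        d-parity : ∀ j → Even (d (suc k′) j ℤ.- d (suc k) j)
        d-parity j = ≡.subst Even
          (Z.solve 4 (λ a a′ b b′ → (a′ Z.:- a) Z.:+ (Z.:- (b′ Z.:- b)) Z.:= (a′ Z.:- b′) Z.:- (a Z.:- b)) ≡.refl
            (m j ℤ.^ suc k) (m j ℤ.^ suc k′) (m i₀ ℤ.^ suc k) (m i₀ ℤ.^ suc k′))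
          (even+even (^-parity (m j) k′ k) (even-neg (^-parity (m i₀) k′ k)))
          where module Z = ℤSolver.+-*-Solver

      all-odd-or-even : (∀ i → Active i → Odd (m i)) ⊎ ∃[ i ] (Active i × Even (m i))
      all-odd-or-even with em {∃[ i ] (Active i × Even (m i))}
      ... | yes even = inj₂ even
      ... | no  none = inj₁ λ i active → [ (λ i-even → contradiction (i , active , i-even) none) ,
              (λ i-odd → i-odd) ]′ (parity (m i))

      odd⇒1 : ∀ l {φ} → SignPattern (suc (l ℕ.+ l)) φ → Realises (suc (l ℕ.+ l)) 1 φ
      odd⇒1 l = descend 0 (suc (l ℕ.+ l)) 1 (odd-multiple l)

      1⇒odd : ∀ l {φ} → SignPattern 1 φ → Realises 1 (suc (l ℕ.+ l)) φ
      1⇒odd l = ascend 0 (suc (l ℕ.+ l)) 1 (odd-multiple l)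

      even⇒2 : ∀ j → 1 ℕ.≤ j → ∀ {φ} → SignPattern (2 ℕ.* j) φ → Realises (2 ℕ.* j) 2 φ
      -- Matching `j` as a successor makes 2 j compute to a successor, the form of exponent that
      -- `mixed` takes.
      even⇒2 j@(suc _) 1≤j pattern-φ = [ (λ all-odd → descend (proj₁ (even-multiple all-odd j 1≤j)) (2 ℕ.* j) 2
          (proj₂ (even-multiple all-odd j 1≤j)) pattern-φ) ,
                                         (λ (i , active , i-even) → mixed (ℕ.pred (2 ℕ.* j)) 1 active i-even
                                             pattern-φ) ]′ all-odd-or-even

      2⇒even : ∀ j → 1 ℕ.≤ j → ∀ {φ} → SignPattern 2 φ → Realises 2 (2 ℕ.* j) φ
      2⇒even j@(suc _) 1≤j pattern-φ = [ (λ all-odd → ascend (proj₁ (even-multiple all-odd j 1≤j)) (2 ℕ.* j) 2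
          (proj₂ (even-multiple all-odd j 1≤j)) pattern-φ) ,
                                         (λ (i , active , i-even) → mixed 1 (ℕ.pred (2 ℕ.* j)) active i-even
                                             pattern-φ) ]′ all-odd-or-even

-- State transfer in spectral terms

module StateTransfer (em : ExcludedMiddle 0ℓ) (ℝ : Reals) {n : ℕ}
                     (H : Matrices.Matrix (Reals.rawRing ℝ) n)
                     (H-sym : Matrices.Symmetric (Reals.rawRing ℝ) H) where
  open Reals ℝ hiding (zero)
  open Theory ℝ
  open RealProperties em ℝ
  open ComplexNumbers em ℝ
  open ExponentialProperties em ℝ
  open MatrixProperties commutativeRing
  open SpectralTheorem em ℝ H H-sym
  open Characters em ℝ
  open Mᴿ using (Vec; Matrix; _≋_; _*ᵛ_; _·ᵛ_; 0ᵛ; e; 1ᴹ; _^ᴹ_)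
  private
    module ℂᴹ = MatrixProperties ℂ-commutativeRing

  re-sum : ∀ {r} (z : Fin r → ℂ) → re (ℂᴹ.sum z) ≈ sum (re ∘ z)
  re-sum {zero}  z = refl
  re-sum {suc r} z = +-congˡ (re-sum (z ∘ suc))

  im-sum : ∀ {r} (z : Fin r → ℂ) → im (ℂᴹ.sum z) ≈ sum (im ∘ z)
  im-sum {zero}  z = refl
  im-sum {suc r} z = +-congˡ (im-sum (z ∘ suc))

  sum-ofℝ : ∀ {r} (x : Vec r) → ℂᴹ.sum (ofℝ ∘ x) ≈ᶜ ofℝ (sum x)
  sum-ofℝ {zero}  x = refl , refl
  sum-ofℝ {suc r} x = +-congˡ (proj₁ (sum-ofℝ (x ∘ suc))) , trans (+-identityˡ _) (proj₂ (sum-ofℝ (x ∘ suc)))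

  ⟶-sum : ∀ {r} (s : Fin r → ℕ → ℂ) (z : Fin r → ℂ) → (∀ i → s i ⟶ (z i)) → (λ N → ℂᴹ.sum λ i → s i N) ⟶ (ℂᴹ.sum z)
  ⟶-sum {zero}  s z s→z = ⟶-constant
  ⟶-sum {suc r} s z s→z = ⟶-+ (s→z zero) (⟶-sum (s ∘ suc) (z ∘ suc) (s→z ∘ suc))

  ofℝ-e : ∀ {r} (a l : Fin r) → Mᶜ.e a l ≈ᶜ ofℝ (e a l)
  ofℝ-e zero    zero    = refl , refl
  ofℝ-e zero    (suc l) = refl , refl
  ofℝ-e (suc a) zero    = refl , refl
  ofℝ-e (suc a) (suc l) = ofℝ-e a l

  column : Fin size → Fin n → Vec n
  column i a l = component i l a

  column≋ : ∀ i a → component i *ᵛ e a ≋ column i a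
  column≋ i a = *ᵛ-e (component i) a

  column-eigenvector : ∀ i a → Eigenspace H (eigenvalue i) (column i a)
  column-eigenvector i a l = trans (sym (*ᵛ-cong H (column≋ i a) l)) (trans (range i (e a) l) (*-congˡ (column≋ i a l)))

  column-sum : ∀ a l → ℂᴹ.sum (λ i → ofℝ (column i a l)) ≈ᶜ Mᶜ.e a l
  column-sum a l = ℂᶜ.trans (sum-ofℝ (λ i → column i a l))
    (ℂᶜ.trans (trans (component-sum l a) (e-sym l a) , refl) (ℂᶜ.sym (ofℝ-e a l)))

  -- Describing a power by its action on eigenvectors lets `H` itself serve as the first power,
  -- although `H ^ᴹ 1` is a different expression.
  IsPower : Matrix n → ℕ → Set
  IsPower K k = ∀ {μ y} → Eigenspace H μ y → Eigenspace K (μ ^ᴿ.^ k) y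

  ^ᴹ-isPower : ∀ k → IsPower (H ^ᴹ k) k
  ^ᴹ-isPower k Hy = ^ᴹ-eigenvector {A = H} Hy k

  isPower-1 : IsPower H 1
  isPower-1 {μ} Hy l = trans (Hy l) (*-congʳ (sym (*-identityʳ μ)))

  -- The character x ↦ exp(-ix), with the sign of the evolution built in.
  phase : Character
  phase = record
    { F      = λ x → cis (- x)
    ; F-cong = cis-cong ∘ -‿cong
    ; F-+    = λ x y → ℂᶜ.trans (cis-cong (solve 2 (λ x y → :- (x :+ y) := (:- x) :+ (:- y)) refl x y))
        (cis-+ (- x) (- y))
    ; F-0    = ℂᶜ.trans (cis-cong -0≈0) cis-0
    }
  open Character phase

  ∣F∣²≈1 : ∀ x → ∣ F x ∣² ≈ 1#
  ∣F∣²≈1 x = ∣cis∣²≈1 (- x)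

  module Evolution {K : Matrix n} {k : ℕ} (K-power : IsPower K k) (τ : Carrier) where
    A : Mᶜ.Matrix n
    A = -iτ τ Mᶜ.·ᴹ complexify K

    θ : Fin size → Carrier
    θ i = τ * eigenvalue i ^ᴿ.^ k

    α : Fin size → ℂ
    α i = 0# +i (- θ i)

    A-eigenvector : ∀ i j → A Mᶜ.*ᵛ (ofℝ ∘ column i j) Mᶜ.≋ α i Mᶜ.·ᵛ (ofℝ ∘ column i j)
    A-eigenvector i j l = begin
      ℂᴹ.sum (λ m → (-iτ τ ℂᴿ.* ofℝ (K l m)) ℂᴿ.* ofℝ (column i j m))
        ≈⟨ ℂᴹ.sum-cong-≋ (λ m → ℂᶜ.trans (ℂᶜ.*-assoc (-iτ τ) (ofℝ (K l m)) (ofℝ (column i j m)))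
            (ℂᶜ.*-congˡ (ℂᶜ.sym (ofℝ-* (K l m) (column i j m))))) ⟩
      ℂᴹ.sum (λ m → -iτ τ ℂᴿ.* ofℝ (K l m * column i j m))
        ≈⟨ ℂᴹ.*-distribˡ-sum (-iτ τ) (λ m → ofℝ (K l m * column i j m)) ⟨
      -iτ τ ℂᴿ.* ℂᴹ.sum (λ m → ofℝ (K l m * column i j m))
        ≈⟨ ℂᶜ.*-congˡ (sum-ofℝ (λ m → K l m * column i j m)) ⟩
      -iτ τ ℂᴿ.* ofℝ ((K *ᵛ column i j) l)
        ≈⟨ ℂᶜ.*-congˡ (K-power (column-eigenvector i j) l , refl) ⟩
      -iτ τ ℂᴿ.* ofℝ (eigenvalue i ^ᴿ.^ k * column i j l)
        ≈⟨ (solve 3 (λ t m y → con (+ 0) :* (m :* y) :- (:- t) :* con (+ 0) := con (+ 0) :* y :- (:- (t :* m)) :*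
            con (+ 0)) refl τ (eigenvalue i ^ᴿ.^ k) (column i j l) ,
            solve 3 (λ t m y → con (+ 0) :* con (+ 0) :+ (:- t) :* (m :* y) := con (+ 0) :* con (+ 0) :+
                (:- (t :* m)) :* y) refl τ (eigenvalue i ^ᴿ.^ k) (column i j l)) ⟩
      α i ℂᴿ.* ofℝ (column i j l) ∎
      where open SetoidReasoning ℂᶜ.setoid

    ^ᴹ-spectral : ∀ N l j → (A Mᶜ.^ᴹ N) l j ≈ᶜ ℂᴹ.sum (λ i → (α i ^ᶜ.^ N) ℂᴿ.* ofℝ (column i j l))
    ^ᴹ-spectral N l j = begin
      (A Mᶜ.^ᴹ N) l j                                                  ≈⟨ ℂᴹ.*ᵛ-e (A Mᶜ.^ᴹ N) j l ⟨
      ((A Mᶜ.^ᴹ N) Mᶜ.*ᵛ Mᶜ.e j) l                                     ≈⟨ ℂᴹ.*ᵛ-cong (A Mᶜ.^ᴹ N) (column-sum j) l ⟨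
      ((A Mᶜ.^ᴹ N) Mᶜ.*ᵛ (λ m → ℂᴹ.sum λ i → ofℝ (column i j m))) l
        ≈⟨ ℂᴹ.*ᵛ-sum (A Mᶜ.^ᴹ N) (λ i → ofℝ ∘ column i j) l ⟩
      ℂᴹ.sum (λ i → ((A Mᶜ.^ᴹ N) Mᶜ.*ᵛ (ofℝ ∘ column i j)) l)
        ≈⟨ ℂᴹ.sum-cong-≋ (λ i → ℂᴹ.^ᴹ-eigenvector {A = A} (A-eigenvector i j) N l) ⟩
      ℂᴹ.sum (λ i → (α i ^ᶜ.^ N) ℂᴿ.* ofℝ (column i j l))              ∎
      where open SetoidReasoning ℂᶜ.setoid

    -- On each eigencomponent the matrix series becomes the scalar exponential series at `α i`,
    -- whose limit is known.
    expPartialSum-spectral : ∀ N l j → expPartialSum A N l j ≈ᶜ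
      ℂᴹ.sum (λ i → Sᶜ.partialSum (Eᶜ.term (α i)) N ℂᴿ.* ofℝ (column i j l))
    expPartialSum-spectral zero    l j = ℂᶜ.sym (ℂᴹ.sum-zero (λ i → ℂᴿ.0# ℂᴿ.* ofℝ (column i j l)) (λ i → ℂᶜ.zeroˡ _))
    expPartialSum-spectral (suc N) l j = begin
      expPartialSum A N l j ℂᴿ.+ f ℂᴿ.* (A Mᶜ.^ᴹ N) l j
        ≈⟨ ℂᶜ.+-cong (expPartialSum-spectral N l j) (ℂᶜ.*-congˡ (^ᴹ-spectral N l j)) ⟩
      ℂᴹ.sum (λ i → S i ℂᴿ.* c i) ℂᴿ.+ f ℂᴿ.* ℂᴹ.sum (λ i → (α i ^ᶜ.^ N) ℂᴿ.* c i)
        ≈⟨ ℂᴹ.sum-+[] (λ i → S i ℂᴿ.* c i) f (λ i → (α i ^ᶜ.^ N) ℂᴿ.* c i) ⟨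
      ℂᴹ.sum (λ i → S i ℂᴿ.* c i ℂᴿ.+ f ℂᴿ.* ((α i ^ᶜ.^ N) ℂᴿ.* c i))
        ≈⟨ ℂᴹ.sum-cong-≋ (λ i → ℂₛ.solve 4 (λ s c f p → s ℂₛ.:* c ℂₛ.:+ f ℂₛ.:* (p ℂₛ.:* c) ℂₛ.:=
            (s ℂₛ.:+ f ℂₛ.:* p) ℂₛ.:* c) ℂᶜ.refl (S i) (c i) f (α i ^ᶜ.^ N)) ⟩
      ℂᴹ.sum (λ i → (S i ℂᴿ.+ f ℂᴿ.* (α i ^ᶜ.^ N)) ℂᴿ.* c i) ∎
      where
      open SetoidReasoning ℂᶜ.setoid
      f = ofℝ (1/ N !)
      S c : Fin size → ℂ
      S i = Sᶜ.partialSum (Eᶜ.term (α i)) N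
      c i = ofℝ (column i j l)

    U : Mᶜ.Matrix n
    U l j = ℂᴹ.sum λ i → F (θ i) ℂᴿ.* ofℝ (column i j l)

    U-isExp : IsExp A U
    U-isExp l j = ⟶-cong (λ N → ℂᶜ.sym (expPartialSum-spectral N l j))
      (⟶-sum (λ i N → Sᶜ.partialSum (Eᶜ.term (α i)) N ℂᴿ.* ofℝ (column i j l)) (λ i → F (θ i) ℂᴿ.* ofℝ (column i j l))
        (λ i → ⟶-* (exp-limit (α i)) ⟶-constant))

    Criterion : Fin n → Fin n → Set
    Criterion a b = ∃[ γ ] (∣ γ ∣² ≈ 1# × ∀ i l → F (θ i) ℂᴿ.* ofℝ (column i a l) ≈ᶜ γ ℂᴿ.* ofℝ (column i b l))

    target : ∀ γ b l → γ ℂᴿ.* Mᶜ.e b l ≈ᶜ ℂᴹ.sum (λ i → γ ℂᴿ.* ofℝ (column i b l))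
    target γ b l = ℂᶜ.trans (ℂᶜ.*-congˡ (ℂᶜ.sym (column-sum b l))) (ℂᴹ.*-distribˡ-sum γ (λ i → ofℝ (column i b l)))

    criterion⇒PSTAt : ∀ {a b} → Criterion a b → PSTAt K a b τ
    criterion⇒PSTAt {a} {b} (γ , ∣γ∣²≈1 , F≈γ) = U , U-isExp , γ ,
      (0≤1 , trans ∣γ∣²≈1 (sym (*-identityˡ 1#))) , λ l →
        ℂᶜ.trans (ℂᴹ.*ᵛ-e U a l) (ℂᶜ.trans (ℂᴹ.sum-cong-≋ (λ i → F≈γ i l)) (ℂᶜ.sym (target γ b l)))

    -- Uniqueness of limits replaces the given exponential by `U`. Independence then splits the
    -- total equation into eigencomponents; it is available for real vectors, so real and imaginary
    -- parts are compared separately, both through `match`.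
    PSTAt⇒criterion : ∀ {a b} → PSTAt K a b τ → Criterion a b
    PSTAt⇒criterion {a} {b} (V , V-isExp , γ , (_ , ∣γ∣²≈1·1) , Ve≋γe) =
      γ , trans ∣γ∣²≈1·1 (*-identityˡ 1#) , λ i l →
        ℂᶜ.trans (F-components i l) (ℂᶜ.trans (match re re-total i l , match im im-total i l)
            (ℂᶜ.sym (γ-components i l)))
      where
      F-components : ∀ i l → F (θ i) ℂᴿ.* ofℝ (column i a l) ≈ᶜ (re (F (θ i)) * column i a l) +i
          (im (F (θ i)) * column i a l)
      F-components i l = ℂᶜ.trans (ℂᶜ.*-comm _ _) (ℂᶜ.trans (ofℝ-*-components (column i a l) (F (θ i)))
          (*-comm _ _ , *-comm _ _))
      γ-components : ∀ i l → γ ℂᴿ.* ofℝ (column i b l) ≈ᶜ (re γ * column i b l) +i (im γ * column i b l)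
      γ-components i l = ℂᶜ.trans (ℂᶜ.*-comm _ _) (ℂᶜ.trans (ofℝ-*-components (column i b l) γ)
          (*-comm _ _ , *-comm _ _))
      sums : ∀ l → ℂᴹ.sum (λ i → F (θ i) ℂᴿ.* ofℝ (column i a l)) ≈ᶜ ℂᴹ.sum (λ i → γ ℂᴿ.* ofℝ (column i b l))
      sums l = ℂᶜ.trans (⟶-unique (U-isExp l a) (V-isExp l a)) (ℂᶜ.trans (ℂᶜ.sym (ℂᴹ.*ᵛ-e V a l))
          (ℂᶜ.trans (Ve≋γe l) (target γ b l)))
      re-total : ∀ l → sum (λ i → re (F (θ i)) * column i a l) ≈ sum (λ i → re γ * column i b l)
      re-total l = trans (sum-cong-≋ λ i → sym (proj₁ (F-components i l)))
          (trans (sym (re-sum λ i → F (θ i) ℂᴿ.* ofℝ (column i a l)))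
        (trans (proj₁ (sums l)) (trans (re-sum λ i → γ ℂᴿ.* ofℝ (column i b l)) (sum-cong-≋ λ i → proj₁
            (γ-components i l)))))
      im-total : ∀ l → sum (λ i → im (F (θ i)) * column i a l) ≈ sum (λ i → im γ * column i b l)
      im-total l = trans (sum-cong-≋ λ i → sym (proj₂ (F-components i l)))
          (trans (sym (im-sum λ i → F (θ i) ℂᴿ.* ofℝ (column i a l)))
        (trans (proj₂ (sums l)) (trans (im-sum λ i → γ ℂᴿ.* ofℝ (column i b l)) (sum-cong-≋ λ i → proj₂
            (γ-components i l)))))
      match : (part : ℂ → Carrier) →
        (∀ l → sum (λ i → part (F (θ i)) * column i a l) ≈ sum (λ i → part γ * column i b l)) →
        ∀ i l → part (F (θ i)) * column i a l ≈ part γ * column i b l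
      match part sums≈ i l = x-y≈0⇒x≈y (trans (solve 2 (λ x y → x :- y := x :+ (:- con (+ 1)) :* y) refl _ _)
        (eigenvectors-independent y Hy (λ l → trans (sum-+[] (λ i → part (F (θ i)) * column i a l) (- 1#)
            (λ i → part γ * column i b l))
          (trans (+-congʳ (sums≈ l)) (solve 1 (λ s → s :+ (:- con (+ 1)) :* s := con (+ 0)) refl _))) i l))
        where
        y : Fin size → Vec n
        y i = (part (F (θ i)) ·ᵛ column i a) +[ - 1# ] (part γ ·ᵛ column i b)
        Hy : ∀ i → Eigenspace H (eigenvalue i) (y i)
        Hy i l = begin
          (H *ᵛ y i) l
            ≈⟨ *ᵛ-+[] H (part (F (θ i)) ·ᵛ column i a) (- 1#) (part γ ·ᵛ column i b) l ⟩
          (H *ᵛ (part (F (θ i)) ·ᵛ column i a)) l + - 1# * (H *ᵛ (part γ ·ᵛ column i b)) l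
            ≈⟨ +-cong (trans (*ᵛ-· H (part (F (θ i))) (column i a) l) (*-congˡ (column-eigenvector i a l)))
                      (*-congˡ (trans (*ᵛ-· H (part γ) (column i b) l) (*-congˡ (column-eigenvector i b l)))) ⟩
          part (F (θ i)) * (eigenvalue i * column i a l) + - 1# * (part γ * (eigenvalue i * column i b l))
            ≈⟨ solve 5 (λ f m p g q → f :* (m :* p) :+ (:- con (+ 1)) :* (g :* (m :* q)) := m :*
                (f :* p :+ (:- con (+ 1)) :* (g :* q))) refl
                 (part (F (θ i))) (eigenvalue i) (column i a l) (part γ) (column i b l) ⟩
          eigenvalue i * y i l ∎
          where open SetoidReasoning setoid

-- Strong cospectrality and the change of exponent

module PeriodTransfer (em : ExcludedMiddle 0ℓ) (ℝ : Reals) {n : ℕ}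
                      (H : Matrices.Matrix (Reals.rawRing ℝ) n)
                      (H-sym : Matrices.Symmetric (Reals.rawRing ℝ) H)
                      {a b : Fin n} (a≢b : a ≢ b) where
  open Reals ℝ hiding (zero)
  open Theory ℝ
  open RealProperties em ℝ
  open ComplexNumbers em ℝ
  open MatrixProperties commutativeRing
  open LinearAlgebra em ℝ
  open SpectralTheorem em ℝ H H-sym
  open Characters em ℝ
  open IntegerPowers
  open StateTransfer em ℝ H H-sym
  open Mᴿ using (Vec; Matrix; _≋_; _*ᵛ_; _·ᵛ_; 0ᵛ; e; 1ᴹ; _^ᴹ_)
  open Character phase
  open CharacterProperties phase

  p q : Fin size → Vec n
  p i = column i a
  q i = column i b

  Active : Fin size → Set
  Active i = ¬ (p i ≋ 0ᵛ)

  sum-p : ∀ l → sum (λ i → p i l) ≈ e a l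
  sum-p l = trans (component-sum l a) (e-sym l a)

  sum-q : ∀ l → sum (λ i → q i l) ≈ e b l
  sum-q l = trans (component-sum l b) (e-sym l b)

  active-exists : ∃ Active
  active-exists = decidable-stable em λ none → 1≉0 (trans (sym (e-diagonal a)) (trans (sym (sum-p a))
    (sum-zero (λ i → p i a) λ i → decidable-stable em λ pia≉0 → none (i , λ p≋0 → pia≉0 (p≋0 a)))))

  -- Strong cospectrality of the two vertices: their projections agree up to the signs ω, and the
  -- phases ζ equal these signs up to a common γ. At inactive indices both projections vanish and ω
  -- is arbitrary.
  record Cospectrality (ζ : Fin size → ℂ) : Set where
    field
      ω       : Fin size → Carrier
      q≈ωp    : ∀ i l → q i l ≈ ω i * p i l
      γ       : ℂ
      ∣γ∣²≈1  : ∣ γ ∣² ≈ 1#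
      ω²≈1    : ∀ i → Active i → ω i * ω i ≈ 1#
      ζ≈ωγ    : ∀ i → Active i → ζ i ≈ᶜ ofℝ (ω i) ℂᴿ.* γ

    -- Otherwise q ≈ ω i₀ p throughout, and summing gives e b ≈ ω i₀ · e a.
    ω-nonconstant : ∀ i₀ → ∃[ j ] (Active j × ¬ (ω j ≈ ω i₀))
    ω-nonconstant i₀ = decidable-stable em λ constant →
      let q≈ω₀p : ∀ j l → q j l ≈ ω i₀ * p j l
          q≈ω₀p j l = trans (q≈ωp j l) (decidable-stable em λ ωp≉ω₀p → constant (j ,
            (λ p≋0 → ωp≉ω₀p (trans (*-congˡ (p≋0 l)) (trans (zeroʳ _) (sym (trans (*-congˡ (p≋0 l)) (zeroʳ _)))))) ,
            (λ ω≈ω₀ → ωp≉ω₀p (*-congʳ ω≈ω₀))))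
      in 1≉0 (trans (sym (e-diagonal b)) (trans (sym (sum-q b)) (trans (sum-cong-≋ λ j → q≈ω₀p j b)
           (trans (sym (*-distribˡ-sum (ω i₀) (λ j → p j b))) (trans (*-congˡ (trans (sum-p b)
               (e-off-diagonal a≢b))) (zeroʳ _))))))

  criterion⇒cospectrality : {ζ : Fin size → ℂ} → (∀ i → ∣ ζ i ∣² ≈ 1#) →
    ∃[ γ ] (∣ γ ∣² ≈ 1# × ∀ i l → ζ i ℂᴿ.* ofℝ (p i l) ≈ᶜ γ ℂᴿ.* ofℝ (q i l)) → Cospectrality ζ
  criterion⇒cospectrality {ζ} ∣ζ∣²≈1 (γ , ∣γ∣²≈1 , ζp≈γq) = record
    { ω      = ω
    ; q≈ωp   = q≈ωp
    ; γ      = γ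
    ; ∣γ∣²≈1 = ∣γ∣²≈1
    ; ω²≈1   = ω²≈1
    ; ζ≈ωγ   = ζ≈ωγ
    }
    where
    open SetoidReasoning setoid
    g = re γ
    h = im γ
    ω : Fin size → Carrier
    -- The real part of ζ i times the conjugate of γ. Multiplying ζ p = γ q by the conjugate of γ
    -- and taking real parts gives q = ω p; using the conjugate of ζ i gives p = ω q. Together they
    -- yield ω² = 1 where p is nonzero.
    ω i = re (ζ i) * g + im (ζ i) * h
    re-eq : ∀ i l → re (ζ i) * p i l ≈ g * q i l
    re-eq i l = trans (solve 3 (λ c s p → c :* p := c :* p :- s :* con (+ 0)) refl (re (ζ i)) (im (ζ i)) (p i l))
      (trans (proj₁ (ζp≈γq i l)) (solve 3 (λ c s p → c :* p :- s :* con (+ 0) := c :* p) refl g h (q i l)))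
    im-eq : ∀ i l → im (ζ i) * p i l ≈ h * q i l
    im-eq i l = trans (solve 3 (λ c s p → s :* p := c :* con (+ 0) :+ s :* p) refl (re (ζ i)) (im (ζ i)) (p i l))
      (trans (proj₂ (ζp≈γq i l)) (solve 3 (λ c s p → c :* con (+ 0) :+ s :* p := s :* p) refl g h (q i l)))
    q≈ωp : ∀ i l → q i l ≈ ω i * p i l
    q≈ωp i l = begin
      q i l                                             ≈⟨ *-identityˡ (q i l) ⟨
      1# * q i l                                        ≈⟨ *-congʳ ∣γ∣²≈1 ⟨
      (g * g + h * h) * q i l
        ≈⟨ solve 3 (λ g h q → (g :* g :+ h :* h) :* q := g :* (g :* q) :+ h :* (h :* q)) refl g h (q i l) ⟩
      g * (g * q i l) + h * (h * q i l)                 ≈⟨ +-cong (*-congˡ (re-eq i l)) (*-congˡ (im-eq i l)) ⟨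
      g * (re (ζ i) * p i l) + h * (im (ζ i) * p i l)
        ≈⟨ solve 5 (λ g h c s p → g :* (c :* p) :+ h :* (s :* p) := (c :* g :+ s :* h) :* p) refl g h (re (ζ i))
            (im (ζ i)) (p i l) ⟩
      ω i * p i l                                       ∎
    p≈ωq : ∀ i l → p i l ≈ ω i * q i l
    p≈ωq i l = begin
      p i l                                             ≈⟨ *-identityˡ (p i l) ⟨
      1# * p i l                                        ≈⟨ *-congʳ (∣ζ∣²≈1 i) ⟨
      ∣ ζ i ∣² * p i l
        ≈⟨ solve 3 (λ g h q → (g :* g :+ h :* h) :* q := g :* (g :* q) :+ h :* (h :* q)) refl (re (ζ i))
            (im (ζ i)) (p i l) ⟩
      re (ζ i) * (re (ζ i) * p i l) + im (ζ i) * (im (ζ i) * p i l)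
        ≈⟨ +-cong (*-congˡ (re-eq i l)) (*-congˡ (im-eq i l)) ⟩
      re (ζ i) * (g * q i l) + im (ζ i) * (h * q i l)
        ≈⟨ solve 5 (λ g h c s q → c :* (g :* q) :+ s :* (h :* q) := (c :* g :+ s :* h) :* q) refl g h (re (ζ i))
            (im (ζ i)) (q i l) ⟩
      ω i * q i l                                       ∎
    cancel : ∀ {i x y} → Active i → (∀ l → x * p i l ≈ y * p i l) → x ≈ y
    cancel {i} active xp≈yp = let l , pl≉0 = ≉0⇒entry {x = p i} active in
      *-cancelˡ pl≉0 (trans (*-comm _ _) (trans (xp≈yp l) (*-comm _ _)))
    ω²≈1 : ∀ i → Active i → ω i * ω i ≈ 1#
    ω²≈1 i active = cancel active λ l → trans (*-assoc _ _ _) (trans (*-congˡ (sym (q≈ωp i l)))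
        (trans (sym (p≈ωq i l)) (sym (*-identityˡ _))))
    ζ≈ωγ : ∀ i → Active i → ζ i ≈ᶜ ofℝ (ω i) ℂᴿ.* γ
    ζ≈ωγ i active = ℂᶜ.trans
      (cancel active (λ l → trans (re-eq i l) (trans (*-congˡ (q≈ωp i l)) (swap g l))) ,
       cancel active (λ l → trans (im-eq i l) (trans (*-congˡ (q≈ωp i l)) (swap h l))))
      (ℂᶜ.sym (ofℝ-*-components (ω i) γ))
      where
      swap : ∀ x l → x * (ω i * p i l) ≈ ω i * x * p i l
      swap x l = solve 3 (λ x w p → x :* (w :* p) := w :* x :* p) refl x (ω i) (p i l)

  HasIntegerSpectrum : Carrier → (Fin size → ℤ) → Set
  HasIntegerSpectrum c m = ∀ i → Active i → eigenvalue i ≈ c * ι (m i)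

  fromℤ≈ι : ∀ i → fromℤ i ≈ ι i
  fromℤ≈ι (+ n)    = refl
  fromℤ≈ι -[1+ n ] = refl

  integer-spectrum : ∀ {c} → (supp H (e a) ∪ supp H (e b)) ⊆ (c ·ℤ) → ∃ (HasIntegerSpectrum c)
  integer-spectrum {c} supp⊆cℤ = (λ i → proj₁ (choose i)) , λ i → proj₂ (choose i)
    where
    choose : ∀ i → Σ[ m ∈ ℤ ] (Active i → eigenvalue i ≈ c * ι m)
    choose i with em {Active i}
    -- An arbitrary value, as the condition concerns active indices only.
    ... | no  inactive = + 0 , λ active → contradiction active inactive
    ... | yes active   = let m , λ≈cm = supp⊆cℤ (inj₁ in-support) in m , λ _ → trans λ≈cm (*-congˡ (fromℤ≈ι m))
      where
      nonzero : ¬ (component i *ᵛ e a ≋ 0ᵛ)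
      nonzero ≋0 = active λ l → trans (sym (column≋ i a l)) (≋0 l)
      in-support : supp H (e a) (eigenvalue i)
      in-support = (component i *ᵛ e a , nonzero , range i (e a)) , component i , component-isEigenprojection i ,
          nonzero

  -- Divide the integers by 2 until one of them is odd; this terminates since m j ≢ 0.
  make-odd : ∀ N {c m j} → 0# < c → HasIntegerSpectrum c m → Active j → m j ≢ + 0 → ℤ.∣ m j ∣ ℕ.≤ N →
    ∃[ c′ ] ∃[ m′ ] (0# < c′ × HasIntegerSpectrum c′ m′ × ∃[ i₀ ] (Active i₀ × Odd (m′ i₀)))
  make-odd N {c} {m} {j} 0<c m-spec j-active mj≢0 ∣mj∣≤N with em {∃[ i ] (Active i × Odd (m i))}
  ... | yes odd = c , m , 0<c , m-spec , odd
  ... | no  none = halve N ∣mj∣≤N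
    where
    m′ : Fin size → ℤ
    -- For odd `m i` this is the half rounded down; among active indices that case is excluded by
    -- `none`.
    m′ i = [ proj₁ , proj₁ ]′ (parity (m i))
    m≡2m′ : ∀ i → Active i → m i ≡ + 2 ℤ.* m′ i
    m≡2m′ i active with parity (m i)
    ... | inj₁ (w , m≡2w) = m≡2w
    ... | inj₂ m-odd      = contradiction (i , active , m-odd) none
    m′-spec : HasIntegerSpectrum (2# * c) m′
    m′-spec i active = trans (m-spec i active) (trans (*-congˡ (trans (ι-cong (m≡2m′ i active))
        (trans (ι-* (+ 2) (m′ i)) (*-congʳ ι-2))))
      (solve 2 (λ c w → c :* ((con (+ 1) :+ con (+ 1)) :* w) := (con (+ 1) :+ con (+ 1)) :* c :* w) refl c (ι (m′ i))))
    m′j≢0 : m′ j ≢ + 0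
    m′j≢0 m′j≡0 = mj≢0 (≡.trans (m≡2m′ j j-active) (≡.cong (+ 2 ℤ.*_) m′j≡0))
    ∣mj∣≡ : ℤ.∣ m j ∣ ≡ 2 ℕ.* ℤ.∣ m′ j ∣
    ∣mj∣≡ = ≡.trans (≡.cong ℤ.∣_∣ (m≡2m′ j j-active)) (ℤ.abs-* (+ 2) (m′ j))
    halve : ∀ N → ℤ.∣ m j ∣ ℕ.≤ N → ∃[ c′ ] ∃[ m′ ] (0# < c′ × HasIntegerSpectrum c′ m′ × ∃[ i₀ ] (Active i₀ × Odd
        (m′ i₀)))
    halve zero    ∣mj∣≤0 = contradiction (ℤ.∣i∣≡0⇒i≡0 (ℕ.n≤0⇒n≡0 ∣mj∣≤0)) mj≢0
    halve (suc N) ∣mj∣≤N = make-odd N {m = m′} (*-pos 0<2 0<c) m′-spec j-active m′j≢0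
      (ℕ.s≤s⁻¹ (ℕ.≤-trans (ℕ.m<m+n ℤ.∣ m′ j ∣ (ℕ.≤-trans (ℕ.n≢0⇒n>0 (m′j≢0 ∘ ℤ.∣i∣≡0⇒i≡0)) (ℕ.m≤m+n _ _)))
        (ℕ.≤-trans (ℕ.≤-reflexive (≡.sym ∣mj∣≡)) ∣mj∣≤N)))

  ^-pos : ∀ {x} → 0# < x → ∀ k → 0# < x ^ᴿ.^ k
  ^-pos 0<x zero    = 0<1
  ^-pos 0<x (suc k) = *-pos 0<x (^-pos 0<x k)

  *ι-^ : ∀ c i k → (c * ι i) ^ᴿ.^ k ≈ c ^ᴿ.^ k * ι (i ℤ.^ k)
  *ι-^ c i zero    = solve 0 (con (+ 1) := con (+ 1) :* (con (+ 1) :+ con (+ 0))) refl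
  *ι-^ c i (suc k) = trans (*-congˡ (*ι-^ c i k))
    (trans (solve 4 (λ c i d j → (c :* i) :* (d :* j) := (c :* d) :* (i :* j)) refl c (ι i) (c ^ᴿ.^ k) (ι (i ℤ.^ k)))
      (*-congˡ (sym (ι-* i (i ℤ.^ k)))))

  eigenvalue-^ : ∀ {c m} → HasIntegerSpectrum c m → ∀ τ k i → Active i →
                 τ * eigenvalue i ^ᴿ.^ k ≈ τ * c ^ᴿ.^ k * ι (m i ℤ.^ k)
  eigenvalue-^ {c} {m} m-spec τ k i active = trans
    (*-congˡ (trans (^ᴿ.^-congˡ k (m-spec i active)) (*ι-^ c (m i) k))) (sym (*-assoc _ _ _))

  -- Quantified over all families because the integers and the reference index are found only after
  -- a transfer time has been given.
  Transferable : ℕ → ℕ → Set₁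
  Transferable k k′ = ∀ {I : Set} (Active : I → Set) m i₀ m₀-odd {φ} →
    Family.SignPattern Active m i₀ m₀-odd k φ → Family.Realises Active m i₀ m₀-odd k k′ φ

  module Transfer {c m} (0<c : 0# < c) (m-spec : HasIntegerSpectrum c m) {i₀} (i₀-active : Active i₀)
      (m₀-odd : Odd (m i₀)) where
    open Family Active m i₀ m₀-odd

    F-d : ∀ φ k i → F (φ * ι (d k i)) ℂᴿ.* F (φ * ι (m i₀ ℤ.^ k)) ≈ᶜ F (φ * ι (m i ℤ.^ k))
    F-d φ k i = ℂᶜ.trans (ℂᶜ.sym (F-+ _ _)) (F-cong (trans
      (+-congʳ (*-congˡ (trans (ι-+ (m i ℤ.^ k) (ℤ.- (m i₀ ℤ.^ k))) (+-congˡ (ι-neg (m i₀ ℤ.^ k))))))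
      (solve 3 (λ p x y → p :* (x :- y) :+ p :* y := p :* x) refl φ (ι (m i ℤ.^ k)) (ι (m i₀ ℤ.^ k)))))

    module _ {τ k} (0<τ : 0# < τ) (cospectral : Cospectrality λ i → F (τ * eigenvalue i ^ᴿ.^ k)) where
      open Cospectrality cospectral

      φ : Carrier
      φ = τ * c ^ᴿ.^ k

      -- Dividing the phase relation at `i` by the one at `i₀` removes γ, and `ω i₀` is its own
      -- inverse.
      F-φd : ∀ i → Active i → F (φ * ι (d k i)) ≈ᶜ ofℝ (ω i * ω i₀)
      F-φd i active = begin
        X                                                   ≈⟨ ℂᶜ.*-identityʳ X ⟨
        X ℂᴿ.* ℂᴿ.1#                                        ≈⟨ ℂᶜ.*-congˡ unit ⟨
        X ℂᴿ.* ((w₀ ℂᴿ.* γ) ℂᴿ.* (w₀ ℂᴿ.* conj γ))          ≈⟨ ℂᶜ.*-assoc _ _ _ ⟨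
        (X ℂᴿ.* (w₀ ℂᴿ.* γ)) ℂᴿ.* (w₀ ℂᴿ.* conj γ)          ≈⟨ ℂᶜ.*-congʳ relation ⟩
        (ofℝ (ω i) ℂᴿ.* γ) ℂᴿ.* (w₀ ℂᴿ.* conj γ)
          ≈⟨ ℂₛ.solve 4 (λ w g v g′ → (w ℂₛ.:* g) ℂₛ.:* (v ℂₛ.:* g′) ℂₛ.:= (w ℂₛ.:* v) ℂₛ.:* (g ℂₛ.:* g′)) ℂᶜ.refl
              (ofℝ (ω i)) γ w₀ (conj γ) ⟩
        (ofℝ (ω i) ℂᴿ.* w₀) ℂᴿ.* (γ ℂᴿ.* conj γ)            ≈⟨ ℂᶜ.*-cong (ℂᶜ.sym (ofℝ-* (ω i) (ω i₀))) γγ*≈1 ⟩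
        ofℝ (ω i * ω i₀) ℂᴿ.* ℂᴿ.1#                         ≈⟨ ℂᶜ.*-identityʳ _ ⟩
        ofℝ (ω i * ω i₀)                                    ∎
        where
        open SetoidReasoning ℂᶜ.setoid
        X = F (φ * ι (d k i))
        w₀ = ofℝ (ω i₀)
        γγ*≈1 : γ ℂᴿ.* conj γ ≈ᶜ ℂᴿ.1#
        γγ*≈1 = trans (solve 2 (λ g h → g :* g :- h :* (:- h) := g :* g :+ h :* h) refl (re γ) (im γ)) ∣γ∣²≈1 ,
                solve 2 (λ g h → g :* (:- h) :+ h :* g := con (+ 0)) refl (re γ) (im γ)
        unit : (w₀ ℂᴿ.* γ) ℂᴿ.* (w₀ ℂᴿ.* conj γ) ≈ᶜ ℂᴿ.1#
        unit = ℂᶜ.trans (ℂₛ.solve 3 (λ w g g′ → (w ℂₛ.:* g) ℂₛ.:* (w ℂₛ.:* g′) ℂₛ.:= (w ℂₛ.:* w) ℂₛ.:*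
            (g ℂₛ.:* g′)) ℂᶜ.refl w₀ γ (conj γ))
          (ℂᶜ.trans (ℂᶜ.*-cong (ℂᶜ.trans (ℂᶜ.sym (ofℝ-* (ω i₀) (ω i₀))) (ω²≈1 i₀ i₀-active , refl)) γγ*≈1)
              (ℂᶜ.*-identityˡ _))
        F-φm : ∀ i → Active i → F (φ * ι (m i ℤ.^ k)) ≈ᶜ ofℝ (ω i) ℂᴿ.* γ
        F-φm i active = ℂᶜ.trans (F-cong (sym (eigenvalue-^ {m = m} m-spec τ k i active))) (ζ≈ωγ i active)
        relation : X ℂᴿ.* (w₀ ℂᴿ.* γ) ≈ᶜ ofℝ (ω i) ℂᴿ.* γ
        relation = ℂᶜ.trans (ℂᶜ.*-congˡ (ℂᶜ.sym (F-φm i₀ i₀-active))) (ℂᶜ.trans (F-d φ k i) (F-φm i active))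

      signPattern : SignPattern k φ
      signPattern = record
        { positive    = *-pos 0<τ (^-pos 0<c k)
        ; sign        = λ i active → isSign-resp (ℂᶜ.sym (F-φd i active)) (ℂᶜ.trans (ℂᶜ.sym (ofℝ-* _ _))
            (trans (solve 2 (λ x y → (x :* y) :* (x :* y) := (x :* x) :* (y :* y)) refl (ω i) (ω i₀))
              (trans (*-cong (ω²≈1 i active) (ω²≈1 i₀ i₀-active)) (*-identityˡ 1#)) , refl))
        ; nonconstant = let j , active , ωj≉ω₀ = ω-nonconstant i₀ in j , active , λ F≈1 → ωj≉ω₀ (begin
            ω j                     ≈⟨ *-identityʳ _ ⟨
            ω j * 1#                ≈⟨ *-congˡ (ω²≈1 i₀ i₀-active) ⟨
            ω j * (ω i₀ * ω i₀)     ≈⟨ *-assoc _ _ _ ⟨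
            ω j * ω i₀ * ω i₀       ≈⟨ *-congʳ (trans (sym (proj₁ (F-φd j active))) (proj₁ F≈1)) ⟩
            1# * ω i₀               ≈⟨ *-identityˡ _ ⟩
            ω i₀                    ∎)
        }
        where open SetoidReasoning setoid

      transferred : ∀ {k′} → Realises k k′ φ → ∃[ τ′ ] (0# < τ′ × ∃[ γ′ ] (∣ γ′ ∣² ≈ 1# ×
        ∀ i l → F (τ′ * eigenvalue i ^ᴿ.^ k′) ℂᴿ.* ofℝ (p i l) ≈ᶜ γ′ ℂᴿ.* ofℝ (q i l)))
      transferred {k′} (φ′ , 0<φ′ , F′≈F) = τ′ , *-pos 0<φ′ (⁻¹-pos (^-pos 0<c k′)) , γ′ , ∣γ′∣²≈1 , match
        where
        open SetoidReasoning ℂᶜ.setoid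
        cᵏ′ = c ^ᴿ.^ k′
        τ′ = φ′ * cᵏ′ ⁻¹
        F₀ = F (φ′ * ι (m i₀ ℤ.^ k′))
        w₀ = ofℝ (ω i₀)
        -- Forced by the reference index: there F₀ p = γ′ q with q = ω i₀ p, and `ω i₀` is its own
        -- inverse.
        γ′ = F₀ ℂᴿ.* w₀
        ∣γ′∣²≈1 : ∣ γ′ ∣² ≈ 1#
        ∣γ′∣²≈1 = trans
          (solve 3 (λ x y w → let r = x :* w :- y :* con (+ 0); s = x :* con (+ 0) :+ y :* w in
            r :* r :+ s :* s := (x :* x :+ y :* y) :* (w :* w)) refl (re F₀) (im F₀) (ω i₀))
          (trans (*-cong (∣F∣²≈1 (φ′ * ι (m i₀ ℤ.^ k′))) (ω²≈1 i₀ i₀-active)) (*-identityˡ 1#))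
        τ′c≈φ′ : τ′ * cᵏ′ ≈ φ′
        τ′c≈φ′ = trans (*-assoc _ _ _) (trans (*-congˡ (⁻¹-inverseˡ cᵏ′ (pos⇒≉0 (^-pos 0<c k′)))) (*-identityʳ φ′))
        match : ∀ i l → F (τ′ * eigenvalue i ^ᴿ.^ k′) ℂᴿ.* ofℝ (p i l) ≈ᶜ γ′ ℂᴿ.* ofℝ (q i l)
        match i l = by-activity em
          where
          by-activity : Dec (Active i) → F (τ′ * eigenvalue i ^ᴿ.^ k′) ℂᴿ.* ofℝ (p i l) ≈ᶜ γ′ ℂᴿ.* ofℝ (q i l)
          by-activity (no inactive) = ℂᶜ.trans (ℂᶜ.trans (ℂᶜ.*-congˡ (p≈0 , refl)) (ℂᶜ.zeroʳ _))
              (ℂᶜ.sym (ℂᶜ.trans (ℂᶜ.*-congˡ (trans (q≈ωp i l) (trans (*-congˡ p≈0) (zeroʳ _)) , refl)) (ℂᶜ.zeroʳ _)))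
            where
            p≈0 : p i l ≈ 0#
            p≈0 = decidable-stable em λ pil≉0 → inactive λ p≋0 → pil≉0 (p≋0 l)
          by-activity (yes active) = begin
            F (τ′ * eigenvalue i ^ᴿ.^ k′) ℂᴿ.* P
              ≈⟨ ℂᶜ.*-congʳ (F-cong (trans (eigenvalue-^ {m = m} m-spec τ′ k′ i active) (*-congʳ τ′c≈φ′))) ⟩
            F (φ′ * ι (m i ℤ.^ k′)) ℂᴿ.* P                    ≈⟨ ℂᶜ.*-congʳ (F-d φ′ k′ i) ⟨
            (F (φ′ * ι (d k′ i)) ℂᴿ.* F₀) ℂᴿ.* P
              ≈⟨ ℂᶜ.*-congʳ (ℂᶜ.*-congʳ (ℂᶜ.trans (F′≈F i active) (ℂᶜ.trans (F-φd i active) (ofℝ-* (ω i)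
                  (ω i₀))))) ⟩
            ((ofℝ (ω i) ℂᴿ.* w₀) ℂᴿ.* F₀) ℂᴿ.* P
              ≈⟨ ℂₛ.solve 4 (λ w v f p → w ℂₛ.:* v ℂₛ.:* f ℂₛ.:* p ℂₛ.:= (f ℂₛ.:* v) ℂₛ.:* (w ℂₛ.:* p)) ℂᶜ.refl
                  (ofℝ (ω i)) w₀ F₀ P ⟩
            γ′ ℂᴿ.* (ofℝ (ω i) ℂᴿ.* P)                        ≈⟨ ℂᶜ.*-congˡ (ofℝ-* (ω i) (p i l)) ⟨
            γ′ ℂᴿ.* ofℝ (ω i * p i l)                         ≈⟨ ℂᶜ.*-congˡ (sym (q≈ωp i l) , refl) ⟩
            γ′ ℂᴿ.* ofℝ (q i l)                               ∎
            where P = ofℝ (p i l)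

  module _ {c₀} (0<c₀ : 0# < c₀) (supp⊆cℤ : (supp H (e a) ∪ supp H (e b)) ⊆ (c₀ ·ℤ)) where

    -- Active indices with different signs are different, so their eigenvalues are distinct and
    -- cannot both be 0. The resulting nonzero integer is what makes repeated halving stop.
    cospectrality⇒odd : ∀ {τ k} → Cospectrality (λ i → F (τ * eigenvalue i ^ᴿ.^ k)) →
      ∃[ c ] ∃[ m ] (0# < c × HasIntegerSpectrum c m × ∃[ i₀ ] (Active i₀ × Odd (m i₀)))
    cospectrality⇒odd {τ} {k} cospectral = by-zero (m i ℤ.≟ + 0) (m j ℤ.≟ + 0)
      where
      open Cospectrality cospectral
      i = proj₁ active-exists
      i-active = proj₂ active-exists
      j = proj₁ (ω-nonconstant i)
      j-active = proj₁ (proj₂ (ω-nonconstant i))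
      ωj≉ωi = proj₂ (proj₂ (ω-nonconstant i))
      m : Fin size → ℤ
      m = proj₁ (integer-spectrum supp⊆cℤ)
      m-spec : HasIntegerSpectrum c₀ m
      m-spec = proj₂ (integer-spectrum supp⊆cℤ)
      λj≈λi : m i ≡ + 0 → m j ≡ + 0 → eigenvalue j ≈ eigenvalue i
      λj≈λi mi≡0 mj≡0 = trans (m-spec j j-active) (trans (*-congˡ (ι-cong (≡.trans mj≡0 (≡.sym mi≡0))))
          (sym (m-spec i i-active)))
      by-zero : Dec (m i ≡ + 0) → Dec (m j ≡ + 0) →
                ∃[ c ] ∃[ m ] (0# < c × HasIntegerSpectrum c m × ∃[ i₀ ] (Active i₀ × Odd (m i₀)))
      by-zero (no mi≢0)  _          = make-odd ℤ.∣ m i ∣ {m = m} 0<c₀ m-spec i-active mi≢0 ℕ.≤-refl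
      by-zero (yes _)    (no mj≢0)  = make-odd ℤ.∣ m j ∣ {m = m} 0<c₀ m-spec j-active mj≢0 ℕ.≤-refl
      by-zero (yes mi≡0) (yes mj≡0) = contradiction
        (reflexive (≡.cong ω (decidable-stable em λ j≢i → distinct j≢i (λj≈λi mi≡0 mj≡0)))) ωj≉ωi

    transfer : ∀ {K K′} k k′ → IsPower K k → IsPower K′ k′ → Transferable k k′ → PST K a b → PST K′ a b
    transfer {K} {K′} k k′ K-power K′-power transferable (τ , 0<τ , pst) = from-cospectrality
      (criterion⇒cospectrality (λ i → ∣F∣²≈1 (τ * eigenvalue i ^ᴿ.^ k)) (Evolution.PSTAt⇒criterion {K} {k} K-power
          τ {a} {b} pst))
      where
      to-PST : (∃[ τ′ ] (0# < τ′ × Evolution.Criterion {K′} {k′} K′-power τ′ a b)) → PST K′ a b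
      to-PST (τ′ , 0<τ′ , criterion) = τ′ , 0<τ′ , Evolution.criterion⇒PSTAt {K′} {k′} K′-power τ′ {a} {b} criterion
      from-odd : Cospectrality (λ i → F (τ * eigenvalue i ^ᴿ.^ k)) →
        ∃[ c ] ∃[ m ] (0# < c × HasIntegerSpectrum c m × ∃[ i₀ ] (Active i₀ × Odd (m i₀))) → PST K′ a b
      from-odd cospectral (c , m , 0<c , m-spec , i₀ , i₀-active , m₀-odd) =
        to-PST (Transfer.transferred {c} {m} 0<c m-spec {i₀} i₀-active m₀-odd {τ} {k} 0<τ cospectral {k′}
          (transferable Active m i₀ m₀-odd (Transfer.signPattern {c} {m} 0<c m-spec {i₀} i₀-active m₀-odd {τ} {k}
              0<τ cospectral)))
      from-cospectrality : Cospectrality (λ i → F (τ * eigenvalue i ^ᴿ.^ k)) → PST K′ a b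
      from-cospectrality cospectral = from-odd cospectral (cospectrality⇒odd {τ} {k} cospectral)

-- Parity classes of exponents

module OddEvenPowers where
  l+l≡2*l : ∀ l → l ℕ.+ l ≡ 2 ℕ.* l
  l+l≡2*l l = ≡.cong (l ℕ.+_) (≡.sym (ℕ.+-identityʳ l))

  1+l+l≡2*l+1 : ∀ l → suc (l ℕ.+ l) ≡ 2 ℕ.* l ℕ.+ 1
  1+l+l≡2*l+1 l = ≡.trans (≡.cong suc (l+l≡2*l l)) (ℕ.+-comm 1 (2 ℕ.* l))

  2ℕ+1⊆ℕ⁺ : ∀ {k} → k ∈ 2ℕ+1 → k ∈ ℕ⁺
  2ℕ+1⊆ℕ⁺ (l , ≡.refl) = ℕ.m≤n+m 1 (2 ℕ.* l)

  2ℕ⁺⊆ℕ⁺ : ∀ {k} → k ∈ 2ℕ⁺ → k ∈ ℕ⁺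
  2ℕ⁺⊆ℕ⁺ (l , 1≤l , ≡.refl) = ℕ.≤-trans 1≤l (ℕ.m≤m+n l _)

  odd-or-even : ∀ {k} → k ∈ ℕ⁺ → k ∈ 2ℕ+1 ⊎ k ∈ 2ℕ⁺
  odd-or-even {k} 1≤k with IntegerPowers.half k
  ... | inj₁ (suc l , k≡) = inj₂ (suc l , ℕ.s≤s ℕ.z≤n , ≡.trans k≡ (l+l≡2*l (suc l)))
  ... | inj₂ (l , k≡)     = inj₁ (l , ≡.trans k≡ (1+l+l≡2*l+1 l))
  odd-or-even () | inj₁ (zero , ≡.refl)

  -- On each parity class, membership in `P` is one proposition independent of k, so the truth
  -- values of `Odd` and `Even` leave four cases.
  classify : ∀ {P : Pred ℕ 0ℓ} {Odd Even : Set} → Dec Odd → Dec Even → (∀ {k} → P k → k ∈ ℕ⁺) →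
    (∀ {k} → k ∈ 2ℕ+1 → P k ⇔ Odd) → (∀ {k} → k ∈ 2ℕ⁺ → P k ⇔ Even) →
    P ≐ ∅ ⊎ P ≐ 2ℕ+1 ⊎ P ≐ 2ℕ⁺ ⊎ P ≐ ℕ⁺
  classify {P} {Odd} {Even} odd? even? P⊆ℕ⁺ P⇔Odd P⇔Even = cases odd? even?
    where
    open Equivalence
    odd∈ : ∀ {k} → k ∈ 2ℕ+1 → Odd → P k
    odd∈ k-odd = from (P⇔Odd k-odd)
    even∈ : ∀ {k} → k ∈ 2ℕ⁺ → Even → P k
    even∈ k-even = from (P⇔Even k-even)
    split : ∀ {k} → P k → (k ∈ 2ℕ+1 × Odd) ⊎ (k ∈ 2ℕ⁺ × Even)
    split k∈P = [ (λ k-odd → inj₁ (k-odd , to (P⇔Odd k-odd) k∈P)) , (λ k-even → inj₂ (k-even , to (P⇔Even k-even)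
        k∈P)) ]′
      (odd-or-even (P⊆ℕ⁺ k∈P))
    cases : Dec Odd → Dec Even → P ≐ ∅ ⊎ P ≐ 2ℕ+1 ⊎ P ≐ 2ℕ⁺ ⊎ P ≐ ℕ⁺
    cases (no ¬o)  (no ¬e)  = inj₁ ((λ k∈P → [ (λ (_ , o) → ¬o o) , (λ (_ , e) → ¬e e) ]′ (split k∈P)) , λ ())
    cases (yes o)  (no ¬e)  = inj₂ (inj₁ ((λ k∈P → [ proj₁ , (λ (_ , e) → contradiction e ¬e) ]′ (split k∈P)) ,
        λ k-odd → odd∈ k-odd o))
    cases (no ¬o)  (yes e)  = inj₂ (inj₂ (inj₁ ((λ k∈P → [ (λ (_ , o) → contradiction o ¬o) , proj₁ ]′
        (split k∈P)) , λ k-even → even∈ k-even e)))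
    cases (yes o)  (yes e)  = inj₂ (inj₂ (inj₂ (P⊆ℕ⁺ , λ 1≤k → [ (λ k-odd → odd∈ k-odd o) ,
        (λ k-even → even∈ k-even e) ]′ (odd-or-even 1≤k))))

theorem1p1 :
  ExcludedMiddle 0ℓ →
  (ℝ : Reals) →
  let open Reals ℝ
      open Theory ℝ
      open Mᴿ
  in
  (n : ℕ) (H : Matrix n) → Symmetric H →
  (a b : Fin n) → a ≢ b →
  ∃[ c ] (0# < c × (supp H (e a) ∪ supp H (e b)) ⊆ (c ·ℤ)) →
  (∀ k → k ∈ ℕ⁺ →
    (k ∈ 2ℕ+1 → PST (H ^ᴹ k) a b ⇔ PST H a b) ×
    (k ∈ 2ℕ⁺ → PST (H ^ᴹ k) a b ⇔ PST (H ^ᴹ 2) a b)) ×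
  (𝒦 H a b ≐ ∅ ⊎ 𝒦 H a b ≐ 2ℕ+1 ⊎ 𝒦 H a b ≐ 2ℕ⁺ ⊎ 𝒦 H a b ≐ ℕ⁺)
theorem1p1 em ℝ n H H-sym a b a≢b (c , 0<c , supp⊆cℤ) =
  (λ k 1≤k → odd-power , even-power) ,
  classify em em proj₁
    (λ k-odd → mk⇔ (λ (_ , pst) → Equivalence.to (odd-power k-odd) pst) (λ pst → 2ℕ+1⊆ℕ⁺ k-odd , Equivalence.from
        (odd-power k-odd) pst))
    (λ k-even → mk⇔ (λ (_ , pst) → Equivalence.to (even-power k-even) pst) (λ pst → 2ℕ⁺⊆ℕ⁺ k-even ,
        Equivalence.from (even-power k-even) pst))
  where
  open Theory ℝ
  open Mᴿ using (_^ᴹ_)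
  open OddEvenPowers
  open StateTransfer em ℝ H H-sym using (phase; ^ᴹ-isPower; isPower-1)
  open PeriodTransfer em ℝ H H-sym a≢b
  open Characters em ℝ using (module CharacterProperties)
  module Family = CharacterProperties.Family phase

  odd-power : ∀ {k} → k ∈ 2ℕ+1 → PST (H ^ᴹ k) a b ⇔ PST H a b
  odd-power {k} (l , k≡2l+1) = mk⇔
    (transfer 0<c supp⊆cℤ {H ^ᴹ k} {H} k 1 (^ᴹ-isPower k) isPower-1
      (≡.subst (λ k → Transferable k 1) k≡ λ Active m i₀ m₀-odd → Family.odd⇒1 Active m i₀ m₀-odd l))
    (transfer 0<c supp⊆cℤ {H} {H ^ᴹ k} 1 k isPower-1 (^ᴹ-isPower k)
      (≡.subst (Transferable 1) k≡ λ Active m i₀ m₀-odd → Family.1⇒odd Active m i₀ m₀-odd l))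
    where
    k≡ : suc (l ℕ.+ l) ≡ k
    k≡ = ≡.trans (1+l+l≡2*l+1 l) (≡.sym k≡2l+1)

  even-power : ∀ {k} → k ∈ 2ℕ⁺ → PST (H ^ᴹ k) a b ⇔ PST (H ^ᴹ 2) a b
  even-power (j , 1≤j , ≡.refl) = mk⇔
    (transfer 0<c supp⊆cℤ {H ^ᴹ (2 ℕ.* j)} {H ^ᴹ 2} (2 ℕ.* j) 2 (^ᴹ-isPower (2 ℕ.* j)) (^ᴹ-isPower 2)
      λ Active m i₀ m₀-odd → Family.even⇒2 Active m i₀ m₀-odd j 1≤j)
    (transfer 0<c supp⊆cℤ {H ^ᴹ 2} {H ^ᴹ (2 ℕ.* j)} 2 (2 ℕ.* j) (^ᴹ-isPower 2) (^ᴹ-isPower (2 ℕ.* j))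
      λ Active m i₀ m₀-odd → Family.2⇒even Active m i₀ m₀-odd j 1≤j)
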